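{- Let $r$ be a positive integer. There exists a shape datum $(b_{\mu,\nu})_{\mu,\nu\in\mathbf{Y}}$ for $(\mathbf{Y},\leftharpoondown_r,\mathbb{N}^r)$ determined by the requirement that, for $\kappa\in\mathbf{Y}$ with $\mu\leftharpoondown_r\kappa$ and $\nu\leftharpoondown_r\kappa$, $(a,\lambda)=b_{\mu,\nu}(\kappa)$ holds if and only if $\left(\binom{\delta(\lambda)\ \delta(\mu)}{\delta(\nu)\ \delta(\kappa)},a,0\right)$ is a basic square configuration. Moreover, in that case one has $$\mathrm{spin}(\kappa/\mu)+\mathrm{spin}(\kappa/\nu)=\mathrm{spin}(\mu/\lambda)+\mathrm{spin}(\nu/\lambda)+\mathrm{n}(a).$$
   Context: $\mathbb{N}=\{0,1,2,\dots\}$. Elements of $\mathbb{N}^r$ have components indexed by $0,\dots,r-1$; for $a\in\mathbb{N}^r$ put $|a|=\sum_{i=0}^{r-1}a_i$ and $\mathrm{n}(a)=\sum_{i=0}^{r-1}i\,a_i$; $e_h$ ($0\le h<r$) is the standard basis vector with $1$ in component $h$. Bit sequences. A bit sequence is a map $s:\mathbb{Z}\to\{0,1\}$, $i\mapsto s_i$. For bit sequences $s,t$, $t/s$ is a horizontal $r$-ribbon strip, written $s\leftharpoondown_r t$, if there is a bit sequence $w$ (it is then unique, and called the witness for $s\leftharpoondown_r t$) such that for all $i\in\mathbb{Z}$, $(w_{i-r},t_{i-r},s_i,w_i)\in\{(a,a,b,b):a,b\in\{0,1\}\}\cup\{(1,0,0,1)\}$, with $(1,0,0,1)$ occurring for only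 finitely many $i$. Let $I(t/s)$ be the set of $i$ with $(w_{i-r},t_{i-r},s_i,w_i)=(1,0,0,1)$; for $i\in I(t/s)$ one says that $t/s$ has an $r$-ribbon at position $i$, of height $\sum_{j=1}^{r-1}w_{i-j}$. Put $\mathrm{spin}(t/s)=\frac12\sum_{i\in I(t/s)}\sum_{j=1}^{r-1}w_{i-j}$. Basic square configurations. Let $l,m,n,k$ be bit sequences and $a_\ll,a_\gg\in\mathbb{N}^r$. Then $\left(\binom{l\ m}{n\ k},a_\ll,a_\gg\right)$ is a basic square configuration if $m/l$, $n/l$, $k/m$, $k/n$ and $k/l$ are all horizontal $r$-ribbon strips and, with $w$ the witness for $l\leftharpoondown_r k$, there is a map $a:\mathbb{Z}\to\mathbb{N}^r$ such that for all $i\in\mathbb{Z}$, with $h=\sum_{j=1}^{r-1}w_{i-j}$: (1) if $k/l$ has no $r$-ribbon at position $i$, then $a(i)=a(i+1)$; (2) if $w_{i-r}\neq w_i$, then $a(i)_h=0$; (3) if $k/l$ has an $r$-ribbon at position $i$, then $a(i+1)=a(i)+d\,e_h$, where $d=1$ if both $m/l$ and $n/l$ have $r$-ribbons at position $i$, $d=-1$ if both $k/m$ and $k/n$ have $r$-ribbons at position $i$, and $d=0$ otherwise; (4) if $k/l$ has no $r$-ribbons at positions $j<i$, then $a(i)=a_\ll$; (5) if $k/l$ has no $r$-ribbons at positions $j\ge i$, then $a(i)=a_\gg$. Partitions. $\mathbf{Y}$ is the set of all partitions $\lambda=(\lambda_0\ge\lambda_1\ge\cdots)$ (eventually $0$),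 identified with Young diagrams; $|\lambda|=\sum_i\lambda_i$ and $|\lambda|_r=\lfloor|\lambda|/r\rfloor$. The edge sequence of $\lambda$ is the bit sequence $\delta(\lambda)$ with $\delta(\lambda)_k=1$ if and only if $k=\lambda_i-i-1$ for some $i\ge0$. For $\lambda,\mu\in\mathbf{Y}$ one writes $\lambda\leftharpoondown_r\mu$ if $\delta(\lambda)\leftharpoondown_r\delta(\mu)$, and then $\mathrm{spin}(\mu/\lambda)=\mathrm{spin}(\delta(\mu)/\delta(\lambda))$. A shape datum for $(\mathbf{Y},\leftharpoondown_r,\mathbb{N}^r)$ is a family of bijections, one for each pair $\mu,\nu\in\mathbf{Y}$, $$b_{\mu,\nu}:\{\kappa\in\mathbf{Y}:\mu\leftharpoondown_r\kappa,\ \nu\leftharpoondown_r\kappa\}\to\{(a,\lambda)\in\mathbb{N}^r\times\mathbf{Y}:\lambda\leftharpoondown_r\mu,\ \lambda\leftharpoondown_r\nu\},$$ such that $|\kappa|_r-|\nu|_r-|\mu|_r+|\lambda|_r=|a|$ whenever $(a,\lambda)=b_{\mu,\nu}(\kappa)$. -}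

module Defs where

open import Level using (0ℓ)
open import Data.Bool using (if_then_else_)
open import Data.Digit using (Bit; 0b; 1b)
open import Data.Fin using (Fin; toℕ; fromℕ<)
import Data.Fin.Properties as Fin
open import Data.Integer as ℤ using (ℤ; +_; 0ℤ; 1ℤ; -1ℤ; ∣_∣)
import Data.Integer.Properties as ℤ
open import Data.List using (List; []; _∷_; length; map; sum; upTo)
import Data.List.Properties as List
open import Data.List.Membership.Propositional using (_∈_)
open import Data.List.Relation.Unary.All using (All)
open import Data.List.Relation.Unary.Linked using (Linked)
open import Data.List.Relation.Unary.Unique.Propositional using (Unique)
open import Data.Nat as ℕ using (ℕ; zero; suc; pred; NonZero; z≤n; s≤s)
import Data.Nat.Properties as ℕ
open import Data.Product using (∃; _×_; _,_; proj₁; proj₂)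
open import Data.Product.Properties using (≡-dec)
open import Data.Rational as ℚ using (ℚ)
open import Data.Vec as Vec using (Vec; lookup; tabulate; replicate; _[_]≔_)
open import Function.Bundles using (_⇔_; Bijection)
open import Relation.Binary.Bundles using (Setoid)
import Relation.Binary.Construct.On as On
open import Relation.Binary.PropositionalEquality
open import Relation.Nullary using (¬_; Dec; yes; no; does)
open import Relation.Nullary.Decidable using (map′; _×-dec_)

∣_∣ᵥ : ∀ {r} → Vec ℕ r → ℕ
∣ a ∣ᵥ = Vec.sum a

n⟨_⟩ : ∀ {r} → Vec ℕ r → ℕ
n⟨ a ⟩ = Vec.sum (tabulate λ i → toℕ i ℕ.* lookup a i)

0ᵥ : ∀ {r} → Vec ℕ r
0ᵥ = replicate _ 0

e : ∀ {r} → Fin r → Vec ℕ r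
e h = 0ᵥ [ h ]≔ 1

BitSeq : Set
BitSeq = ℤ → Bit

Bit⁴ : Set
Bit⁴ = Bit × Bit × Bit × Bit

data Admissible : Bit⁴ → Set where
  copy   : ∀ a b → Admissible (a , a , b , b)
  ribbon : Admissible (1b , 0b , 0b , 1b)

quad : ℕ → (w t s : BitSeq) → ℤ → Bit⁴
quad r w t s i = w (i ℤ.- + r) , t (i ℤ.- + r) , s i , w i

-- Here j runs from 0 to r - 2, hence suc j from 1 to r - 1.
height : ℕ → BitSeq → ℤ → ℕ
height r w i = sum (map (λ j → toℕ (w (i ℤ.- + suc j))) (upTo (pred r)))

sum-bits≤length : (f : ℕ → Bit) (js : List ℕ) →
                  sum (map (λ j → toℕ (f j)) js) ℕ.≤ length js
sum-bits≤length f []       = z≤n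
sum-bits≤length f (j ∷ js) =
  ℕ.+-mono-≤ (ℕ.≤-pred (Fin.toℕ<n (f j))) (sum-bits≤length f js)

height<r : ∀ r .{{_ : NonZero r}} w i → height r w i ℕ.< r
height<r (suc n) w i =
  s≤s (subst (height (suc n) w i ℕ.≤_) (List.length-upTo n)
             (sum-bits≤length (λ j → w (i ℤ.- + suc j)) (upTo n)))

heightᶠ : ∀ r .{{_ : NonZero r}} → BitSeq → ℤ → Fin r
heightᶠ r w i = fromℕ< (height<r r w i)

infix 4 _↽[_]_ _↽ᵖ[_]_

-- The finite set I(t/s) is given by a duplicate-free enumeration.
record _↽[_]_ (s : BitSeq) (r : ℕ) (t : BitSeq) : Set where
  field
    w          : BitSeq
    admissible : ∀ i → Admissible (quad r w t s i)
    I          : List ℤ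
    I-unique   : Unique I
    I-exact    : ∀ i → i ∈ I ⇔ quad r w t s i ≡ (1b , 0b , 0b , 1b)

RibbonAt : ∀ {r s t} → s ↽[ r ] t → ℤ → Set
RibbonAt {r} {s} {t} t/s i = quad r w t s i ≡ (1b , 0b , 0b , 1b)
  where open _↽[_]_ t/s

ribbonAt? : ∀ {r s t} (t/s : s ↽[ r ] t) i → Dec (RibbonAt t/s i)
ribbonAt? t/s i =
  ≡-dec Fin._≟_ (≡-dec Fin._≟_ (≡-dec Fin._≟_ Fin._≟_)) _ _

spin : ∀ {r s t} → s ↽[ r ] t → ℚ
spin {r} t/s = (+ sum (map (height r w) I)) ℚ./ 2
  where open _↽[_]_ t/s

-- The first two cases exclude each other: if both m/l and k/m had a ribbon
-- at position i, k/l could not be a horizontal strip.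
increment : ∀ {r l m n k} →
            l ↽[ r ] m → l ↽[ r ] n → m ↽[ r ] k → n ↽[ r ] k → ℤ → ℤ
increment m/l n/l k/m k/n i =
  if does (ribbonAt? m/l i ×-dec ribbonAt? n/l i) then 1ℤ
  else if does (ribbonAt? k/m i ×-dec ribbonAt? k/n i) then -1ℤ
  else 0ℤ

-- BasicSquare r l m n k a≪ a≫ is the square with rows (l m) and (n k).
record BasicSquare (r : ℕ) .{{_ : NonZero r}} (l m n k : BitSeq)
                   (a≪ a≫ : Vec ℕ r) : Set where
  field
    m/l : l ↽[ r ] m
    n/l : l ↽[ r ] n
    k/m : m ↽[ r ] k
    k/n : n ↽[ r ] k
    k/l : l ↽[ r ] k

  open _↽[_]_ k/l using (w)

  h : ℤ → Fin r
  h = heightᶠ r w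

  d : ℤ → ℤ
  d = increment m/l n/l k/m k/n

  field
    a         : ℤ → Vec ℕ r
    no-ribbon : ∀ i → ¬ RibbonAt k/l i → a i ≡ a (i ℤ.+ 1ℤ)
    vanishing : ∀ i → w (i ℤ.- + r) ≢ w i → lookup (a i) (h i) ≡ 0
    step      : ∀ i → RibbonAt k/l i → ∀ c →
                + lookup (a (i ℤ.+ 1ℤ)) c
                  ≡ + lookup (a i) c ℤ.+ d i ℤ.* + lookup (e (h i)) c
    left      : ∀ i → (∀ j → j ℤ.< i → ¬ RibbonAt k/l j) → a i ≡ a≪
    right     : ∀ i → (∀ j → i ℤ.≤ j → ¬ RibbonAt k/l j) → a i ≡ a≫

-- Trailing zeros are dropped, so that equal partitions are equal for _≡_.
record Partition : Set where
  constructor partition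
  field
    parts    : List ℕ
    sorted   : Linked ℕ._≥_ parts
    positive : All (0 ℕ.<_) parts

open Partition public using (parts)

nth : List ℕ → ℕ → ℕ
nth []       _       = 0
nth (x ∷ _)  zero    = x
nth (_ ∷ xs) (suc i) = nth xs i

size : Partition → ℕ
size p = sum (parts p)

size/ : (r : ℕ) .{{_ : NonZero r}} → Partition → ℕ
size/ r p = size p ℕ./ r

IsEdge : Partition → ℤ → ℕ → Set
IsEdge p k i = k ≡ + nth (parts p) i ℤ.- + i ℤ.- 1ℤ

edge-bound : ∀ xs k i → k ≡ + nth xs i ℤ.- + i ℤ.- 1ℤ →
             i ℕ.< length xs ℕ.+ ∣ k ∣
edge-bound xs k i eq with i ℕ.<? length xs
... | yes i<l = ℕ.<-≤-trans i<l (ℕ.m≤m+n _ _)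
... | no  i≮l = ℕ.<-≤-trans (ℕ.≤-reflexive (sym ∣k∣≡1+i)) (ℕ.m≤n+m _ _)
  where
  nth≡0 : ∀ ys j → length ys ℕ.≤ j → nth ys j ≡ 0
  nth≡0 []       j       _       = refl
  nth≡0 (_ ∷ ys) (suc j) (s≤s q) = nth≡0 ys j q

  abs : ∀ j → ∣ 0ℤ ℤ.- + j ℤ.- 1ℤ ∣ ≡ suc j
  abs zero    = refl
  abs (suc j) = cong (λ x → suc (suc x)) (ℕ.+-identityʳ j)

  ∣k∣≡1+i : ∣ k ∣ ≡ suc i
  ∣k∣≡1+i = trans (cong ∣_∣ eq)
    (trans (cong (λ x → ∣ + x ℤ.- + i ℤ.- 1ℤ ∣) (nth≡0 xs i (ℕ.≮⇒≥ i≮l)))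
           (abs i))

edge? : ∀ p k → Dec (∃ (IsEdge p k))
edge? p k = map′
  (λ (i , _ , eq) → i , eq)
  (λ (i , eq) → i , edge-bound (parts p) k i eq , eq)
  (ℕ.anyUpTo? (λ i → k ℤ.≟ _) (length (parts p) ℕ.+ ∣ k ∣))

δ : Partition → BitSeq
δ p k = if does (edge? p k) then 1b else 0b

_↽ᵖ[_]_ : Partition → ℕ → Partition → Set
p ↽ᵖ[ r ] q = δ p ↽[ r ] δ q

-- Subsets of partitions: elements are compared by the underlying
-- partition, ignoring the evidence for being a horizontal strip.
Above : ℕ → (μ ν : Partition) → Setoid 0ℓ 0ℓ
Above r μ ν = On.setoid {B = ∃ λ κ → μ ↽ᵖ[ r ] κ × ν ↽ᵖ[ r ] κ}
                        (setoid Partition) proj₁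

Below : ℕ → (μ ν : Partition) → Setoid 0ℓ 0ℓ
Below r μ ν =
  On.setoid {B = ∃ λ ((_ , κ) : Vec ℕ r × Partition) →
                   κ ↽ᵖ[ r ] μ × κ ↽ᵖ[ r ] ν}
            (setoid (Vec ℕ r × Partition)) proj₁

record ShapeDatum (r : ℕ) .{{_ : NonZero r}} : Set where
  field
    bijection : ∀ μ ν → Bijection (Above r μ ν) (Below r μ ν)

  b : ∀ μ ν κ → μ ↽ᵖ[ r ] κ → ν ↽ᵖ[ r ] κ → Vec ℕ r × Partition
  b μ ν κ κ/μ κ/ν =
    proj₁ (Bijection.to (bijection μ ν) (κ , κ/μ , κ/ν))

  field
    weight : ∀ μ ν κ (κ/μ : μ ↽ᵖ[ r ] κ) (κ/ν : ν ↽ᵖ[ r ] κ) a λ′ →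
             (a , λ′) ≡ b μ ν κ κ/μ κ/ν →
             + size/ r κ ℤ.- + size/ r ν ℤ.- + size/ r μ ℤ.+ + size/ r λ′
               ≡ + ∣ a ∣ᵥ

module _ {r : ℕ} .{{_ : NonZero r}} where

  infix 4 _≋_

  _≋_ : ShapeDatum r → ShapeDatum r → Set
  B ≋ C = ∀ μ ν κ (κ/μ : μ ↽ᵖ[ r ] κ) (κ/ν : ν ↽ᵖ[ r ] κ) →
    ShapeDatum.b B μ ν κ κ/μ κ/ν ≡ ShapeDatum.b C μ ν κ κ/μ κ/ν

  GivenBySquares : ShapeDatum r → Set
  GivenBySquares B =
    ∀ μ ν κ (κ/μ : μ ↽ᵖ[ r ] κ) (κ/ν : ν ↽ᵖ[ r ] κ) a λ′ →
    (a , λ′) ≡ ShapeDatum.b B μ ν κ κ/μ κ/ν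
      ⇔ BasicSquare r (δ λ′) (δ μ) (δ ν) (δ κ) a 0ᵥ

  SpinIdentity : ShapeDatum r → Set
  SpinIdentity B =
    ∀ μ ν κ (κ/μ : μ ↽ᵖ[ r ] κ) (κ/ν : ν ↽ᵖ[ r ] κ) a λ′ →
    (a , λ′) ≡ ShapeDatum.b B μ ν κ κ/μ κ/ν →
    (μ/λ : λ′ ↽ᵖ[ r ] μ) (ν/λ : λ′ ↽ᵖ[ r ] ν) →
    spin κ/μ ℚ.+ spin κ/ν
      ≡ spin μ/λ ℚ.+ spin ν/λ ℚ.+ (+ n⟨ a ⟩) ℚ./ 1

{-# OPTIONS --safe #-}
module Submission where

-- Let c_i be 1 if t/s has a ribbon at position i, and 0 otherwise. Then t/s is
-- a horizontal strip with witness w if and only if s_i + c_i = w_i and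
-- t_{i-r} + c_i = w_{i-r}. Hence strips are linear: in a square, the indicators
-- A, B, C, D, E of m/l, n/l, k/l, k/m, k/n satisfy A + D = C = B + E, and
-- condition (3) says that a(i+1) + D_i E_i e_h = a(i) + A_i B_i e_h.
--
-- The square is determined from l, m, n and a_≪ by a scan from left to right.
-- There is a choice at i only if neither m/l nor n/l has a ribbon there,
-- w_{i-r} = 1 and l_i = 0; then k/l has a ribbon if and only if a(i)_h > 0:
-- a ribbon decreases a(i)_h, and without one (2) requires a(i)_h = 0.
-- With W_i the number of bits 1 of w in the positions i-r, …, i-1, one has
-- a(i)_h = 0 for all h ≥ W_i, so that the remaining instances of (2) hold. The
-- reversal i ↦ -i exchanges l with k and a_≪ with a_≫, so the same scan
-- determines l and a_≪ from m, n, k and a_≫ = 0.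
--
-- Sizes are read off as first moments of edge sequences. For the spin, both
-- w - w(m/l) and w - w(k/m) are given by the ribbons of the other strip; the
-- resulting corrections to the heights cancel, and what remains telescopes
-- along a.

-- The obstacle is that a strip has only finitely many ribbons, while the scan merely produces a
-- sequence on all of ℤ. In the reversed direction the sequence ends in 1s, and a bit 1 of the
-- source leaves no room for a ribbon. In the forward direction it ends in 0s, and bits of w may go
-- on moving r places at a time; but beyond the ribbons of m/l and n/l each move is paid for by one
-- of the |a| counters, and a potential shows that the window empties. The invariant at W = 0 then
-- yields a_≫ = 0, the 0 of the theorem. The left ends are dual to this: the bits 1 of an edge
-- sequence give W = r there, which leaves a_≪ arbitrary, while the bits 0 of a reversed one give W
-- = 0, for which the invariant demands a = 0. A witness and its ribbons are determined by source
-- and target, so what is computed from the strips of a square holds for any evidence supplied. A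
-- sequence joined to a partition by a strip is recognised as an edge sequence by its two ends and
-- by the number of bits 1 in a window, which fixes the shift.

open import Defs
open import Data.Bool using (Bool; true; false; if_then_else_; _∧_)
open import Data.Digit using (Bit; 0b; 1b)
open import Data.Empty using (⊥-elim)
open import Data.Fin as Fin using (Fin; toℕ; fromℕ<)
import Data.Fin.Properties as Fin
open import Data.Integer as ℤ using (ℤ; +_; -[1+_]; 0ℤ; 1ℤ; -1ℤ; ∣_∣)
import Data.Integer.Properties as ℤ
import Data.Integer.Tactic.RingSolver as ℤ-Ring
open import Data.List using (List; []; _∷_; length; map; upTo; applyUpTo; filter)
open import Data.List.Properties using (map-cong; map-upTo; map-∘; length-upTo)
open import Data.List.Membership.Propositional using (_∈_)
open import Data.List.Membership.Propositional.Properties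
  using (∈-upTo⁺; ∈-filter⁺; ∈-filter⁻; ∈-map⁺)
open import Data.List.Membership.Propositional.Properties.WithK using (unique∧set⇒bag)
open import Data.List.Relation.Binary.BagAndSetEquality using (∼bag⇒↭)
open import Data.List.Relation.Binary.Permutation.Propositional using (_↭_)
import Data.List.Relation.Binary.Permutation.Propositional.Properties as ↭
open import Data.List.Relation.Unary.All as All using (All; []; _∷_)
open import Data.List.Relation.Unary.Any using (here; there)
open import Data.List.Relation.Unary.Linked as Linked using (Linked; []; [-]; _∷_)
open import Data.List.Relation.Unary.Unique.Propositional using (Unique)
import Data.List.Relation.Unary.Unique.Propositional.Properties as Unique
open import Data.Nat
open import Data.Nat.Divisibility using (n∣m*n)
open import Data.Nat.DivMod using (+-distrib-/-∣ʳ; m*n/n≡m)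
open import Data.Nat.Induction using (<-rec)
open import Data.Nat.ListAction using (sum)
open import Data.Nat.ListAction.Properties using (sum-↭)
open import Data.Nat.Properties
import Data.Nat.Tactic.RingSolver as ℕ-Ring
open import Data.Product using (∃; _×_; _,_; proj₁; proj₂)
open import Data.Product.Properties using (≡-dec)
import Data.Rational as ℚ
import Data.Rational.Properties as ℚ
import Data.Rational.Unnormalised as ℚᵘ
import Data.Rational.Unnormalised.Properties as ℚᵘ
open import Data.Sum using (_⊎_; inj₁; inj₂)
open import Data.Vec as Vec using (Vec; []; _∷_; lookup; tabulate; _[_]%=_)
import Data.Vec.Properties as Vec
open import Function using (_∘_; id; const)
open import Function.Bundles using (mk⇔; Equivalence)
open import Relation.Binary.Definitions using (tri<; tri≈; tri>)
open import Relation.Binary.PropositionalEquality hiding ([_])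
open import Relation.Nullary using (¬_; Dec; yes; no; does; contradiction)
open import Relation.Nullary.Decidable using (dec-true; dec-false)
open import Relation.Unary using (Decidable)

-- Integer inequalities, and sums over windows of ℤ

-- Linear reasoning: to derive x ≡ y from L ≡ R it suffices to check the
-- identity x + R ≡ y + L.
linear : ∀ {L R} x y → L ≡ R → x + R ≡ y + L → x ≡ y
linear {L} x y refl q = +-cancelʳ-≡ L x y q

-- The slack `n` is a certificate: an inequality that follows from another one is reduced to a ring
-- identity.
≤-linear : ∀ {i j u v} n → i ℤ.≤ j → v ℤ.- u ≡ (j ℤ.- i) ℤ.+ + n → u ℤ.≤ v
≤-linear n i≤j eq = ℤ.0≤i-j⇒j≤i
  (subst (0ℤ ℤ.≤_) (sym eq) (ℤ.+-mono-≤ (ℤ.i≤j⇒0≤j-i i≤j) (ℤ.+≤+ (z≤n {n}))))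

<-linear : ∀ {i j u v} n → i ℤ.< j → v ℤ.- u ≡ (j ℤ.- i) ℤ.+ + n → u ℤ.< v
<-linear {i} {j} {u} {v} n i<j eq = ℤ.suc[i]≤j⇒i<j
  (≤-linear n (ℤ.i<j⇒suc[i]≤j i<j) (trans (peel v u) (trans (cong (ℤ._- 1ℤ) eq) (peel′ j i (+ n)))))
  where
  peel : ∀ v u → v ℤ.- (1ℤ ℤ.+ u) ≡ v ℤ.- u ℤ.- 1ℤ
  peel = ℤ-Ring.solve-∀
  peel′ : ∀ j i n → (j ℤ.- i) ℤ.+ n ℤ.- 1ℤ ≡ j ℤ.- (1ℤ ℤ.+ i) ℤ.+ n
  peel′ = ℤ-Ring.solve-∀

∑ : ℕ → (ℕ → ℕ) → ℕ
∑ zero    f = 0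
∑ (suc n) f = ∑ n f + f n

∑-cong : ∀ n {f g} → (∀ j → j < n → f j ≡ g j) → ∑ n f ≡ ∑ n g
∑-cong zero    _   = refl
∑-cong (suc n) f≗g = cong₂ _+_ (∑-cong n (λ j j<n → f≗g j (m<n⇒m<1+n j<n)))
                               (f≗g n (n<1+n n))

∑-≗ : ∀ n {f g} → f ≗ g → ∑ n f ≡ ∑ n g
∑-≗ n f≗g = ∑-cong n (λ j _ → f≗g j)

∑-zero : ∀ n {f} → (∀ j → j < n → f j ≡ 0) → ∑ n f ≡ 0
∑-zero zero    _ = refl
∑-zero (suc n) z = cong₂ _+_ (∑-zero n (λ j j<n → z j (m<n⇒m<1+n j<n))) (z n (n<1+n n))

∑-+ : ∀ n f g → ∑ n (λ j → f j + g j) ≡ ∑ n f + ∑ n g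
∑-+ zero    f g = refl
∑-+ (suc n) f g = trans (cong (_+ (f n + g n)) (∑-+ n f g)) (eq (∑ n f) (∑ n g) (f n) (g n))
  where
  eq : ∀ a b c d → a + b + (c + d) ≡ a + c + (b + d)
  eq = ℕ-Ring.solve-∀

∑-* : ∀ n a f → ∑ n (λ j → a * f j) ≡ a * ∑ n f
∑-* zero    a f = sym (*-zeroʳ a)
∑-* (suc n) a f = trans (cong (_+ a * f n) (∑-* n a f)) (sym (*-distribˡ-+ a (∑ n f) (f n)))

∑-split : ∀ m n f → ∑ (m + n) f ≡ ∑ m f + ∑ n (λ j → f (m + j))
∑-split m zero    f = trans (cong (λ k → ∑ k f) (+-identityʳ m)) (sym (+-identityʳ _))
∑-split m (suc n) f = trans (cong (λ k → ∑ k f) (+-suc m n))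
  (trans (cong (_+ f (m + n)) (∑-split m n f)) (+-assoc (∑ m f) _ _))

∑-front : ∀ n f → ∑ (suc n) f ≡ f 0 + ∑ n (f ∘ suc)
∑-front n f = ∑-split 1 n f

∑-reverse : ∀ n f → ∑ n f ≡ ∑ n (λ j → f (n ∸ suc j))
∑-reverse zero    f = refl
∑-reverse (suc n) f = trans (+-comm _ (f n)) (trans
  (cong (_+_ (f n)) (∑-reverse n f))
  (sym (∑-front n (λ j → f (n ∸ j)))))

∑-swap : ∀ m n (f : ℕ → ℕ → ℕ) → ∑ m (λ i → ∑ n (f i)) ≡ ∑ n (λ j → ∑ m (λ i → f i j))
∑-swap zero    n f = sym (∑-zero n (λ _ _ → refl))
∑-swap (suc m) n f = trans (cong (_+ ∑ n (f m)) (∑-swap m n f)) (sym (∑-+ n _ (f m)))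

-- Both sums agree with the sum over the first p + n terms, since `f` vanishes on what either of
-- them omits.
∑-shift : ∀ n p f → (∀ j → j < p → f j ≡ 0) → (∀ j → n ≤ j → f j ≡ 0) →
          ∑ n (λ j → f (p + j)) ≡ ∑ n f
∑-shift n p f low high = begin
  ∑ n (λ j → f (p + j))          ≡⟨ cong (_+ ∑ n (λ j → f (p + j))) (sym (∑-zero p low)) ⟩
  ∑ p f + ∑ n (λ j → f (p + j))  ≡⟨ sym (∑-split p n f) ⟩
  ∑ (p + n) f                    ≡⟨ cong (λ k → ∑ k f) (+-comm p n) ⟩
  ∑ (n + p) f                    ≡⟨ ∑-split n p f ⟩
  ∑ n f + ∑ p (λ j → f (n + j))  ≡⟨ cong (_+_ (∑ n f)) (∑-zero p (λ j _ → high (n + j) (m≤m+n n j))) ⟩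
  ∑ n f + 0                      ≡⟨ +-identityʳ _ ⟩
  ∑ n f                          ∎
  where open ≡-Reasoning

sum-map-upTo : ∀ f n → sum (map f (upTo n)) ≡ ∑ n f
sum-map-upTo f n = trans (cong sum (map-upTo f n)) (go f n)
  where
  go : ∀ f n → sum (applyUpTo f n) ≡ ∑ n f
  go f zero    = refl
  go f (suc n) = trans (cong (_+_ (f 0)) (go (f ∘ suc) n)) (sym (∑-front n f))

-- A sum over ℤ with finite support is a sum over the window [-N, N) for every large N. Stating
-- identities for all large N lets finitely many of them be combined before a common N is chosen.
Eventually : (ℕ → Set) → Set
Eventually P = ∃ λ M → ∀ N → M ≤ N → P N

mapᴱ : ∀ {P Q : ℕ → Set} → (∀ N → P N → Q N) → Eventually P → Eventually Q
mapᴱ f (M , p) = M , λ N le → f N (p N le)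

zipᴱ : ∀ {P Q : ℕ → Set} → Eventually P → Eventually Q → Eventually (λ N → P N × Q N)
zipᴱ (M , p) (M′ , q) = M + M′ , λ N le →
  p N (≤-trans (m≤m+n M M′) le) , q N (≤-trans (m≤n+m M′ M) le)

constant : ∀ {P : Set} → Eventually (λ _ → P) → P
constant (M , p) = p M ≤-refl

at : ℕ → ℕ → ℤ
at M j = ℤ.- + M ℤ.+ + j

∑[_] : ℕ → (ℤ → ℕ) → ℕ
∑[ M ] f = ∑ (M + M) (f ∘ at M)

Vanishes : (ℤ → ℕ) → ℕ → Set
Vanishes f M = ∀ i → i ℤ.< ℤ.- + M ⊎ + M ℤ.≤ i → f i ≡ 0

FinSupp : (ℤ → ℕ) → Set
FinSupp f = ∃ (Vanishes f)

vanishes-mono : ∀ {f M N} → Vanishes f M → M ≤ N → Vanishes f N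
vanishes-mono v M≤N i (inj₁ i<-N) = v i (inj₁ (ℤ.<-≤-trans i<-N (ℤ.neg-mono-≤ (ℤ.+≤+ M≤N))))
vanishes-mono v M≤N i (inj₂ N≤i)  = v i (inj₂ (ℤ.≤-trans (ℤ.+≤+ M≤N) N≤i))

window-margins : ∀ {f} p → FinSupp f → Eventually λ N →
                 (∀ j → j < p → f (at N j) ≡ 0) × (∀ j → N + N ≤ j → f (at N j) ≡ 0)
window-margins {f} p (M , v) = M + p , λ N M+p≤N →
    (λ j j<p → v _ (inj₁ (low N M+p≤N j j<p)))
  , (λ j 2N≤j → v _ (inj₂ (high N M+p≤N j 2N≤j)))
  where
  low : ∀ N → M + p ≤ N → ∀ j → j < p → at N j ℤ.< ℤ.- + M
  low N le j j<p = ℤ.<-≤-trans (ℤ.+-monoʳ-< (ℤ.- + N) (ℤ.+<+ j<p))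
    (≤-linear 0 (ℤ.+≤+ le) (trans (eq (+ N) (+ M) (+ p)) (cong (λ x → + N ℤ.- x ℤ.+ 0ℤ) (sym (ℤ.pos-+ M p)))))
    where
    eq : ∀ N M p → ℤ.- M ℤ.- (ℤ.- N ℤ.+ p) ≡ N ℤ.- (M ℤ.+ p) ℤ.+ 0ℤ
    eq = ℤ-Ring.solve-∀

  high : ∀ N → M + p ≤ N → ∀ j → N + N ≤ j → + M ℤ.≤ at N j
  high N le j 2N≤j = ℤ.≤-trans (ℤ.+≤+ (≤-trans (m≤m+n M p) le))
    (≤-linear 0 (ℤ.+≤+ 2N≤j) (trans (eq (+ N) (+ j)) (cong (λ x → + j ℤ.- x ℤ.+ 0ℤ) (sym (ℤ.pos-+ N N)))))
    where
    eq : ∀ N j → (ℤ.- N ℤ.+ j) ℤ.- N ≡ j ℤ.- (N ℤ.+ N) ℤ.+ 0ℤ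
    eq = ℤ-Ring.solve-∀

at-+ : ∀ N j p → at N j ℤ.+ + p ≡ at N (p + j)
at-+ N j p = trans (eq (+ N) (+ j) (+ p)) (cong (ℤ._+_ (ℤ.- + N)) (sym (ℤ.pos-+ p j)))
  where
  eq : ∀ N j p → ℤ.- N ℤ.+ j ℤ.+ p ≡ ℤ.- N ℤ.+ (p ℤ.+ j)
  eq = ℤ-Ring.solve-∀

∑[]-shift : ∀ {f} p → FinSupp f → Eventually (λ N → ∑[ N ] (λ i → f (i ℤ.+ + p)) ≡ ∑[ N ] f)
∑[]-shift {f} p fin = mapᴱ (λ N (low , high) → trans (∑-≗ (N + N) (λ j → cong f (at-+ N j p)))
  (∑-shift (N + N) p (f ∘ at N) low high)) (window-margins p fin)

-- Strong induction on the distance from N, with everything to the left of N as the base case;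
-- usually N lies to the left of all ribbons.
ℤ-induction : (P : ℤ → Set) (N : ℤ) → (∀ i → i ℤ.< N → P i) →
              (∀ i → (∀ j → j ℤ.< i → P j) → P i) → ∀ i → P i
ℤ-induction P N base ind i = below (suc ∣ i ℤ.- N ∣) i
  (below-end (lt (i ℤ.- N)))
  where
  lt : ∀ x → x ℤ.< + suc ∣ x ∣
  lt (+ n)     = ℤ.+<+ (n<1+n n)
  lt -[1+ n ]  = ℤ.-<+

  below-end : i ℤ.- N ℤ.< + suc ∣ i ℤ.- N ∣ → i ℤ.< N ℤ.+ + suc ∣ i ℤ.- N ∣
  below-end p = <-linear 0 p (eq N (+ suc ∣ i ℤ.- N ∣) i)
    where
    eq : ∀ N x i → (N ℤ.+ x) ℤ.- i ≡ x ℤ.- (i ℤ.- N) ℤ.+ 0ℤ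
    eq = ℤ-Ring.solve-∀

  below : ∀ n i → i ℤ.< N ℤ.+ + n → P i
  below zero    i i<N   = base i (subst (i ℤ.<_) (ℤ.+-identityʳ N) i<N)
  below (suc n) i i<N+n = ind i λ j j<i → below n j
    (ℤ.<-≤-trans j<i (≤-linear 0 (ℤ.i<j⇒suc[i]≤j i<N+n)
      (trans (eq N (+ n) i) (cong (λ x → N ℤ.+ x ℤ.- (1ℤ ℤ.+ i) ℤ.+ 0ℤ) (sym (ℤ.pos-+ 1 n))))))
    where
    eq : ∀ N n i → (N ℤ.+ n) ℤ.- i ≡ N ℤ.+ (1ℤ ℤ.+ n) ℤ.- (1ℤ ℤ.+ i) ℤ.+ 0ℤ
    eq = ℤ-Ring.solve-∀

i-r+r : ∀ i r → i ℤ.- r ℤ.+ r ≡ i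
i-r+r = ℤ-Ring.solve-∀

i+r-r : ∀ i r → i ℤ.+ r ℤ.- r ≡ i
i+r-r = ℤ-Ring.solve-∀

i-r<i : ∀ i r .{{_ : NonZero r}} → i ℤ.- + r ℤ.< i
i-r<i i (suc n) = <-linear n (ℤ.+<+ (z<s {0})) (trans (eq i (+ suc n)) (cong (ℤ._+_ 0ℤ) (ℤ.pos-+ 1 n)))
  where
  eq : ∀ i x → i ℤ.- (i ℤ.- x) ≡ 0ℤ ℤ.+ x
  eq = ℤ-Ring.solve-∀

-- Strips in linear form

pattern 𝟘 = Fin.zero
pattern 𝟙 = Fin.suc Fin.zero

bit≤1 : ∀ (b : Bit) → toℕ b ≤ 1
bit≤1 b = ≤-pred (Fin.toℕ<n b)

bit : ℕ → Bit
bit zero    = 0b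
bit (suc _) = 1b

toℕ-bit : ∀ {n} → n ≤ 1 → toℕ (bit n) ≡ n
toℕ-bit {zero}        _         = refl
toℕ-bit {suc zero}    _         = refl
toℕ-bit {suc (suc _)} (s≤s ())

-- A horizontal strip in linear form: c is the indicator of the set of
-- ribbons, and the bits w of the witness are counted in two ways.
record Strip (r : ℕ) (s t w : BitSeq) (c : ℤ → ℕ) : Set where
  field
    source : ∀ i → toℕ (s i) + c i ≡ toℕ (w i)
    target : ∀ i → toℕ (t (i ℤ.- + r)) + c i ≡ toℕ (w (i ℤ.- + r))
    finite : FinSupp c

  -- Think of `c i` = 1 as a bit 1 moving from i - r to i. Then `w` is `s` with the arrivals added,
  -- and `t` is `w` with the departures removed; `flow` is the conservation law that results when
  -- `w` is eliminated.
  flow : ∀ i → toℕ (t (i ℤ.- + r)) + c i ≡ toℕ (s (i ℤ.- + r)) + c (i ℤ.- + r)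
  flow i = trans (target i) (sym (source (i ℤ.- + r)))

  c≤1 : ∀ i → c i ≤ 1
  c≤1 i = ≤-trans (m≤n+m (c i) (toℕ (s i))) (≤-trans (≤-reflexive (source i)) (bit≤1 (w i)))

open Strip

carry : ∀ (z u : Bit) {c} → toℕ z + suc c ≡ toℕ u → z ≡ 0b × u ≡ 1b × c ≡ 0
carry 𝟘 𝟙 refl = refl , refl , refl
carry 𝟙 𝟘 ()
carry 𝟙 𝟙 ()

local : ∀ (x y z u : Bit) c → toℕ z + c ≡ toℕ u → toℕ y + c ≡ toℕ x →
        (c ≡ 0 × x ≡ y × z ≡ u) ⊎ (c ≡ 1 × (x , y , z , u) ≡ (1b , 0b , 0b , 1b))
local x y z u zero p q =
  inj₁ (refl , Fin.toℕ-injective (sym (trans (sym (+-identityʳ _)) q))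
             , Fin.toℕ-injective (trans (sym (+-identityʳ _)) p))
local x y z u (suc c) p q with carry z u p | carry y x q
... | refl , refl , refl | refl , refl , _ = inj₂ (refl , refl)

admissible-copy : ∀ {x y z u} → x ≡ y → z ≡ u → Admissible (x , y , z , u)
admissible-copy refl refl = copy _ _

window : ℕ → List ℤ
window M = map (at M) (upTo (M + M))

at-injective : ∀ M {j k} → at M j ≡ at M k → j ≡ k
at-injective M {j} {k} eq = ℤ.+-injective (trans (sym (cancel (+ M) (+ j)))
  (trans (cong (ℤ._+_ (+ M)) eq) (cancel (+ M) (+ k))))
  where
  cancel : ∀ M j → M ℤ.+ (ℤ.- M ℤ.+ j) ≡ j
  cancel = ℤ-Ring.solve-∀

window-unique : ∀ M → Unique (window M)
window-unique M = Unique.map⁺ (at-injective M) (Unique.upTo⁺ (M + M))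

at-surjective : ∀ M i → ℤ.- + M ℤ.≤ i → i ℤ.< + M → ∃ λ j → j < M + M × i ≡ at M j
at-surjective M i -M≤i i<M = ∣ i ℤ.+ + M ∣
  , ℤ.drop‿+<+ (subst (ℤ._< + (M + M)) (sym nonNeg)
      (<-linear 0 i<M (trans (cong (ℤ._- (i ℤ.+ + M)) (ℤ.pos-+ M M)) (eq₂ i (+ M)))))
  , trans (sym (eq₁ i (+ M))) (cong (ℤ._+_ (ℤ.- + M)) (sym nonNeg))
  where
  eq₁ : ∀ i M → ℤ.- M ℤ.+ (i ℤ.+ M) ≡ i
  eq₁ = ℤ-Ring.solve-∀
  eq₂ : ∀ i M → (M ℤ.+ M) ℤ.- (i ℤ.+ M) ≡ M ℤ.- i ℤ.+ 0ℤ
  eq₂ = ℤ-Ring.solve-∀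
  eq₃ : ∀ i M → (i ℤ.+ M) ℤ.- 0ℤ ≡ i ℤ.- (ℤ.- M) ℤ.+ 0ℤ
  eq₃ = ℤ-Ring.solve-∀
  nonNeg : + ∣ i ℤ.+ + M ∣ ≡ i ℤ.+ + M
  nonNeg = ℤ.0≤i⇒+∣i∣≡i (≤-linear 0 -M≤i (eq₃ i (+ M)))

inside : ∀ {f M} → Vanishes f M → ∀ i → f i ≢ 0 → ℤ.- + M ℤ.≤ i × i ℤ.< + M
inside {M = M} v i fi≢0 =
    ℤ.≮⇒≥ (λ i<-M → fi≢0 (v i (inj₁ i<-M)))
  , ℤ.≰⇒> (λ M≤i → fi≢0 (v i (inj₂ M≤i)))

∈-window : ∀ {f M} → Vanishes f M → ∀ i → f i ≢ 0 → i ∈ window M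
∈-window {M = M} v i fi≢0 with inside v i fi≢0
... | -M≤i , i<M with at-surjective M i -M≤i i<M
...   | j , j<2M , refl = ∈-map⁺ (at M) (∈-upTo⁺ j<2M)

-- Sums over the ribbons of a strip

indicator : ∀ {r s t} → s ↽[ r ] t → ℤ → ℕ
indicator t/s i = if does (ribbonAt? t/s i) then 1 else 0

module _ {r s t} (t/s : s ↽[ r ] t) where
  open _↽[_]_ t/s

  indicator-yes : ∀ {i} → RibbonAt t/s i → indicator t/s i ≡ 1
  indicator-yes {i} p = cong (if_then 1 else 0) (dec-true (ribbonAt? t/s i) p)

  indicator-no : ∀ {i} → ¬ RibbonAt t/s i → indicator t/s i ≡ 0
  indicator-no {i} ¬p = cong (if_then 1 else 0) (dec-false (ribbonAt? t/s i) ¬p)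

  ∈I⇒indicator : ∀ {i} → i ∈ I → indicator t/s i ≡ 1
  ∈I⇒indicator i∈I = indicator-yes (Equivalence.to (I-exact _) i∈I)

  indicator-finite : FinSupp (indicator t/s)
  indicator-finite = bound I , λ i out → outside i out
    where
    bound : List ℤ → ℕ
    bound []       = 0
    bound (x ∷ xs) = suc ∣ x ∣ + bound xs

    ∈⇒<bound : ∀ {xs i} → i ∈ xs → ∣ i ∣ < bound xs
    ∈⇒<bound {x ∷ xs} (here refl)  = m≤m+n (suc ∣ x ∣) (bound xs)
    ∈⇒<bound {x ∷ xs} (there i∈xs) = ≤-trans (∈⇒<bound i∈xs) (m≤n+m (bound xs) (suc ∣ x ∣))

    large : ∀ M i → i ℤ.< ℤ.- + M ⊎ + M ℤ.≤ i → M ≤ ∣ i ∣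
    large zero    _        _                = z≤n
    large (suc M) (+ n)    (inj₂ le)        = ℤ.drop‿+≤+ le
    large (suc M) -[1+ n ] (inj₁ (ℤ.-<- p)) = s≤s (<⇒≤ p)
    large (suc M) (+ n) (inj₁ ())

    outside : Vanishes (indicator t/s) (bound I)
    outside i out with ribbonAt? t/s i
    ... | no  _ = refl
    ... | yes p = contradiction (∈⇒<bound (Equivalence.from (I-exact i) p))
                                (≤⇒≯ (large (bound I) i out))

  strip : Strip r s t w (indicator t/s)
  strip = record
    { source = λ i → proj₁ (count (admissible i))
    ; target = λ i → proj₂ (count (admissible i))
    ; finite = indicator-finite
    }
    where
    count : ∀ {x y z u} → Admissible (x , y , z , u) →
            let c = if does (≡-dec Fin._≟_ (≡-dec Fin._≟_ (≡-dec Fin._≟_ Fin._≟_)) (x , y , z , u) (1b , 0b , 0b , 1b)) then 1 else 0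
            in toℕ z + c ≡ toℕ u × toℕ y + c ≡ toℕ x
    count (copy 𝟘 𝟘) = refl , refl
    count (copy 𝟘 𝟙) = refl , refl
    count (copy 𝟙 𝟘) = refl , refl
    count (copy 𝟙 𝟙) = refl , refl
    count ribbon       = refl , refl

  -- `I` and the filtered window are duplicate-free lists with the same members, hence permutations
  -- of each other, so the sum does not depend on the enumeration.
  sum-ribbons : ∀ f → Eventually λ N → sum (map f I) ≡ ∑[ N ] (λ i → indicator t/s i * f i)
  sum-ribbons f with indicator-finite
  ... | M , v = M , λ N M≤N → begin
    sum (map f I)                                ≡⟨ sum-↭ (↭.map⁺ f (I↭ N (vanishes-mono v M≤N))) ⟩
    sum (map f (filter one? (window N)))         ≡⟨ sum-filter (window N) ⟩
    sum (map g (map (at N) (upTo (N + N))))      ≡⟨ cong sum (sym (map-∘ (upTo (N + N)))) ⟩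
    sum (map (g ∘ at N) (upTo (N + N)))          ≡⟨ sum-map-upTo (g ∘ at N) (N + N) ⟩
    ∑[ N ] g                                     ∎
    where
    open ≡-Reasoning
    g : ℤ → ℕ
    g i = indicator t/s i * f i

    one? : Decidable (λ i → RibbonAt t/s i)
    one? = ribbonAt? t/s

    sum-filter : ∀ xs → sum (map f (filter one? xs)) ≡ sum (map g xs)
    sum-filter []       = refl
    sum-filter (x ∷ xs) with one? x
    ... | yes _ = cong₂ _+_ (sym (+-identityʳ (f x))) (sum-filter xs)
    ... | no  _ = sum-filter xs

    I↭ : ∀ N → Vanishes (indicator t/s) N → I ↭ filter one? (window N)
    I↭ N vN = ∼bag⇒↭ (unique∧set⇒bag I-unique (Unique.filter⁺ one? (window-unique N)) (mk⇔
      (λ i∈I → ∈-filter⁺ one? (∈-window vN _ (λ eq → 1≢0 (trans (sym (∈I⇒indicator i∈I)) eq)))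
                              (Equivalence.to (I-exact _) i∈I))
      (λ i∈F → Equivalence.from (I-exact _) (proj₂ (∈-filter⁻ one? {xs = window N} i∈F)))))
      where
      1≢0 : 1 ≢ 0
      1≢0 ()

module _ {r s t w c} (S : Strip r s t w c) where

  ribbonStrip : s ↽[ r ] t
  ribbonStrip = record
    { w = w
    ; admissible = adm
    ; I = filter one? (window M)
    ; I-unique = Unique.filter⁺ one? (window-unique M)
    ; I-exact = λ i → mk⇔
        (λ i∈F → one⇒quad i (proj₂ (∈-filter⁻ one? {xs = window M} i∈F)))
        (λ q → ∈-filter⁺ one? (∈-window v i (λ c≡0 → 1≢0 (trans (sym (quad⇒one i q)) c≡0))) (quad⇒one i q))
    }
    where
    M : ℕ
    M = proj₁ (finite S)
    v : Vanishes c M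
    v = proj₂ (finite S)

    1≢0 : 1 ≢ 0
    1≢0 ()

    one? : Decidable (λ i → c i ≡ 1)
    one? i = c i ≟ 1

    loc = λ i → local (w (i ℤ.- + r)) (t (i ℤ.- + r)) (s i) (w i) (c i) (source S i) (target S i)

    adm : ∀ i → Admissible (quad r w t s i)
    adm i with loc i
    ... | inj₁ (_ , p , q) = admissible-copy p q
    ... | inj₂ (_ , p)     = subst Admissible (sym p) ribbon

    one⇒quad : ∀ i → c i ≡ 1 → quad r w t s i ≡ (1b , 0b , 0b , 1b)
    one⇒quad i c≡1 with loc i
    ... | inj₁ (c≡0 , _) = contradiction (trans (sym c≡1) c≡0) 1≢0
    ... | inj₂ (_ , p)   = p

    quad⇒one : ∀ i → quad r w t s i ≡ (1b , 0b , 0b , 1b) → c i ≡ 1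
    quad⇒one i q = +-cancelˡ-≡ 0 _ _ (subst₂ (λ a b → toℕ a + c i ≡ toℕ b)
      (cong (λ x → proj₁ (proj₂ (proj₂ x))) q) (cong (λ x → proj₂ (proj₂ (proj₂ x))) q) (source S i))

-- Reversal, uniqueness and composition of strips

reverse : BitSeq → BitSeq
reverse s i = s (ℤ.- i)

-- A ribbon at j moves a bit from j - r to j. Read backwards it moves one from -j to r - j, so
-- source and target change places and the ribbon sits at r - j.
Strip-reverse : ∀ {r s t w c} → Strip r s t w c →
  Strip r (reverse t) (reverse s) (reverse w) (λ i → c (+ r ℤ.- i))
Strip-reverse {r} {s} {t} {w} {c} S = record
  { source = λ i → subst (λ j → toℕ (t j) + c (+ r ℤ.- i) ≡ toℕ (w j)) (eq₁ i (+ r)) (target S (+ r ℤ.- i))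
  ; target = λ i → subst (λ j → toℕ (s j) + c (+ r ℤ.- i) ≡ toℕ (w j)) (eq₂ i (+ r)) (source S (+ r ℤ.- i))
  -- The reflection is centred at r rather than 0, which costs r; the half-open window [-M, M)
  -- changes its open end, which costs 1 more.
  ; finite = M + suc r , λ { i (inj₁ p) → v _ (inj₂ (low i p)) ; i (inj₂ p) → v _ (inj₁ (high i p)) }
  }
  where
  M = proj₁ (finite S)
  v = proj₂ (finite S)
  eq₁ : ∀ i r → r ℤ.- i ℤ.- r ≡ ℤ.- i
  eq₁ = ℤ-Ring.solve-∀
  eq₂ : ∀ i r → r ℤ.- i ≡ ℤ.- (i ℤ.- r)
  eq₂ = ℤ-Ring.solve-∀
  cast : + (M + suc r) ≡ + M ℤ.+ (1ℤ ℤ.+ + r)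
  cast = trans (ℤ.pos-+ M (suc r)) (cong (ℤ._+_ (+ M)) (ℤ.pos-+ 1 r))
  low : ∀ i → i ℤ.< ℤ.- + (M + suc r) → + M ℤ.≤ + r ℤ.- i
  low i p = ≤-linear (r + suc r) (ℤ.<⇒≤ (subst (λ x → i ℤ.< ℤ.- x) cast p))
    (trans (eq (+ M) (+ r) i) (cong (ℤ._+_ (ℤ.- (+ M ℤ.+ (1ℤ ℤ.+ + r)) ℤ.- i)) (sym (trans (ℤ.pos-+ r (suc r)) (cong (ℤ._+_ (+ r)) (ℤ.pos-+ 1 r))))))
    where
    eq : ∀ M r i → (r ℤ.- i) ℤ.- M ≡ ℤ.- (M ℤ.+ (1ℤ ℤ.+ r)) ℤ.- i ℤ.+ (r ℤ.+ (1ℤ ℤ.+ r))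
    eq = ℤ-Ring.solve-∀
  high : ∀ i → + (M + suc r) ℤ.≤ i → + r ℤ.- i ℤ.< ℤ.- + M
  high i p = ℤ.suc[i]≤j⇒i<j (≤-linear 0 (subst (ℤ._≤ i) cast p) (eq (+ M) (+ r) i))
    where
    eq : ∀ M r i → ℤ.- M ℤ.- (1ℤ ℤ.+ (r ℤ.- i)) ≡ i ℤ.- (M ℤ.+ (1ℤ ℤ.+ r)) ℤ.+ 0ℤ
    eq = ℤ-Ring.solve-∀

Strip-resp : ∀ {r s s′ t t′ w c} → s ≗ s′ → t ≗ t′ → Strip r s t w c → Strip r s′ t′ w c
Strip-resp {c = c} s≗ t≗ S = record
  { source = λ i → trans (cong (λ b → toℕ b + c i) (sym (s≗ i))) (source S i)
  ; target = λ i → trans (cong (λ b → toℕ b + c i) (sym (t≗ _))) (target S i)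
  ; finite = finite S
  }

both-vanish : ∀ {f g} → FinSupp f → FinSupp g → ∃ λ M → Vanishes f M × Vanishes g M
both-vanish (M , v) (N , u) =
  M + N , vanishes-mono v (m≤m+n M N) , vanishes-mono u (m≤n+m N M)

-- Far to the left there are no ribbons and both witnesses equal `s`. Thereafter `target` computes
-- `c i` from the witness at i - r, and `source` computes the witness at i from `c i`.
Strip-unique : ∀ {r s t w w′ c c′} .{{_ : NonZero r}} → Strip r s t w c → Strip r s t w′ c′ →
               ∀ i → w i ≡ w′ i × c i ≡ c′ i
Strip-unique {r} {s} {t} {w} {w′} {c} {c′} S S′ with both-vanish (finite S) (finite S′)
... | M , v , v′ = ℤ-induction _ (ℤ.- + M)
  (λ i i<-M → from-c i (trans (v i (inj₁ i<-M)) (sym (v′ i (inj₁ i<-M)))))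
  (λ i ih → from-c i (+-cancelˡ-≡ (toℕ (t (i ℤ.- + r))) _ _
    (trans (target S i) (trans (cong toℕ (proj₁ (ih _ (i-r<i i r)))) (sym (target S′ i))))))
  where
  from-c : ∀ i → c i ≡ c′ i → w i ≡ w′ i × c i ≡ c′ i
  from-c i eq = Fin.toℕ-injective (trans (sym (source S i))
    (trans (cong (_+_ (toℕ (s i))) eq) (source S′ i))) , eq

-- Adding the conservation laws shows that A + D - C takes the same value at i and at i - r; far to
-- the left it is 0.
Strip-additive : ∀ {r l m k w w₁ w₂ C A D} .{{_ : NonZero r}} →
  Strip r l k w C → Strip r l m w₁ A → Strip r m k w₂ D → ∀ i → A i + D i ≡ C i
Strip-additive {r} {l} {m} {k} {C = C} {A} {D} SC SA SD
  with both-vanish (finite SA) (finite SD) | finite SC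
... | M , vA , vD | N , vC = ℤ-induction _ (ℤ.- + (M + N))
  (λ i i< → trans (cong₂ _+_ (vanishes-mono vA (m≤m+n M N) i (inj₁ i<)) (vanishes-mono vD (m≤m+n M N) i (inj₁ i<)))
                  (sym (vanishes-mono vC (m≤n+m N M) i (inj₁ i<))))
  (λ i ih → let i′ = i ℤ.- + r in
    linear (A i + D i) (C i)
      (cong₂ _+_ (cong₂ _+_ (flow SA i) (flow SD i)) (cong₂ _+_ (sym (flow SC i)) (ih i′ (i-r<i i r))))
      (eq (A i) (D i) (C i) (toℕ (l i′)) (toℕ (m i′)) (toℕ (k i′)) (A i′) (D i′) (C i′)))
  where
  eq : ∀ a d c l m k a′ d′ c′ →
    a + d + (l + a′ + (m + d′) + (k + c + c′)) ≡ c + (m + a + (k + d) + (l + c′ + (a′ + d′)))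
  eq = ℕ-Ring.solve-∀

-- The witness is forced to be m + D, and the point is that this is a bit: adding the departures
-- A_{i+r} turns m_i + D_i into l_i + A_i + D_i = w_i.
Strip-difference : ∀ {r l m k w w₁ C A} D → Strip r l k w C → Strip r l m w₁ A →
  (∀ i → A i + D i ≡ C i) → Strip r m k (λ i → bit (toℕ (m i) + D i)) D
Strip-difference {r} {l} {m} {k} {w} {w₁} {C} {A} D SC SA A+D≡C = record
  { source = λ i → sym (toℕ-bit (small i))
  ; target = λ i → let i′ = i ℤ.- + r in trans
      (linear (toℕ (k i′) + D i) (toℕ (m i′) + D i′)
        (cong₂ _+_ (cong₂ _+_ (flow SC i) (sym (flow SA i))) (cong₂ _+_ (A+D≡C i) (sym (A+D≡C i′))))
        (eq (A i) (D i) (C i) (toℕ (l i′)) (toℕ (m i′)) (toℕ (k i′)) (A i′) (D i′) (C i′)))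
      (sym (toℕ-bit (small i′)))
  ; finite = proj₁ (finite SC) , λ i out → m+n≡0⇒n≡0 (A i) (trans (A+D≡C i) (proj₂ (finite SC) i out))
  }
  where
  eq : ∀ a d c l m k a′ d′ c′ →
    k + d + (l + c′ + (m + a) + (c + (a′ + d′))) ≡ m + d′ + (k + c + (l + a′) + (a + d + c′))
  eq = ℕ-Ring.solve-∀

  small : ∀ i → toℕ (m i) + D i ≤ 1
  small i = begin
    toℕ (m i) + D i                        ≤⟨ +-monoˡ-≤ (D i) (m≤m+n _ (A (i ℤ.+ + r))) ⟩
    toℕ (m i) + A (i ℤ.+ + r) + D i        ≡⟨ cong (_+ D i) (subst (λ j → toℕ (m j) + A (i ℤ.+ + r) ≡ toℕ (l j) + A j)
                                                (i+r-r i (+ r)) (flow SA (i ℤ.+ + r))) ⟩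
    toℕ (l i) + A i + D i                  ≡⟨ trans (+-assoc (toℕ (l i)) _ _) (cong (_+_ (toℕ (l i))) (A+D≡C i)) ⟩
    toℕ (l i) + C i                        ≡⟨ source SC i ⟩
    toℕ (w i)                              ≤⟨ bit≤1 (w i) ⟩
    1                                      ∎
    where open ≤-Reasoning

-- Heights, and squares in linear form

height-∑ : ∀ r w i → height r w i ≡ ∑ (pred r) (λ p → toℕ (w (i ℤ.- + suc p)))
height-∑ r w i = sum-map-upTo _ (pred r)

toℕ-heightᶠ : ∀ r .{{_ : NonZero r}} w i → toℕ (heightᶠ r w i) ≡ height r w i
toℕ-heightᶠ r w i = Fin.toℕ-fromℕ< (height<r r w i)

heightᶠ-cong : ∀ r .{{_ : NonZero r}} {w w′ i i′} → height r w i ≡ height r w′ i′ →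
               heightᶠ r w i ≡ heightᶠ r w′ i′
heightᶠ-cong r {w} {w′} {i} {i′} eq =
  Fin.toℕ-injective (trans (toℕ-heightᶠ r w i) (trans eq (sym (toℕ-heightᶠ r w′ i′))))

heightᶠ-local : ∀ r .{{_ : NonZero r}} {w w′ i} → (∀ j → j ℤ.< i → w j ≡ w′ j) →
                heightᶠ r w i ≡ heightᶠ r w′ i
heightᶠ-local r {w} {w′} {i} eq = heightᶠ-cong r {w} {w′} {i} {i} (trans (height-∑ r w i)
  (trans (∑-≗ (pred r) (λ p → cong toℕ (eq _ (i-r<i i (suc p))))) (sym (height-∑ r w′ i))))

-- The height at i reads the positions strictly between i - r and i, and negation maps them onto
-- those strictly between -i and r - i.
height-reverse : ∀ r .{{_ : NonZero r}} w i → height r (reverse w) i ≡ height r w (+ r ℤ.- i)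
height-reverse r@(suc q) w i = begin
  height r (reverse w) i                              ≡⟨ height-∑ r (reverse w) i ⟩
  ∑ q (λ p → toℕ (w (ℤ.- (i ℤ.- + suc p))))           ≡⟨ ∑-reverse q _ ⟩
  ∑ q (λ p → toℕ (w (ℤ.- (i ℤ.- + suc (q ∸ suc p))))) ≡⟨ ∑-cong q (λ p p<q → cong (toℕ ∘ w) (eq p p<q)) ⟩
  ∑ q (λ p → toℕ (w (+ r ℤ.- i ℤ.- + suc p)))         ≡⟨ sym (height-∑ r w (+ r ℤ.- i)) ⟩
  height r w (+ r ℤ.- i)                              ∎
  where
  open ≡-Reasoning
  eq : ∀ p → p < q → ℤ.- (i ℤ.- + suc (q ∸ suc p)) ≡ + r ℤ.- i ℤ.- + suc p
  eq p p<q = trans (ring₁ i (+ suc (q ∸ suc p)) (+ suc p))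
    (cong (λ x → x ℤ.- i ℤ.- + suc p)
      (trans (sym (ℤ.pos-+ (suc (q ∸ suc p)) (suc p))) (cong (λ x → + suc x) (m∸n+n≡m p<q))))
    where
    ring₁ : ∀ i x p → ℤ.- (i ℤ.- x) ≡ (x ℤ.+ p) ℤ.- i ℤ.- p
    ring₁ = ℤ-Ring.solve-∀

e-self : ∀ {r} (h : Fin r) → lookup (e h) h ≡ 1
e-self h = Vec.lookup∘updateAt h 0ᵥ

e-other : ∀ {r} {h x : Fin r} → x ≢ h → lookup (e h) x ≡ 0
e-other {r} {h} {x} x≢h = trans (Vec.lookup∘updateAt′ x h x≢h 0ᵥ) (Vec.lookup-replicate x 0)

lookup-ext : ∀ {r} {u v : Vec ℕ r} → (∀ x → lookup u x ≡ lookup v x) → u ≡ v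
lookup-ext {u = u} {v} eq =
  trans (sym (Vec.tabulate∘lookup u)) (trans (Vec.tabulate-cong eq) (Vec.tabulate∘lookup v))

-- Conditions (1) and (3) are merged into `step`, which holds at every position and avoids
-- subtraction. Conditions (4) and (5) are required only far out; `constant-left` and
-- `constant-right` recover them in full.
record Square (r : ℕ) .{{_ : NonZero r}} (l m n k : BitSeq) (a≪ a≫ : Vec ℕ r) : Set where
  field
    {w wA wB wD wE} : BitSeq
    {A B C D E}     : ℤ → ℕ
    k/l : Strip r l k w  C
    m/l : Strip r l m wA A
    n/l : Strip r l n wB B
    k/m : Strip r m k wD D
    k/n : Strip r n k wE E
    a   : ℤ → Vec ℕ r

  h : ℤ → Fin r
  h = heightᶠ r w

  field
    vanishing : ∀ i → w (i ℤ.- + r) ≢ w i → lookup (a i) (h i) ≡ 0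
    step      : ∀ i x → lookup (a (i ℤ.+ 1ℤ)) x + D i * E i * lookup (e (h i)) x
                      ≡ lookup (a i) x + A i * B i * lookup (e (h i)) x
    left      : ∃ λ N → ∀ i → i ℤ.≤ N → a i ≡ a≪
    right     : ∃ λ N → ∀ i → N ℤ.≤ i → a i ≡ a≫

  A+D≡C : ∀ i → A i + D i ≡ C i
  A+D≡C = Strip-additive k/l m/l k/m

  B+E≡C : ∀ i → B i + E i ≡ C i
  B+E≡C = Strip-additive k/l n/l k/n

  constant-step : ∀ i → C i ≡ 0 → a (i ℤ.+ 1ℤ) ≡ a i
  constant-step i C≡0 = lookup-ext λ x → begin
    lookup (a (i ℤ.+ 1ℤ)) x
      ≡⟨ sym (+-identityʳ _) ⟩
    lookup (a (i ℤ.+ 1ℤ)) x + 0 * E i * lookup (e (h i)) x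
      ≡⟨ cong (λ d → lookup (a (i ℤ.+ 1ℤ)) x + d * E i * lookup (e (h i)) x)
           (sym (m+n≡0⇒n≡0 (A i) (trans (A+D≡C i) C≡0))) ⟩
    lookup (a (i ℤ.+ 1ℤ)) x + D i * E i * lookup (e (h i)) x
      ≡⟨ step i x ⟩
    lookup (a i) x + A i * B i * lookup (e (h i)) x
      ≡⟨ cong (λ d → lookup (a i) x + d * B i * lookup (e (h i)) x)
           (m+n≡0⇒m≡0 (A i) (trans (A+D≡C i) C≡0)) ⟩
    lookup (a i) x + 0
      ≡⟨ +-identityʳ _ ⟩
    lookup (a i) x ∎
    where open ≡-Reasoning

  constant-left : ∀ i → (∀ j → j ℤ.< i → C j ≡ 0) → a i ≡ a≪
  constant-left = ℤ-induction _ (proj₁ left)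
    (λ i i<N _ → proj₂ left i (ℤ.<⇒≤ i<N))
    (λ i ih C≡0 → subst (λ j → a j ≡ a≪) (i-r+r i 1ℤ)
      (trans (constant-step (i ℤ.- 1ℤ) (C≡0 _ (i-r<i i 1)))
             (ih _ (i-r<i i 1) (λ j j< → C≡0 j (ℤ.<-trans j< (i-r<i i 1))))))

  constant-right : ∀ i → (∀ j → i ℤ.≤ j → C j ≡ 0) → a i ≡ a≫
  -- The induction runs from left to right only, so it is applied to -i.
  constant-right i = subst (λ i → (∀ j → i ℤ.≤ j → C j ≡ 0) → a i ≡ a≫) (ℤ.neg-involutive i)
    (ℤ-induction (λ i → (∀ j → ℤ.- i ℤ.≤ j → C j ≡ 0) → a (ℤ.- i) ≡ a≫) (ℤ.- proj₁ right)
      (λ i i<-N _ → proj₂ right (ℤ.- i) (subst (ℤ._≤ ℤ.- i) (ℤ.neg-involutive _) (ℤ.neg-mono-≤ (ℤ.<⇒≤ i<-N))))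
      (λ i ih C≡0 → trans (sym (constant-step (ℤ.- i) (C≡0 _ ℤ.≤-refl)))
        (subst (λ j → a j ≡ a≫) (eq i) (ih _ (i-r<i i 1) (λ j le → C≡0 j (ℤ.≤-trans (ℤ.neg-mono-≤ (ℤ.<⇒≤ (i-r<i i 1))) le)))))
      (ℤ.- i))
    where
    eq : ∀ i → ℤ.- (i ℤ.- 1ℤ) ≡ ℤ.- i ℤ.+ 1ℤ
    eq = ℤ-Ring.solve-∀

-- Reversal exchanges A with D and B with E, which turns `step` into itself read backwards. The
-- counters before a reversed step are those after the original one, hence the + 1 in `a`; where
-- `vanishing` applies there is no ribbon, so this shift does no harm.
Square-reverse : ∀ {r} .{{_ : NonZero r}} {l m n k a≪ a≫} → Square r l m n k a≪ a≫ →
                 Square r (reverse k) (reverse m) (reverse n) (reverse l) a≫ a≪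
Square-reverse {r} {a≪ = a≪} {a≫} S = record
  { k/l = Strip-reverse k/l
  ; m/l = Strip-reverse k/m
  ; n/l = Strip-reverse k/n
  ; k/m = Strip-reverse m/l
  ; k/n = Strip-reverse n/l
  ; a   = λ i → a (+ r ℤ.- i ℤ.+ 1ℤ)
  ; vanishing = λ i w≢w → let i′ = + r ℤ.- i in
      subst₂ (λ u x → lookup u x ≡ 0) (sym (constant-step i′ (no-ribbon i w≢w))) (sym (h-reverse i))
        (vanishing i′ λ eq → w≢w (trans (cong w (eq₂ i (+ r))) (trans (sym eq) (cong w (eq₁ i (+ r))))))
  ; step = λ i x → subst₂ (λ u h → lookup u x + A (+ r ℤ.- i) * B (+ r ℤ.- i) * lookup (e h) x
                                 ≡ lookup (a (+ r ℤ.- i ℤ.+ 1ℤ)) x + D (+ r ℤ.- i) * E (+ r ℤ.- i) * lookup (e h) x)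
      (cong a (eq₃ i (+ r))) (sym (h-reverse i)) (sym (step (+ r ℤ.- i) x))
  ; left  = + r ℤ.+ 1ℤ ℤ.- proj₁ right , λ i le → proj₂ right _ (≤-linear 0 le (eq₄ i (+ r) (proj₁ right)))
  ; right = + r ℤ.+ 1ℤ ℤ.- proj₁ left , λ i le → proj₂ left _ (≤-linear 0 le (eq₅ i (+ r) (proj₁ left)))
  }
  where
  open Square S

  eq₁ : ∀ i r → r ℤ.- i ℤ.- r ≡ ℤ.- i
  eq₁ = ℤ-Ring.solve-∀
  eq₂ : ∀ i r → ℤ.- (i ℤ.- r) ≡ r ℤ.- i
  eq₂ = ℤ-Ring.solve-∀
  eq₃ : ∀ i r → r ℤ.- i ≡ r ℤ.- (i ℤ.+ 1ℤ) ℤ.+ 1ℤ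
  eq₃ = ℤ-Ring.solve-∀
  eq₄ : ∀ i r N → (r ℤ.- i ℤ.+ 1ℤ) ℤ.- N ≡ r ℤ.+ 1ℤ ℤ.- N ℤ.- i ℤ.+ 0ℤ
  eq₄ = ℤ-Ring.solve-∀
  eq₅ : ∀ i r N → N ℤ.- (r ℤ.- i ℤ.+ 1ℤ) ≡ i ℤ.- (r ℤ.+ 1ℤ ℤ.- N) ℤ.+ 0ℤ
  eq₅ = ℤ-Ring.solve-∀

  h-reverse : ∀ i → heightᶠ r (reverse w) i ≡ h (+ r ℤ.- i)
  h-reverse i = heightᶠ-cong r {reverse w} {w} {i} {+ r ℤ.- i} (height-reverse r w i)

  no-ribbon : ∀ i → w (ℤ.- (i ℤ.- + r)) ≢ w (ℤ.- i) → C (+ r ℤ.- i) ≡ 0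
  no-ribbon i w≢w with C (+ r ℤ.- i) | source k/l (+ r ℤ.- i) | target k/l (+ r ℤ.- i)
  ... | zero  | _ | _ = refl
  ... | suc c | p | q = contradiction
    (trans (cong w (eq₂ i (+ r))) (trans (proj₁ (proj₂ (carry _ _ p)))
      (trans (sym (proj₁ (proj₂ (carry _ _ q)))) (cong w (eq₁ i (+ r)))))) w≢w

Square-resp : ∀ {r} .{{_ : NonZero r}} {l l′ m m′ n n′ k k′ a≪ a≫} → l ≗ l′ → m ≗ m′ → n ≗ n′ → k ≗ k′ →
              Square r l m n k a≪ a≫ → Square r l′ m′ n′ k′ a≪ a≫
Square-resp l≗ m≗ n≗ k≗ S = record
  { k/l = Strip-resp l≗ k≗ k/l
  ; m/l = Strip-resp l≗ m≗ m/l
  ; n/l = Strip-resp l≗ n≗ n/l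
  ; k/m = Strip-resp m≗ k≗ k/m
  ; k/n = Strip-resp n≗ k≗ k/n
  ; a = a ; vanishing = vanishing ; step = step ; left = left ; right = right
  }
  where open Square S

-- Uniqueness

private
  module Clash {r} .{{_ : NonZero r}} {l m n k k′ a≪ a≫ a≫′}
           (S : Square r l m n k a≪ a≫) (S′ : Square r l m n k′ a≪ a≫′) where
    module S  = Square S
    module S′ = Square S′

    -- Suppose only the first square has a ribbon of k/l at i. Then A = B = 0, so D = E = 1 and
    -- `step` needs a positive counter at h. But the second square has w_{i-r} = 1 and w_i = 0
    -- there, so `vanishing` makes the same counter 0.
    clash : ∀ i → S.w (i ℤ.- + r) ≡ S′.w (i ℤ.- + r) → S.a i ≡ S′.a i → S.h i ≡ S′.h i →
            ¬ (S.C i ≡ 1 × S′.C i ≡ 0)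
    clash i w≡ a≡ h≡ (C≡1 , C′≡0) =
      1+n≢0 (trans (sym (trans (cong (_+_ (lookup (S.a (i ℤ.+ 1ℤ)) (S.h i)))
                     (cong₂ _*_ (cong₂ _*_ D≡1 E≡1) (e-self (S.h i)))) (+-comm _ 1)))
        (trans (S.step i (S.h i)) (cong₂ _+_ a≡0 (cong (λ x → x * S.B i * lookup (e (S.h i)) (S.h i)) A≡0))))
      where
      A≡0 : S.A i ≡ 0
      A≡0 = trans (proj₂ (Strip-unique S.m/l S′.m/l i)) (m+n≡0⇒m≡0 (S′.A i) (trans (S′.A+D≡C i) C′≡0))
      B≡0 : S.B i ≡ 0
      B≡0 = trans (proj₂ (Strip-unique S.n/l S′.n/l i)) (m+n≡0⇒m≡0 (S′.B i) (trans (S′.B+E≡C i) C′≡0))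
      D≡1 : S.D i ≡ 1
      D≡1 = trans (cong (_+ S.D i) (sym A≡0)) (trans (S.A+D≡C i) C≡1)
      E≡1 : S.E i ≡ 1
      E≡1 = trans (cong (_+ S.E i) (sym B≡0)) (trans (S.B+E≡C i) C≡1)
      l≡0 : l i ≡ 0b
      l≡0 = proj₁ (carry _ _ (subst (λ c → toℕ (l i) + c ≡ toℕ (S.w i)) C≡1 (source S.k/l i)))
      w≡1 : S′.w (i ℤ.- + r) ≡ 1b
      w≡1 = trans (sym w≡) (proj₁ (proj₂ (carry _ _
        (subst (λ c → toℕ (k (i ℤ.- + r)) + c ≡ toℕ (S.w (i ℤ.- + r))) C≡1 (target S.k/l i)))))
      w≡0 : S′.w i ≡ 0b
      w≡0 = Fin.toℕ-injective (trans (sym (source S′.k/l i)) (cong₂ _+_ (cong toℕ l≡0) C′≡0))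
      a≡0 : lookup (S.a i) (S.h i) ≡ 0
      a≡0 = subst₂ (λ u x → lookup u x ≡ 0) (sym a≡) (sym h≡)
        (S′.vanishing i λ eq → 0≢1 (trans (sym w≡0) (trans (sym eq) w≡1)))
        where
        0≢1 : 0b ≢ 1b
        0≢1 ()

module _ {r} .{{_ : NonZero r}} {l m n k k′ a≪ a≫ a≫′}
         (S : Square r l m n k a≪ a≫) (S′ : Square r l m n k′ a≪ a≫′) where
  private
    module S  = Square S
    module S′ = Square S′

    agree : ∀ i → S.w i ≡ S′.w i × S.C i ≡ S′.C i × S.a i ≡ S′.a i
    agree = ℤ-induction _ (N₁ ℤ.⊓ N₂ ℤ.⊓ N₃)
      (λ i i<N → from-C i (trans (proj₁ (proj₂ both) i (inj₁ (ℤ.<-≤-trans i<N (ℤ.i⊓j≤j _ N₃))))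
                                 (sym (proj₂ (proj₂ both) i (inj₁ (ℤ.<-≤-trans i<N (ℤ.i⊓j≤j _ N₃))))))
                          (trans (proj₂ S.left i (ℤ.≤-trans (ℤ.<⇒≤ i<N) (ℤ.≤-trans (ℤ.i⊓j≤i _ N₃) (ℤ.i⊓j≤i N₁ N₂))))
                            (sym (proj₂ S′.left i (ℤ.≤-trans (ℤ.<⇒≤ i<N) (ℤ.≤-trans (ℤ.i⊓j≤i _ N₃) (ℤ.i⊓j≤j N₁ N₂)))))))
      (λ i ih → let a≡ = a-agree i ih; h≡ = heightᶠ-local r {S.w} {S′.w} {i} (λ j j<i → proj₁ (ih j j<i))
                    w≡ = proj₁ (ih _ (i-r<i i r)) in
        from-C i (cases (S.C i) (S′.C i) (c≤1 S.k/l i) (c≤1 S′.k/l i)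
          (Clash.clash S S′ i w≡ a≡ h≡) (λ (p , q) → Clash.clash S′ S i (sym w≡) (sym a≡) (sym h≡) (q , p))) a≡)
      where
      both = both-vanish (finite S.k/l) (finite S′.k/l)
      N₁ = proj₁ S.left
      N₂ = proj₁ S′.left
      N₃ = ℤ.- + proj₁ both

      cases : ∀ c c′ → c ≤ 1 → c′ ≤ 1 → ¬ (c ≡ 1 × c′ ≡ 0) → ¬ (c ≡ 0 × c′ ≡ 1) → c ≡ c′
      cases zero       zero       _ _ _ _ = refl
      cases zero       (suc zero) _ _ _ f = ⊥-elim (f (refl , refl))
      cases (suc zero) zero       _ _ f _ = ⊥-elim (f (refl , refl))
      cases (suc zero) (suc zero) _ _ _ _ = refl
      cases (suc (suc _)) _ (s≤s ()) _ _ _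
      cases zero (suc (suc _)) _ (s≤s ()) _ _
      cases (suc zero) (suc (suc _)) _ (s≤s ()) _ _

      from-C : ∀ i → S.C i ≡ S′.C i → S.a i ≡ S′.a i →
               S.w i ≡ S′.w i × S.C i ≡ S′.C i × S.a i ≡ S′.a i
      from-C i C≡ a≡ = Fin.toℕ-injective (trans (sym (source S.k/l i))
        (trans (cong (_+_ (toℕ (l i))) C≡) (source S′.k/l i))) , C≡ , a≡

      a-agree : ∀ i → (∀ j → j ℤ.< i → S.w j ≡ S′.w j × S.C j ≡ S′.C j × S.a j ≡ S′.a j) → S.a i ≡ S′.a i
      a-agree i ih = subst (λ i → S.a i ≡ S′.a i) (i-r+r i 1ℤ) (lookup-ext λ x →
        +-cancelʳ-≡ (S′.D j * S′.E j * lookup (e (S′.h j)) x) _ _ (begin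
          lookup (S.a (j ℤ.+ 1ℤ)) x + S′.D j * S′.E j * lookup (e (S′.h j)) x
            ≡⟨ cong (λ d → lookup (S.a (j ℤ.+ 1ℤ)) x + d)
                 (cong₂ _*_ (cong₂ _*_ (sym D≡) (sym E≡)) (cong (λ h → lookup (e h) x) (sym h≡))) ⟩
          lookup (S.a (j ℤ.+ 1ℤ)) x + S.D j * S.E j * lookup (e (S.h j)) x
            ≡⟨ S.step j x ⟩
          lookup (S.a j) x + S.A j * S.B j * lookup (e (S.h j)) x
            ≡⟨ cong₂ _+_ (cong (λ u → lookup u x) (proj₂ (proj₂ (ih j j<i))))
                 (cong₂ _*_ (cong₂ _*_ A≡ B≡) (cong (λ h → lookup (e h) x) h≡)) ⟩
          lookup (S′.a j) x + S′.A j * S′.B j * lookup (e (S′.h j)) x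
            ≡⟨ sym (S′.step j x) ⟩
          lookup (S′.a (j ℤ.+ 1ℤ)) x + S′.D j * S′.E j * lookup (e (S′.h j)) x ∎))
        where
        open ≡-Reasoning
        j = i ℤ.- 1ℤ
        j<i = i-r<i i 1
        h≡ = heightᶠ-local r {S.w} {S′.w} {j} (λ j′ j′<j → proj₁ (ih j′ (ℤ.<-trans j′<j j<i)))
        A≡ : S.A j ≡ S′.A j
        A≡ = proj₂ (Strip-unique S.m/l S′.m/l j)
        B≡ : S.B j ≡ S′.B j
        B≡ = proj₂ (Strip-unique S.n/l S′.n/l j)
        C≡ = proj₁ (proj₂ (ih j j<i))
        D≡ : S.D j ≡ S′.D j
        D≡ = +-cancelˡ-≡ (S′.A j) _ _ (trans (cong (_+ S.D j) (sym A≡)) (trans (S.A+D≡C j) (trans C≡ (sym (S′.A+D≡C j)))))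
        E≡ : S.E j ≡ S′.E j
        E≡ = +-cancelˡ-≡ (S′.B j) _ _ (trans (cong (_+ S.E j) (sym B≡)) (trans (S.B+E≡C j) (trans C≡ (sym (S′.B+E≡C j)))))

  -- Once w and C agree, `target` returns k; the final counters are read off to the right of both
  -- limits.
  Square-unique : k ≗ k′ × a≫ ≡ a≫′
  Square-unique =
      (λ i → subst (λ j → k j ≡ k′ j) (i+r-r i (+ r)) (Fin.toℕ-injective
        (+-cancelʳ-≡ (S.C (i ℤ.+ + r)) _ _ (trans (target S.k/l (i ℤ.+ + r)) (trans
          (cong toℕ (proj₁ (agree _))) (trans (sym (target S′.k/l (i ℤ.+ + r)))
          (cong (_+_ (toℕ (k′ (i ℤ.+ + r ℤ.- + r)))) (sym (proj₁ (proj₂ (agree _)))))))))))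
    , trans (sym (proj₂ S.right N (ℤ.i≤i⊔j N₁ N₂))) (trans (proj₂ (proj₂ (agree N))) (proj₂ S′.right N (ℤ.i≤j⊔i N₁ N₂)))
    where
    N₁ = proj₁ S.right
    N₂ = proj₁ S′.right
    N = N₁ ℤ.⊔ N₂

-- Comparison with basic square configurations

private
  num : Bool → ℕ
  num b = if b then 1 else 0

  inc : Bool → Bool → Bool → Bool → ℤ
  inc p q u v = if p ∧ q then 1ℤ else if u ∧ v then -1ℤ else 0ℤ

  -- The two hypotheses leave four of the sixteen cases: `u` is the negation of `p`, and `v` of `q`,
  -- so the branches of `inc` cannot compete.
  inc⇒ : ∀ p q u v → num p + num u ≡ 1 → num q + num v ≡ 1 → ∀ x′ x y →
         + x′ ≡ + x ℤ.+ inc p q u v ℤ.* + y →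
         x′ + num u * num v * y ≡ x + num p * num q * y
  inc⇒ true  true  false false _ _ x′ x y eq = trans (+-identityʳ x′)
    (ℤ.+-injective (trans eq (trans (cong (ℤ._+_ (+ x)) (sym (ℤ.pos-* 1 y))) (sym (ℤ.pos-+ x (1 * y))))))
  inc⇒ true  false false true  _ _ x′ x y eq = cong (_+ 0)
    (ℤ.+-injective (trans eq (ℤ.+-identityʳ (+ x))))
  inc⇒ false true  true  false _ _ x′ x y eq = cong (_+ 0)
    (ℤ.+-injective (trans eq (ℤ.+-identityʳ (+ x))))
  inc⇒ false false true  true  _ _ x′ x y eq = trans
    (ℤ.+-injective (trans (ℤ.pos-+ x′ (1 * y)) (trans (cong₂ ℤ._+_ eq (ℤ.pos-* 1 y)) (ring (+ x) (+ y)))))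
    (sym (+-identityʳ x))
    where
    ring : ∀ x y → x ℤ.+ -1ℤ ℤ.* y ℤ.+ 1ℤ ℤ.* y ≡ x
    ring = ℤ-Ring.solve-∀

  inc⇐ : ∀ p q u v → num p + num u ≡ 1 → num q + num v ≡ 1 → ∀ x′ x y →
         x′ + num u * num v * y ≡ x + num p * num q * y →
         + x′ ≡ + x ℤ.+ inc p q u v ℤ.* + y
  inc⇐ true  true  false false _ _ x′ x y eq = trans
    (cong +_ (trans (sym (+-identityʳ x′)) eq)) (trans (ℤ.pos-+ x (1 * y)) (cong (ℤ._+_ (+ x)) (ℤ.pos-* 1 y)))
  inc⇐ true  false false true  _ _ x′ x y eq =
    trans (cong +_ (+-cancelʳ-≡ 0 x′ x eq)) (sym (ℤ.+-identityʳ (+ x)))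
  inc⇐ false true  true  false _ _ x′ x y eq =
    trans (cong +_ (+-cancelʳ-≡ 0 x′ x eq)) (sym (ℤ.+-identityʳ (+ x)))
  inc⇐ false false true  true  _ _ x′ x y eq = trans (sym (ring (+ x′) (+ y))) (cong (ℤ._+ -1ℤ ℤ.* + y)
    (trans (cong (ℤ._+_ (+ x′)) (sym (ℤ.pos-* 1 y))) (trans (sym (ℤ.pos-+ x′ (1 * y))) (cong +_ (trans eq (+-identityʳ x))))))
    where
    ring : ∀ x y → x ℤ.+ 1ℤ ℤ.* y ℤ.+ -1ℤ ℤ.* y ≡ x
    ring = ℤ-Ring.solve-∀

basic⇒square : ∀ {r} .{{_ : NonZero r}} {l m n k a≪ a≫} →
               BasicSquare r l m n k a≪ a≫ → Square r l m n k a≪ a≫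
basic⇒square {r} S = record
  { k/l = strip k/l
  ; m/l = strip m/l
  ; n/l = strip n/l
  ; k/m = strip k/m
  ; k/n = strip k/n
  ; a = a
  ; vanishing = vanishing
  ; step = steps
  ; left  = ℤ.- + M , λ i i≤-M → left i λ j j<i p → one j p (v j (inj₁ (ℤ.<-≤-trans j<i i≤-M)))
  ; right = + M , λ i M≤i → right i λ j i≤j p → one j p (v j (inj₂ (ℤ.≤-trans M≤i i≤j)))
  }
  where
  open BasicSquare S
  M = proj₁ (indicator-finite k/l)
  v = proj₂ (indicator-finite k/l)

  one : ∀ j → RibbonAt k/l j → indicator k/l j ≢ 0
  one j p eq = 1+n≢0 (trans (sym (indicator-yes k/l p)) eq)

  A+D = Strip-additive (strip k/l) (strip m/l) (strip k/m)
  B+E = Strip-additive (strip k/l) (strip n/l) (strip k/n)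

  steps : ∀ i x → lookup (a (i ℤ.+ 1ℤ)) x + indicator k/m i * indicator k/n i * lookup (e (h i)) x
                ≡ lookup (a i) x + indicator m/l i * indicator n/l i * lookup (e (h i)) x
  steps i x = by-cases (ribbonAt? k/l i)
    where
    by-cases : Dec (RibbonAt k/l i) → _
    by-cases (yes p) = inc⇒ (does (ribbonAt? m/l i)) (does (ribbonAt? n/l i)) (does (ribbonAt? k/m i)) (does (ribbonAt? k/n i))
      (trans (A+D i) (indicator-yes k/l p)) (trans (B+E i) (indicator-yes k/l p)) _ _ _ (step i p x)
    by-cases (no ¬p) = cong₂ _+_ (cong (λ u → lookup u x) (sym (no-ribbon i ¬p)))
      (cong (_* lookup (e (h i)) x) (trans (cong (_* indicator k/n i) (m+n≡0⇒n≡0 (indicator m/l i) (trans (A+D i) (indicator-no k/l ¬p))))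
        (sym (cong (_* indicator n/l i) (m+n≡0⇒m≡0 (indicator m/l i) (trans (A+D i) (indicator-no k/l ¬p)))))))

square⇒basic : ∀ {r} .{{_ : NonZero r}} {l m n k a≪ a≫} →
               Square r l m n k a≪ a≫ → BasicSquare r l m n k a≪ a≫
square⇒basic {r} S = record
  { m/l = ribbonStrip m/l
  ; n/l = ribbonStrip n/l
  ; k/m = ribbonStrip k/m
  ; k/n = ribbonStrip k/n
  ; k/l = ribbonStrip k/l
  ; a = a
  ; no-ribbon = λ i ¬p → sym (constant-step i (trans (sym (indicator≡ k/l i)) (indicator-no (ribbonStrip k/l) ¬p)))
  ; vanishing = vanishing
  ; step = λ i p x → let C≡1 = trans (sym (indicator≡ k/l i)) (indicator-yes (ribbonStrip k/l) p) in
      inc⇐ (does (ribbonAt? (ribbonStrip m/l) i)) (does (ribbonAt? (ribbonStrip n/l) i))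
           (does (ribbonAt? (ribbonStrip k/m) i)) (does (ribbonAt? (ribbonStrip k/n) i))
        (trans (cong₂ _+_ (indicator≡ m/l i) (indicator≡ k/m i)) (trans (A+D≡C i) C≡1))
        (trans (cong₂ _+_ (indicator≡ n/l i) (indicator≡ k/n i)) (trans (B+E≡C i) C≡1))
        _ _ _
        (trans (cong (λ d → lookup (a (i ℤ.+ 1ℤ)) x + d * lookup (e (h i)) x)
                 (cong₂ _*_ (indicator≡ k/m i) (indicator≡ k/n i)))
          (trans (step i x) (cong (λ d → lookup (a i) x + d * lookup (e (h i)) x)
                 (sym (cong₂ _*_ (indicator≡ m/l i) (indicator≡ n/l i))))))
  ; left  = λ i none → constant-left i λ j j<i → trans (sym (indicator≡ k/l j)) (indicator-no (ribbonStrip k/l) (none j j<i))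
  ; right = λ i none → constant-right i λ j i≤j → trans (sym (indicator≡ k/l j)) (indicator-no (ribbonStrip k/l) (none j i≤j))
  }
  where
  open Square S
  indicator≡ : ∀ {s t w c} (X : Strip r s t w c) i → indicator (ribbonStrip X) i ≡ c i
  indicator≡ X i = proj₂ (Strip-unique (strip (ribbonStrip X)) X i)

-- The scan, and the square that it yields

-- Here x stands for w_{i-r} and v for a(i)_h.
decide : (a b : ℕ) (l x : Bit) (v : ℕ) → ℕ
decide (suc _) _       _ _ _       = 1
decide zero    (suc _) _ _ _       = 1
decide zero    zero    𝟘 𝟙 (suc _) = 1
decide zero    zero    𝟘 𝟙 zero    = 0
decide zero    zero    𝟘 𝟘 _       = 0
decide zero    zero    𝟙 _ _       = 0

-- The graph of `decide` as a view. The constructor `none` remembers why there is no ribbon, which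
-- is what the proofs of `invariant` and `vanishing` split on.
data Decision : (a b c : ℕ) (l x : Bit) (v : ℕ) → Set where
  fromA : ∀ {b l x v} → b ≤ 1 → Decision 1 b 1 l x v
  fromB : ∀ {l x v} → Decision 0 1 1 l x v
  free  : ∀ {v} → Decision 0 0 1 𝟘 𝟙 (suc v)
  none  : ∀ {l x v} → l ≡ 1b ⊎ x ≡ 0b ⊎ v ≡ 0 → Decision 0 0 0 l x v

decision : ∀ a b l x v → a ≤ 1 → b ≤ 1 → Decision a b (decide a b l x v) l x v
decision (suc zero)    b             l x v       _ b≤1 = fromA b≤1
decision (suc (suc _)) _ _ _ _ (s≤s ()) _
decision zero          (suc zero)    l x v       _ _   = fromB
decision zero          (suc (suc _)) _ _ _ _ (s≤s ())
decision zero          zero          𝟘 𝟙 (suc _) _ _   = free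
decision zero          zero          𝟘 𝟙 zero    _ _   = none (inj₂ (inj₂ refl))
decision zero          zero          𝟘 𝟘 _       _ _   = none (inj₂ (inj₁ refl))
decision zero          zero          𝟙 _ _       _ _   = none (inj₁ refl)

∑-const : ∀ n b → ∑ n (λ _ → b) ≡ n * b
∑-const zero    b = refl
∑-const (suc n) b = trans (cong (_+ b) (∑-const n b)) (+-comm (n * b) b)

sum-updateAt : ∀ {n} (u : Vec ℕ n) h f → Vec.sum (u [ h ]%= f) + lookup u h ≡ Vec.sum u + f (lookup u h)
sum-updateAt (x ∷ u) Fin.zero    f = eq x (f x) (Vec.sum u)
  where
  eq : ∀ x y s → y + s + x ≡ x + s + y
  eq = ℕ-Ring.solve-∀
sum-updateAt (x ∷ u) (Fin.suc h) f = trans (+-assoc x _ _)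
  (trans (cong (_+_ x) (sum-updateAt u h f)) (sym (+-assoc x _ _)))

module Scan (q : ℕ) (l : BitSeq) (A B : ℤ → ℕ) (a₀ : Vec ℕ (suc q))
            (N : ℤ) (β : Bit) (l-left : ∀ i → i ℤ.< N → l i ≡ β)
            (A-left : ∀ i → i ℤ.< N → A i ≡ 0) (B-left : ∀ i → i ℤ.< N → B i ≡ 0) where

  r : ℕ
  r = suc q

  -- A state at i consists of the bits w_{i-1}, w_{i-2}, … and of a(i).
  State : Set
  State = (ℕ → Bit) × Vec ℕ r

  heightˢ<r : ∀ u → sum (map (toℕ ∘ u) (upTo q)) < r
  heightˢ<r u = s≤s (subst (sum (map (toℕ ∘ u) (upTo q)) ≤_) (length-upTo q) (sum-bits≤length u (upTo q)))

  heightˢ : (ℕ → Bit) → Fin r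
  heightˢ u = fromℕ< (heightˢ<r u)

  newC : ℤ → State → ℕ
  newC i (u , a) = decide (A i) (B i) (l i) (u q) (lookup a (heightˢ u))

  newW : ℤ → State → Bit
  newW i s = bit (toℕ (l i) + newC i s)

  -- The truncated subtraction never cuts anything off along a run; this is `DE≤a`.
  update : ℤ → ℕ → ℕ → ℕ
  update i c v = v + A i * B i ∸ (c ∸ A i) * (c ∸ B i)

  push : Bit → (ℕ → Bit) → (ℕ → Bit)
  push b u zero    = b
  push b u (suc p) = u p

  next : ℤ → State → State
  next i s@(u , a) = push (newW i s) u , a [ heightˢ u ]%= update i (newC i s)

  initial : State
  initial = const β , a₀

  run : ℕ → State
  run zero    = initial
  run (suc n) = next (N ℤ.+ + n) (run n)

  stateFrom : ℤ → State
  stateFrom (+ n)     = run n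
  stateFrom -[1+ n ]  = initial

  state : ℤ → State
  state i = stateFrom (i ℤ.- N)

  state-left : ∀ i → i ℤ.≤ N → state i ≡ initial
  state-left i i≤N = go (i ℤ.- N) (ℤ.i≤j⇒i-j≤0 i≤N)
    where
    go : ∀ x → x ℤ.≤ 0ℤ → stateFrom x ≡ initial
    go (+ zero)   _ = refl
    go (+ suc _)  (ℤ.+≤+ ())
    go -[1+ _ ]   _ = refl

  state-next : ∀ i → N ℤ.≤ i → state (i ℤ.+ 1ℤ) ≡ next i (state i)
  state-next i N≤i = go (i ℤ.- N) (ℤ.i≤j⇒0≤j-i N≤i) refl
    where
    eq₁ : ∀ i N → i ℤ.+ 1ℤ ℤ.- N ≡ i ℤ.- N ℤ.+ 1ℤ
    eq₁ = ℤ-Ring.solve-∀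
    eq₂ : ∀ i N → N ℤ.+ (i ℤ.- N) ≡ i
    eq₂ = ℤ-Ring.solve-∀
    go : ∀ x → 0ℤ ℤ.≤ x → i ℤ.- N ≡ x → state (i ℤ.+ 1ℤ) ≡ next i (stateFrom x)
    go (+ n) _ eq = trans
      (cong stateFrom (trans (eq₁ i N) (trans (cong (ℤ._+ 1ℤ) eq) (cong +_ (+-comm n 1)))))
      (cong (λ j → next j (run n)) (trans (cong (ℤ._+_ N) (sym eq)) (eq₂ i N)))

  history : ℤ → ℕ → Bit
  history i = proj₁ (state i)

  a : ℤ → Vec ℕ r
  a i = proj₂ (state i)

  C : ℤ → ℕ
  C i = newC i (state i)

  w : BitSeq
  w i = newW i (state i)

  -- Both `l` and the past bits equal β here, so either l_i = 1 or w_{i-r} = 0, and `decide` gives 0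
  -- whatever the counter.
  C-left : ∀ i → i ℤ.< N → C i ≡ 0
  C-left i i<N rewrite state-left i (ℤ.<⇒≤ i<N) | A-left i i<N | B-left i i<N | l-left i i<N = stays β
    where
    stays : ∀ β {v} → decide 0 0 β β v ≡ 0
    stays 𝟘 = refl
    stays 𝟙 = refl

  w-left : ∀ i → i ℤ.< N → w i ≡ β
  w-left i i<N = trans (cong bit (trans (cong₂ _+_ (cong toℕ (l-left i i<N)) (C-left i i<N)) (+-identityʳ (toℕ β))))
    (Fin.toℕ-injective (toℕ-bit (bit≤1 β)))

  a-left : ∀ i → i ℤ.≤ N → a i ≡ a₀
  a-left i i≤N = cong proj₂ (state-left i i≤N)

  history-left : ∀ i → i ℤ.≤ N → ∀ p → history i p ≡ β
  history-left i i≤N p = cong (λ s → proj₁ s p) (state-left i i≤N)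

  i<N⇒i+1≤N : ∀ {i} → i ℤ.< N → i ℤ.+ 1ℤ ℤ.≤ N
  i<N⇒i+1≤N {i} i<N = subst (ℤ._≤ N) (ℤ.+-comm 1ℤ i) (ℤ.i<j⇒suc[i]≤j i<N)

  history-zero : ∀ i → history (i ℤ.+ 1ℤ) 0 ≡ w i
  history-zero i with i ℤ.<? N
  ... | yes i<N = trans (history-left _ (i<N⇒i+1≤N i<N) 0) (sym (w-left i i<N))
  ... | no  i≮N = cong (λ s → proj₁ s 0) (state-next i (ℤ.≮⇒≥ i≮N))

  history-suc : ∀ i p → history (i ℤ.+ 1ℤ) (suc p) ≡ history i p
  history-suc i p with i ℤ.<? N
  ... | yes i<N = trans (history-left _ (i<N⇒i+1≤N i<N) (suc p)) (sym (history-left i (ℤ.<⇒≤ i<N) p))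
  ... | no  i≮N = cong (λ s → proj₁ s (suc p)) (state-next i (ℤ.≮⇒≥ i≮N))

  -- The recursion cannot refer to `w`, which is read off from its result, so the state carries its
  -- own past. Here the two are identified.
  history≡w : ∀ p i → history i p ≡ w (i ℤ.- + suc p)
  history≡w zero    i = trans (cong (λ j → history j 0) (sym (i-r+r i 1ℤ))) (history-zero (i ℤ.- 1ℤ))
  history≡w (suc p) i = trans (cong (λ j → history j (suc p)) (sym (i-r+r i 1ℤ)))
    (trans (history-suc (i ℤ.- 1ℤ) p) (trans (history≡w p (i ℤ.- 1ℤ)) (cong w
      (trans (eq i (+ suc p)) (cong (λ x → i ℤ.- x) (sym (ℤ.pos-+ 1 (suc p))))))))
    where
    eq : ∀ i x → i ℤ.- 1ℤ ℤ.- x ≡ i ℤ.- (1ℤ ℤ.+ x)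
    eq = ℤ-Ring.solve-∀

  h : ℤ → Fin r
  h = heightᶠ r w

  heightˢ≡h : ∀ i → heightˢ (history i) ≡ h i
  heightˢ≡h i = Fin.toℕ-injective (trans (Fin.toℕ-fromℕ< (heightˢ<r (history i))) (trans
    (cong sum (map-cong (λ p → cong toℕ (history≡w p i)) (upTo q))) (sym (toℕ-heightᶠ r w i))))

  C-decide : ∀ i → C i ≡ decide (A i) (B i) (l i) (w (i ℤ.- + r)) (lookup (a i) (h i))
  C-decide i = cong₂ (λ x h → decide (A i) (B i) (l i) x (lookup (a i) h)) (history≡w q i) (heightˢ≡h i)

  a-next : ∀ i → a (i ℤ.+ 1ℤ) ≡ a i [ h i ]%= update i (C i)
  a-next i with i ℤ.<? N
  ... | yes i<N = trans (a-left _ (i<N⇒i+1≤N i<N)) (trans (sym (a-left i (ℤ.<⇒≤ i<N)))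
    (sym (Vec.updateAt-id-local (h i) (a i)
      (trans (cong₂ (λ x y → lookup (a i) (h i) + x ∸ y)
        (cong (_* B i) (A-left i i<N)) (cong (λ c → (c ∸ A i) * (c ∸ B i)) (C-left i i<N)))
        (trans (cong (λ x → lookup (a i) (h i) + 0 ∸ x) (cong₂ _*_ (0∸n≡0 (A i)) (0∸n≡0 (B i)))) (+-identityʳ _))))))
  ... | no  i≮N = trans (cong proj₂ (state-next i (ℤ.≮⇒≥ i≮N)))
    (cong (λ h → a i [ h ]%= update i (C i)) (heightˢ≡h i))

-- The equations of the scan on which the rest relies, separated from the recursion that produces
-- them.
record Run (q : ℕ) (l : BitSeq) (A B : ℤ → ℕ) (a₀ : Vec ℕ (suc q)) (N : ℤ) (β : Bit) : Set where
  field
    w : BitSeq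
    C : ℤ → ℕ
    a : ℤ → Vec ℕ (suc q)

  h : ℤ → Fin (suc q)
  h = heightᶠ (suc q) w

  field
    C-left   : ∀ i → i ℤ.< N → C i ≡ 0
    w-left   : ∀ i → i ℤ.< N → w i ≡ β
    a-left   : ∀ i → i ℤ.≤ N → a i ≡ a₀
    C-decide : ∀ i → C i ≡ decide (A i) (B i) (l i) (w (i ℤ.- + suc q)) (lookup (a i) (h i))
    w-bit    : ∀ i → w i ≡ bit (toℕ (l i) + C i)
    a-next   : ∀ i → a (i ℤ.+ 1ℤ) ≡ a i [ h i ]%= λ v → v + A i * B i ∸ (C i ∸ A i) * (C i ∸ B i)

scan : ∀ q l A B a₀ N β → (∀ i → i ℤ.< N → l i ≡ β) → (∀ i → i ℤ.< N → A i ≡ 0) → (∀ i → i ℤ.< N → B i ≡ 0) →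
       Run q l A B a₀ N β
scan q l A B a₀ N β l-left A-left B-left = record
  { w = w ; C = C ; a = a
  ; C-left = C-left ; w-left = w-left ; a-left = a-left
  ; C-decide = C-decide ; w-bit = λ _ → refl ; a-next = a-next }
  where open Scan q l A B a₀ N β l-left A-left B-left

-- Far to the left W is constant with value `suc q * toℕ β`, so `a₀-vanishes` is the invariant at
-- the start.
module Construct {q : ℕ} {l m n wA wB A B} (m/l : Strip (suc q) l m wA A) (n/l : Strip (suc q) l n wB B)
                 {a₀ : Vec ℕ (suc q)} {N : ℤ} {β : Bit} (run : Run q l A B a₀ N β)
                 (a₀-vanishes : ∀ x → suc q * toℕ β ≤ toℕ x → lookup a₀ x ≡ 0) where

  open Run run

  private
    r = suc q
    supp = both-vanish (finite m/l) (finite n/l)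
    M = proj₁ supp

  dec : ∀ i → Decision (A i) (B i) (C i) (l i) (w (i ℤ.- + r)) (lookup (a i) (h i))
  dec i = subst (λ c → Decision (A i) (B i) c (l i) (w (i ℤ.- + r)) (lookup (a i) (h i))) (sym (C-decide i))
    (decision _ _ _ _ _ (c≤1 m/l i) (c≤1 n/l i))

  l+C≤1 : ∀ i → toℕ (l i) + C i ≤ 1
  l+C≤1 i with A i | B i | C i | l i | w (i ℤ.- + r) | lookup (a i) (h i) | dec i | source m/l i | source n/l i
  ... | _ | _ | _ | _ | _ | _ | fromA _ | p | _ rewrite proj₁ (carry _ _ p) = ≤-refl
  ... | _ | _ | _ | _ | _ | _ | fromB   | _ | p rewrite proj₁ (carry _ _ p) = ≤-refl
  ... | _ | _ | _ | _ | _ | _ | free    | _ | _ = ≤-refl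
  ... | _ | _ | _ | b | _ | _ | none _  | _ | _ = ≤-trans (≤-reflexive (+-identityʳ (toℕ b))) (bit≤1 b)

  l+C≡w : ∀ i → toℕ (l i) + C i ≡ toℕ (w i)
  l+C≡w i = sym (trans (cong toℕ (w-bit i)) (toℕ-bit (l+C≤1 i)))

  A≤C : ∀ i → A i ≤ C i
  A≤C i with A i | B i | C i | l i | w (i ℤ.- + r) | lookup (a i) (h i) | dec i
  ... | _ | _ | _ | _ | _ | _ | fromA _ = ≤-refl
  ... | _ | _ | _ | _ | _ | _ | fromB   = z≤n
  ... | _ | _ | _ | _ | _ | _ | free    = z≤n
  ... | _ | _ | _ | _ | _ | _ | none _  = z≤n

  B≤C : ∀ i → B i ≤ C i
  B≤C i with A i | B i | C i | l i | w (i ℤ.- + r) | lookup (a i) (h i) | dec i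
  ... | _ | _ | _ | _ | _ | _ | fromA b≤1 = b≤1
  ... | _ | _ | _ | _ | _ | _ | fromB     = ≤-refl
  ... | _ | _ | _ | _ | _ | _ | free      = z≤n
  ... | _ | _ | _ | _ | _ | _ | none _    = z≤n

  -- A bit that m/l or n/l moves away from i - r is present in `w` as well, because by `c≤C` the
  -- scan lets at least as many bits arrive there.
  c≤w : ∀ {t w′ c} → Strip r l t w′ c → (∀ i → c i ≤ C i) → ∀ i → c i ≤ toℕ (w (i ℤ.- + r))
  c≤w {t} {w′} {c} S c≤C i = begin
    c i                                      ≤⟨ m≤n+m (c i) _ ⟩
    toℕ (t (i ℤ.- + r)) + c i                ≡⟨ flow S i ⟩
    toℕ (l (i ℤ.- + r)) + c (i ℤ.- + r)      ≤⟨ +-monoʳ-≤ _ (c≤C (i ℤ.- + r)) ⟩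
    toℕ (l (i ℤ.- + r)) + C (i ℤ.- + r)      ≡⟨ l+C≡w (i ℤ.- + r) ⟩
    toℕ (w (i ℤ.- + r))                      ∎
    where open ≤-Reasoning

  C≤w : ∀ i → C i ≤ toℕ (w (i ℤ.- + r))
  C≤w i with A i | B i | C i | l i | w (i ℤ.- + r) | lookup (a i) (h i) | dec i | c≤w m/l A≤C i | c≤w n/l B≤C i
  ... | _ | _ | _ | _ | _ | _ | fromA _ | p | _ = p
  ... | _ | _ | _ | _ | _ | _ | fromB   | _ | p = p
  ... | _ | _ | _ | _ | _ | _ | free    | _ | _ = ≤-refl
  ... | _ | _ | _ | _ | _ | _ | none _  | _ | _ = z≤n

  outcome : ∀ i → C i ≡ 1 × w i ≡ 1b × w (i ℤ.- + r) ≡ 1b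
              ⊎ C i ≡ 0 × w i ≡ l i × (l i ≡ 1b ⊎ w (i ℤ.- + r) ≡ 0b ⊎ lookup (a i) (h i) ≡ 0)
  outcome i with A i | B i | C i | l i | w (i ℤ.- + r) | lookup (a i) (h i) | dec i | C≤w i | l+C≡w i
  ... | _ | _ | _ | b | x | _ | fromA _ | p | q = inj₁ (refl , proj₁ (proj₂ (carry b (w i) q)) , one x p)
    where
    one : ∀ (b : Bit) → 1 ≤ toℕ b → b ≡ 1b
    one 𝟙 _ = refl
  ... | _ | _ | _ | b | x | _ | fromB   | p | q = inj₁ (refl , proj₁ (proj₂ (carry b (w i) q)) , one x p)
    where
    one : ∀ (b : Bit) → 1 ≤ toℕ b → b ≡ 1b
    one 𝟙 _ = refl
  ... | _ | _ | _ | _ | _ | _ | free    | _ | q = inj₁ (refl , proj₁ (proj₂ (carry 𝟘 (w i) q)) , refl)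
  ... | _ | _ | _ | _ | _ | _ | none p  | _ | q =
    inj₂ (refl , Fin.toℕ-injective (sym (trans (sym (+-identityʳ _)) q)) , p)

  D E : ℤ → ℕ
  D i = C i ∸ A i
  E i = C i ∸ B i

  upd : ℤ → ℕ → ℕ
  upd i v = v + A i * B i ∸ D i * E i

  -- D and E are both 1 only in the case `free`, which presupposes a positive counter.
  DE≤a : ∀ i → D i * E i ≤ lookup (a i) (h i) + A i * B i
  DE≤a i with A i | B i | C i | l i | w (i ℤ.- + r) | lookup (a i) (h i) | dec i
  ... | _ | _ | _ | _ | _ | _ | fromA _ = z≤n
  ... | _ | _ | _ | _ | _ | _ | fromB   = z≤n
  ... | _ | _ | _ | _ | _ | _ | free    = s≤s z≤n
  ... | _ | _ | _ | _ | _ | _ | none _  = z≤n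

  a-other : ∀ i x → x ≢ h i → lookup (a (i ℤ.+ 1ℤ)) x ≡ lookup (a i) x
  a-other i x x≢h = trans (cong (λ u → lookup u x) (a-next i)) (Vec.lookup∘updateAt′ x (h i) x≢h (a i))

  a-self : ∀ i → lookup (a (i ℤ.+ 1ℤ)) (h i) + D i * E i ≡ lookup (a i) (h i) + A i * B i
  a-self i = trans (cong (_+ D i * E i) (trans (cong (λ u → lookup u (h i)) (a-next i)) (Vec.lookup∘updateAt (h i) (a i))))
                   (m∸n+n≡m (DE≤a i))

  step : ∀ i x → lookup (a (i ℤ.+ 1ℤ)) x + D i * E i * lookup (e (h i)) x
               ≡ lookup (a i) x + A i * B i * lookup (e (h i)) x
  step i x with x Fin.≟ h i
  ... | yes refl rewrite e-self (h i) | *-identityʳ (D i * E i) | *-identityʳ (A i * B i) = a-self i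
  ... | no x≢h rewrite e-other x≢h | *-zeroʳ (D i * E i) | *-zeroʳ (A i * B i) = cong (_+ 0) (a-other i x x≢h)

  a-constant : ∀ i → C i ≡ 0 → a (i ℤ.+ 1ℤ) ≡ a i
  a-constant i C≡0 = lookup-ext λ x → +-cancelʳ-≡ 0 _ _ (trans
    (cong (λ d → lookup (a (i ℤ.+ 1ℤ)) x + d * E i * lookup (e (h i)) x) (sym (trans (cong (_∸ A i) C≡0) (0∸n≡0 (A i)))))
    (trans (step i x) (cong (λ d → lookup (a i) x + d * B i * lookup (e (h i)) x) (n≤0⇒n≡0 (subst (A i ≤_) C≡0 (A≤C i))))))

  -- One family for windows of every length: `H q` is the height and `H r` is W, so the two differ
  -- by the bit at i - r.
  H : ℕ → ℤ → ℕ
  H m i = ∑ m (λ p → toℕ (w (i ℤ.- + suc p)))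

  W : ℤ → ℕ
  W = H r

  H-next : ∀ m i → H (suc m) (i ℤ.+ 1ℤ) ≡ toℕ (w i) + H m i
  H-next m i = trans (∑-front m _) (cong₂ _+_ (cong (toℕ ∘ w) (i+r-r i 1ℤ))
    (∑-≗ m (λ p → cong (toℕ ∘ w) (trans (cong (λ x → i ℤ.+ 1ℤ ℤ.- x) (ℤ.pos-+ 1 (suc p))) (eq i (+ suc p))))))
    where
    eq : ∀ i x → i ℤ.+ 1ℤ ℤ.- (1ℤ ℤ.+ x) ≡ i ℤ.- x
    eq = ℤ-Ring.solve-∀

  toℕ-h : ∀ i → toℕ (h i) ≡ H q i
  toℕ-h i = trans (toℕ-heightᶠ r w i) (height-∑ r w i)

  -- The far left has W = 0 or W = r, and a counter for height x can only grow
  -- while W = x + 1; to leave this range downwards it must be exhausted.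
  invariant : ∀ i x → W i ≤ toℕ x → lookup (a i) x ≡ 0
  invariant = ℤ-induction _ N
    (λ i i<N x W≤x → trans (cong (λ u → lookup u x) (a-left i (ℤ.<⇒≤ i<N)))
      (a₀-vanishes x (subst (_≤ toℕ x) (trans (∑-≗ r (λ p → cong toℕ
        (w-left _ (ℤ.<-trans (i-r<i i (suc p)) i<N)))) (∑-const r (toℕ β))) W≤x)))
    (λ i ih x → subst (λ i → W i ≤ toℕ x → lookup (a i) x ≡ 0) (i-r+r i 1ℤ)
      (next-holds (i ℤ.- 1ℤ) (ih _ (i-r<i i 1)) x))
    where
    next-holds : ∀ i → (∀ x → W i ≤ toℕ x → lookup (a i) x ≡ 0) →
                 ∀ x → W (i ℤ.+ 1ℤ) ≤ toℕ x → lookup (a (i ℤ.+ 1ℤ)) x ≡ 0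
    next-holds i ih x W≤x with H-next q i | outcome i
    -- With a ribbon, W is h + 1 both before and after, so every x in question exceeds h and its
    -- counter is not touched.
    ... | W≡ | inj₁ (C≡1 , w≡1 , x≡1) = trans (a-other i x x≢h) (ih x (subst (_≤ toℕ x) (sym W≡W) h<x))
      where
      h<x : suc (H q i) ≤ toℕ x
      h<x = subst (_≤ toℕ x) (trans W≡ (cong (λ b → toℕ b + H q i) w≡1)) W≤x
      W≡W : W i ≡ suc (H q i)
      W≡W = trans (cong (λ b → H q i + toℕ b) x≡1) (+-comm (H q i) 1)
      x≢h : x ≢ h i
      x≢h refl = <-irrefl (sym (toℕ-h i)) h<x
    ... | W≡ | inj₂ (C≡0 , w≡l , why) = trans (cong (λ u → lookup u x) (a-constant i C≡0)) (by-case why)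
      where
      Wx : toℕ (w i) + H q i ≤ toℕ x
      Wx = subst (_≤ toℕ x) W≡ W≤x
      -- If l_i = 1 or w_{i-r} = 0, then W does not decrease. Otherwise it can drop from h + 1 to h,
      -- and the only new index x = h has counter 0 by the decision.
      by-case : l i ≡ 1b ⊎ w (i ℤ.- + r) ≡ 0b ⊎ lookup (a i) (h i) ≡ 0 → lookup (a i) x ≡ 0
      by-case (inj₁ l≡1) = ih x (≤-trans (+-monoʳ-≤ (H q i) (bit≤1 (w (i ℤ.- + r))))
        (≤-trans (≤-reflexive (+-comm (H q i) 1)) (subst (λ b → toℕ b + H q i ≤ toℕ x) (trans w≡l l≡1) Wx)))
      by-case (inj₂ (inj₁ x≡0)) = ih x (≤-trans (≤-reflexive (trans (cong (λ b → H q i + toℕ b) x≡0) (+-identityʳ _)))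
        (≤-trans (m≤n+m (H q i) (toℕ (w i))) Wx))
      by-case (inj₂ (inj₂ a≡0)) with x Fin.≟ h i
      ... | yes refl = a≡0
      ... | no x≢h = ih x (≤-trans (+-monoʳ-≤ (H q i) (bit≤1 (w (i ℤ.- + r))))
        (≤-trans (≤-reflexive (+-comm (H q i) 1))
          (≤∧≢⇒< (≤-trans (m≤n+m (H q i) (toℕ (w i))) Wx) (λ eq → x≢h (Fin.toℕ-injective (trans (sym eq) (sym (toℕ-h i))))))))

  -- Of the three reasons for the absence of a ribbon, one is the claim itself. Under the other two
  -- the bit at i - r is 0, so W_i equals the height and `invariant` applies.
  vanishing : ∀ i → w (i ℤ.- + r) ≢ w i → lookup (a i) (h i) ≡ 0
  vanishing i w≢w with outcome i
  ... | inj₁ (_ , w≡1 , x≡1) = contradiction (trans x≡1 (sym w≡1)) w≢w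
  ... | inj₂ (_ , _ , inj₂ (inj₂ a≡0)) = a≡0
  ... | inj₂ (_ , w≡l , inj₁ l≡1) = invariant i (h i) (≤-reflexive
    (trans (cong (λ b → H q i + toℕ b) (zero-if (w (i ℤ.- + r)) λ eq → w≢w (trans eq (sym (trans w≡l l≡1)))))
           (trans (+-identityʳ _) (sym (toℕ-h i)))))
    where
    zero-if : ∀ (b : Bit) → b ≢ 1b → b ≡ 0b
    zero-if 𝟘 _ = refl
    zero-if 𝟙 f = ⊥-elim (f refl)
  ... | inj₂ (_ , _ , inj₂ (inj₁ x≡0)) = invariant i (h i) (≤-reflexive
    (trans (cong (λ b → H q i + toℕ b) x≡0) (trans (+-identityʳ _) (sym (toℕ-h i)))))

  -- The witness with the departures removed; by `C≤w` the truncated difference is exact.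
  k : BitSeq
  k i = bit (toℕ (w i) ∸ C (i ℤ.+ + r))

  k+C≡w : ∀ i → toℕ (k (i ℤ.- + r)) + C i ≡ toℕ (w (i ℤ.- + r))
  k+C≡w i = trans (cong (_+ C i) (trans (toℕ-bit (≤-trans (m∸n≤m (toℕ (w (i ℤ.- + r))) (C (i ℤ.- + r ℤ.+ + r))) (bit≤1 (w (i ℤ.- + r)))))
      (cong (λ j → toℕ (w (i ℤ.- + r)) ∸ C j) (i-r+r i (+ r)))))
    (m∸n+n≡m (C≤w i))

  module _ (T : ℤ) (C-right : ∀ i → T ℤ.≤ i → C i ≡ 0) where

    C-finite : FinSupp C
    C-finite = ∣ N ∣ + ∣ T ∣ , λ
      { i (inj₁ i<) → C-left i (ℤ.<-≤-trans i< (ℤ.≤-trans (ℤ.neg-mono-≤ (ℤ.+≤+ (m≤m+n ∣ N ∣ ∣ T ∣))) (-∣i∣≤i N)))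
      ; i (inj₂ ≤i) → C-right i (ℤ.≤-trans (ℤ.≤-trans (i≤∣i∣ T) (ℤ.+≤+ (m≤n+m ∣ T ∣ ∣ N ∣))) ≤i) }
      where
      i≤∣i∣ : ∀ i → i ℤ.≤ + ∣ i ∣
      i≤∣i∣ (+ n)    = ℤ.≤-refl
      i≤∣i∣ -[1+ n ] = ℤ.-≤+
      -∣i∣≤i : ∀ i → ℤ.- + ∣ i ∣ ℤ.≤ i
      -∣i∣≤i (+ n)    = ℤ.neg-≤-pos
      -∣i∣≤i -[1+ n ] = ℤ.≤-refl

    a-right : ∀ i → T ℤ.≤ i → a i ≡ a T
    a-right = ℤ-induction _ T (λ i i<T T≤i → contradiction T≤i (ℤ.<⇒≱ i<T)) by-step
      where
      by-step : ∀ i → (∀ j → j ℤ.< i → T ℤ.≤ j → a j ≡ a T) → T ℤ.≤ i → a i ≡ a T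
      by-step i ih T≤i with T ℤ.≟ i
      ... | yes refl = refl
      ... | no T≢i = subst (λ j → a j ≡ a T) (i-r+r i 1ℤ)
          (trans (a-constant (i ℤ.- 1ℤ) (C-right _ T≤i-1)) (ih _ (i-r<i i 1) T≤i-1))
        where
        T≤i-1 : T ℤ.≤ i ℤ.- 1ℤ
        T≤i-1 = ≤-linear 0 (ℤ.i<j⇒suc[i]≤j (ℤ.≤∧≢⇒< T≤i T≢i)) (eq i T)
          where
          eq : ∀ i T → i ℤ.- 1ℤ ℤ.- T ≡ i ℤ.- (1ℤ ℤ.+ T) ℤ.+ 0ℤ
          eq = ℤ-Ring.solve-∀

    square : Square r l m n k a₀ (a T)
    square = record
      { k/l = k/l
      ; m/l = m/l
      ; n/l = n/l
      ; k/m = Strip-difference D k/l m/l (λ i → m+[n∸m]≡n (A≤C i))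
      ; k/n = Strip-difference E k/l n/l (λ i → m+[n∸m]≡n (B≤C i))
      ; a = a
      ; vanishing = vanishing
      ; step = step
      ; left = N , a-left
      ; right = T , a-right
      }
      where
      k/l : Strip r l k w C
      k/l = record { source = l+C≡w ; target = k+C≡w ; finite = C-finite }

  -- Where l_i = 1 a ribbon would push l_i + C_i above 1, so the scan comes to rest by itself and
  -- leaves whatever counters it has.
  completion₁ : ∀ N₁ → (∀ i → N₁ ℤ.≤ i → l i ≡ 1b) → ∃ λ k → ∃ λ a≫ → Square r l m n k a₀ a≫
  completion₁ N₁ l≡1 = k , _ , square N₁ λ i N₁≤i → no-ribbon i (l≡1 i N₁≤i)
    where
    no-ribbon : ∀ i → l i ≡ 1b → C i ≡ 0
    no-ribbon i l≡1 = n≤0⇒n≡0 (≤-pred (subst (λ b → toℕ b + C i ≤ 1) l≡1 (l+C≤1 i)))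

  module _ (N₁ : ℤ) (l≡0 : ∀ i → N₁ ℤ.≤ i → l i ≡ 0b) where
    private
      -- From here on `l`, `A` and `B` are all 0, so `w` coincides with `C` and only free ribbons
      -- occur, each at the price of one counter.
      T₀ = N₁ ℤ.⊔ + M

      A≡0 : ∀ i → T₀ ℤ.≤ i → A i ≡ 0
      A≡0 i le = proj₁ (proj₂ supp) i (inj₂ (ℤ.≤-trans (ℤ.i≤j⊔i N₁ (+ M)) le))
      B≡0 : ∀ i → T₀ ℤ.≤ i → B i ≡ 0
      B≡0 i le = proj₂ (proj₂ supp) i (inj₂ (ℤ.≤-trans (ℤ.i≤j⊔i N₁ (+ M)) le))
      w≡C : ∀ i → T₀ ℤ.≤ i → toℕ (w i) ≡ C i
      w≡C i le = trans (sym (l+C≡w i)) (cong (λ b → toℕ b + C i) (l≡0 i (ℤ.≤-trans (ℤ.i≤i⊔j N₁ (+ M)) le)))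

      C*C≡C : ∀ i → C i * C i ≡ C i
      C*C≡C i with outcome i
      ... | inj₁ (C≡1 , _) rewrite C≡1 = refl
      ... | inj₂ (C≡0 , _) rewrite C≡0 = refl

      sum-a : ∀ i → T₀ ℤ.≤ i → ∣ a i ∣ᵥ ≡ ∣ a (i ℤ.+ 1ℤ) ∣ᵥ + C i
      sum-a i le = sym (+-cancelʳ-≡ v _ _ (begin
          ∣ a (i ℤ.+ 1ℤ) ∣ᵥ + C i + v                    ≡⟨ shuffle _ (C i) v ⟩
          ∣ a (i ℤ.+ 1ℤ) ∣ᵥ + v + C i                    ≡⟨ cong (λ u → ∣ u ∣ᵥ + v + C i) (a-next i) ⟩
          ∣ a i [ h i ]%= upd i ∣ᵥ + v + C i    ≡⟨ cong (_+ C i) (sum-updateAt (a i) (h i) (upd i)) ⟩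
          ∣ a i ∣ᵥ + upd i v + C i              ≡⟨ +-assoc ∣ a i ∣ᵥ _ _ ⟩
          ∣ a i ∣ᵥ + (upd i v + C i)            ≡⟨ cong (_+_ ∣ a i ∣ᵥ) upd+C ⟩
          ∣ a i ∣ᵥ + v                                   ∎))
        where
        open ≡-Reasoning
        v = lookup (a i) (h i)
        shuffle : ∀ x y z → x + y + z ≡ x + z + y
        shuffle = ℕ-Ring.solve-∀
        DE≡C : D i * E i ≡ C i
        DE≡C = trans (cong₂ (λ x y → (C i ∸ x) * (C i ∸ y)) (A≡0 i le) (B≡0 i le)) (C*C≡C i)
        upd+C : upd i v + C i ≡ v
        upd+C = trans (cong (_+_ (upd i v)) (sym DE≡C)) (trans (m∸n+n≡m (DE≤a i))
          (trans (cong (λ x → v + x * B i) (A≡0 i le)) (+-identityʳ v)))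

      -- In the potential Φ a bit 1 at i - 1 - p counts r - p times. A step to the
      -- right takes 1 from each of the W i bits in the window; a bit moved by a
      -- ribbon gains r, which is paid for by the counters.
      P Φ : ℤ → ℕ
      P i = ∑ r (λ m → H (suc m) i)
      Φ i = P i + r * ∣ a i ∣ᵥ

      P-next : ∀ i → P (i ℤ.+ 1ℤ) + W i ≡ r * toℕ (w i) + P i
      P-next i = begin
        P (i ℤ.+ 1ℤ) + W i                                  ≡⟨ cong (_+ W i) (∑-≗ r (λ m → H-next m i)) ⟩
        ∑ r (λ m → toℕ (w i) + H m i) + W i                 ≡⟨ cong (_+ W i) (∑-+ r (λ _ → toℕ (w i)) (λ m → H m i)) ⟩
        ∑ r (λ _ → toℕ (w i)) + ∑ r (λ m → H m i) + W i     ≡⟨ +-assoc (∑ r (λ _ → toℕ (w i))) _ _ ⟩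
        ∑ r (λ _ → toℕ (w i)) + ∑ (suc r) (λ m → H m i)     ≡⟨ cong₂ _+_ (∑-const r (toℕ (w i))) (∑-front r (λ m → H m i)) ⟩
        r * toℕ (w i) + P i                                 ∎
        where open ≡-Reasoning

      Φ-next : ∀ i → T₀ ℤ.≤ i → Φ (i ℤ.+ 1ℤ) + W i ≡ Φ i
      Φ-next i le = linear (Φ (i ℤ.+ 1ℤ) + W i) (Φ i)
        (cong₂ _+_ (cong₂ _+_ (P-next i) (cong (_*_ r) (sym (sum-a i le)))) (cong (_*_ r) (w≡C i le)))
        (eq (P (i ℤ.+ 1ℤ)) (P i) r ∣ a (i ℤ.+ 1ℤ) ∣ᵥ ∣ a i ∣ᵥ (W i) (toℕ (w i)) (C i))
        where
        eq : ∀ p′ p r s′ s W x c →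
          p′ + r * s′ + W + (r * x + p + r * s + r * c) ≡ p + r * s + (p′ + W + r * (s′ + c) + r * x)
        eq = ℕ-Ring.solve-∀

      descend : ∀ n i → Φ i ≡ n → T₀ ℤ.≤ i → ∃ λ T → T₀ ℤ.≤ T × W T ≡ 0
      descend = <-rec _ by-step
        where
        by-step : ∀ n → (∀ {n′} → n′ < n → ∀ i → Φ i ≡ n′ → T₀ ℤ.≤ i → ∃ λ T → T₀ ℤ.≤ T × W T ≡ 0) →
               ∀ i → Φ i ≡ n → T₀ ℤ.≤ i → ∃ λ T → T₀ ℤ.≤ T × W T ≡ 0
        by-step n ih i refl le = by-W (W i) refl
          where
          by-W : ∀ v → W i ≡ v → ∃ λ T → T₀ ℤ.≤ T × W T ≡ 0
          by-W zero    W≡ = i , le , W≡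
          by-W (suc v) W≡ = ih
            (subst (Φ (i ℤ.+ 1ℤ) <_) (trans (cong (_+_ (Φ (i ℤ.+ 1ℤ))) (sym W≡)) (Φ-next i le))
              (m<m+n (Φ (i ℤ.+ 1ℤ)) z<s))
            (i ℤ.+ 1ℤ) refl (ℤ.≤-trans le (ℤ.i≤i+j i 1ℤ))

      stop = descend _ T₀ refl ℤ.≤-refl
      T = proj₁ stop

      W⇒C : ∀ i → W i ≡ 0 → C i ≡ 0
      W⇒C i W≡0 = n≤0⇒n≡0 (≤-trans (C≤w i) (≤-trans (m≤n+m _ (H q i)) (≤-reflexive W≡0)))

      W-right : ∀ i → T ℤ.≤ i → W i ≡ 0
      W-right = ℤ-induction _ T (λ i i<T T≤i → contradiction T≤i (ℤ.<⇒≱ i<T)) by-step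
        where
        by-step : ∀ i → (∀ j → j ℤ.< i → T ℤ.≤ j → W j ≡ 0) → T ℤ.≤ i → W i ≡ 0
        by-step i ih T≤i with T ℤ.≟ i
        ... | yes refl = proj₂ (proj₂ stop)
        ... | no T≢i = subst (λ j → W j ≡ 0) (i-r+r i 1ℤ)
            (trans (H-next q j) (cong₂ _+_ (trans (w≡C j T₀≤j) (W⇒C j Wj≡0)) (m+n≡0⇒m≡0 (H q j) Wj≡0)))
          where
          j = i ℤ.- 1ℤ
          T≤j : T ℤ.≤ j
          T≤j = ≤-linear 0 (ℤ.i<j⇒suc[i]≤j (ℤ.≤∧≢⇒< T≤i T≢i)) (eq i T)
            where
            eq : ∀ i T → i ℤ.- 1ℤ ℤ.- T ≡ i ℤ.- (1ℤ ℤ.+ T) ℤ.+ 0ℤ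
            eq = ℤ-Ring.solve-∀
          T₀≤j : T₀ ℤ.≤ j
          T₀≤j = ℤ.≤-trans (proj₁ (proj₂ stop)) T≤j
          Wj≡0 : W j ≡ 0
          Wj≡0 = ih j (i-r<i i 1) T≤j

    -- An empty window stays empty, as no bit is left to move and `l` supplies none. With W = 0 the
    -- invariant covers every index, so all counters end at 0.
    completion₀ : ∃ λ k → Square r l m n k a₀ 0ᵥ
    completion₀ = k , subst (Square r l m n k a₀)
      (lookup-ext λ x → trans (invariant T x (subst (_≤ toℕ x) (sym (W-right T ℤ.≤-refl)) z≤n)) (sym (Vec.lookup-replicate x 0)))
      (square T (λ i T≤i → W⇒C i (W-right i T≤i)))

completion : ∀ {q l m n wA wB A B} → Strip (suc q) l m wA A → Strip (suc q) l n wB B →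
  ∀ {a₀ : Vec ℕ (suc q)} N β → (∀ i → i ℤ.< N → l i ≡ β) →
  (∀ x → suc q * toℕ β ≤ toℕ x → lookup a₀ x ≡ 0) →
  (∀ N′ → (∀ i → N′ ℤ.≤ i → l i ≡ 1b) → ∃ λ k → ∃ λ a≫ → Square (suc q) l m n k a₀ a≫) ×
  (∀ N′ → (∀ i → N′ ℤ.≤ i → l i ≡ 0b) → ∃ λ k → Square (suc q) l m n k a₀ 0ᵥ)
completion {q} {l} m/l n/l {a₀} N β l-left a₀-vanishes = completion₁ , completion₀
  where
  M = both-vanish (Strip.finite m/l) (Strip.finite n/l)
  -- To the left of `N⁻` there are no ribbons of either strip and no bits other than β, so the scan
  -- can start from a constant state.
  N⁻ = N ℤ.⊓ (ℤ.- + proj₁ M)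
  run : Run q l _ _ a₀ N⁻ β
  run = scan q l _ _ a₀ N⁻ β
    (λ i i< → l-left i (ℤ.<-≤-trans i< (ℤ.i⊓j≤i N _)))
    (λ i i< → proj₁ (proj₂ M) i (inj₁ (ℤ.<-≤-trans i< (ℤ.i⊓j≤j N _))))
    (λ i i< → proj₂ (proj₂ M) i (inj₁ (ℤ.<-≤-trans i< (ℤ.i⊓j≤j N _))))
  open Construct m/l n/l run a₀-vanishes

-- Edge sequences by recursion on the parts

⟦_≡_⟧ : ℤ → ℤ → ℕ
⟦ i ≡ j ⟧ = if does (i ℤ.≟ j) then 1 else 0

⟦≡⟧-yes : ∀ {i j} → i ≡ j → ⟦ i ≡ j ⟧ ≡ 1
⟦≡⟧-yes {i} {j} p = cong (if_then 1 else 0) (dec-true (i ℤ.≟ j) p)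

⟦≡⟧-no : ∀ {i j} → i ≢ j → ⟦ i ≡ j ⟧ ≡ 0
⟦≡⟧-no {i} {j} p = cong (if_then 1 else 0) (dec-false (i ℤ.≟ j) p)

⟦≡⟧-cong : ∀ {i j i′ j′} → (i ≡ j → i′ ≡ j′) → (i′ ≡ j′ → i ≡ j) → ⟦ i ≡ j ⟧ ≡ ⟦ i′ ≡ j′ ⟧
⟦≡⟧-cong {i} {j} to from with i ℤ.≟ j
... | yes p = sym (⟦≡⟧-yes (to p))
... | no ¬p = sym (⟦≡⟧-no (¬p ∘ from))

-- The edge sequence by recursion on the parts: removing the largest part x
-- deletes the bit at x - 1 and shifts the other bits to the right.
edges : List ℕ → ℤ → ℕ
edges []       (+ _)    = 0
edges []       -[1+ _ ] = 1
edges (x ∷ xs) k        = ⟦ k ≡ + x ℤ.- 1ℤ ⟧ + edges xs (k ℤ.+ 1ℤ)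

edges-large : ∀ xs k → + sum xs ℤ.≤ k → edges xs k ≡ 0
edges-large []       (+ _) _  = refl
edges-large (x ∷ xs) k     le = cong₂ _+_
  (⟦≡⟧-no {k} {+ x ℤ.- 1ℤ} λ { refl → ℤ.<⇒≱ (i-r<i (+ x) 1) (ℤ.≤-trans (ℤ.+≤+ (m≤m+n x (sum xs))) le) })
  (edges-large xs (k ℤ.+ 1ℤ) (ℤ.≤-trans (ℤ.+≤+ (m≤n+m (sum xs) x)) (ℤ.≤-trans le (ℤ.i≤i+j k 1ℤ))))

edges-small : ∀ xs k → k ℤ.< ℤ.- + length xs → edges xs k ≡ 1
edges-small []       -[1+ _ ] _ = refl
edges-small []       (+ _)    (ℤ.+<+ ())
edges-small (x ∷ xs) k       lt = cong₂ _+_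
  (⟦≡⟧-no {k} {+ x ℤ.- 1ℤ} λ { refl → ℤ.<⇒≱ lt (ℤ.≤-trans (ℤ.neg-mono-≤ (ℤ.+≤+ (s≤s (z≤n {length xs}))))
    (ℤ.+-monoˡ-≤ -1ℤ (ℤ.+≤+ (z≤n {x})))) })
  (edges-small xs (k ℤ.+ 1ℤ) (<-linear 0 lt
    (trans (eq k (+ length xs)) (cong (λ l → ℤ.- l ℤ.- k ℤ.+ 0ℤ) (sym (ℤ.pos-+ 1 (length xs)))))))
  where
  eq : ∀ k l → ℤ.- l ℤ.- (k ℤ.+ 1ℤ) ≡ ℤ.- (1ℤ ℤ.+ l) ℤ.- k ℤ.+ 0ℤ
  eq = ℤ-Ring.solve-∀

-- Sortedness enters here: the remaining edges stay clear of the position of the head, which keeps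
-- `edges` from reaching 2.
edges-above-head : ∀ {x xs} → Linked _≥_ (x ∷ xs) → ∀ k → + x ℤ.≤ k → edges xs k ≡ 0
edges-above-head [-]          (+ _) _  = refl
edges-above-head {xs = y ∷ ys} (y≤x ∷ L) k x≤k = cong₂ _+_
  (⟦≡⟧-no {k} {+ y ℤ.- 1ℤ} λ { refl → ℤ.<⇒≱ (i-r<i (+ y) 1) (ℤ.≤-trans (ℤ.+≤+ y≤x) x≤k) })
  (edges-above-head L (k ℤ.+ 1ℤ) (ℤ.≤-trans (ℤ.+≤+ y≤x) (ℤ.≤-trans x≤k (ℤ.i≤i+j k 1ℤ))))

nth≤head : ∀ {x xs} → Linked _≥_ (x ∷ xs) → ∀ i → nth xs i ≤ x
nth≤head [-]        i       = z≤n
nth≤head (y≤x ∷ L)  zero    = y≤x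
nth≤head (y≤x ∷ L)  (suc i) = ≤-trans (nth≤head L i) y≤x

edgeAt : List ℕ → ℕ → ℤ
edgeAt xs i = + nth xs i ℤ.- + i ℤ.- 1ℤ

edgeAt-suc : ∀ x xs i → edgeAt (x ∷ xs) (suc i) ℤ.+ 1ℤ ≡ edgeAt xs i
edgeAt-suc x xs i = trans (cong (λ j → + nth xs i ℤ.- j ℤ.- 1ℤ ℤ.+ 1ℤ) (ℤ.pos-+ 1 i)) (eq (+ nth xs i) (+ i))
  where
  eq : ∀ n i → n ℤ.- (1ℤ ℤ.+ i) ℤ.- 1ℤ ℤ.+ 1ℤ ≡ n ℤ.- i ℤ.- 1ℤ
  eq = ℤ-Ring.solve-∀

edges-edgeAt : ∀ {xs} → Linked _≥_ xs → ∀ i → edges xs (edgeAt xs i) ≡ 1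
edges-edgeAt []                 zero    = refl
edges-edgeAt []                 (suc i) = refl
edges-edgeAt {x ∷ xs} L         zero    = cong₂ _+_
  (⟦≡⟧-yes (cong (ℤ._- 1ℤ) (ℤ.+-identityʳ (+ x))))
  (edges-above-head L _ (ℤ.≤-reflexive (sym (eq (+ x)))))
  where
  eq : ∀ x → x ℤ.- 0ℤ ℤ.- 1ℤ ℤ.+ 1ℤ ≡ x
  eq = ℤ-Ring.solve-∀
edges-edgeAt {x ∷ xs} L         (suc i) = cong₂ _+_ (⟦≡⟧-no below)
  (trans (cong (edges xs) (edgeAt-suc x xs i)) (edges-edgeAt (Linked.tail L) i))
  where
  below : edgeAt (x ∷ xs) (suc i) ≢ + x ℤ.- 1ℤ
  below eq = ℤ.<⇒≢ (ℤ.≤-<-trans (ℤ.+-monoˡ-≤ -1ℤ (ℤ.+-monoˡ-≤ (ℤ.- + suc i) (ℤ.+≤+ (nth≤head L i))))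
    (ℤ.+-monoˡ-< -1ℤ (i-r<i (+ x) (suc i)))) eq

edges⇒edgeAt : ∀ xs k → edges xs k ≢ 0 → ∃ λ i → k ≡ edgeAt xs i
edges⇒edgeAt []       (+ _)    ≢0 = contradiction refl ≢0
edges⇒edgeAt []       -[1+ n ] _  = n , sym (minus n)
  where
  minus : ∀ n → 0ℤ ℤ.- + n ℤ.- 1ℤ ≡ -[1+ n ]
  minus zero    = refl
  minus (suc n) = cong (-[1+_] ∘ suc) (+-identityʳ n)
edges⇒edgeAt (x ∷ xs) k        ≢0 with k ℤ.≟ + x ℤ.- 1ℤ
... | yes p = 0 , trans p (cong (ℤ._- 1ℤ) (sym (ℤ.+-identityʳ (+ x))))
... | no _ with edges⇒edgeAt xs (k ℤ.+ 1ℤ) ≢0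
...   | i , p = suc i , ℤ-cancel (trans p (sym (edgeAt-suc x xs i)))
  where
  ℤ-cancel : ∀ {i j} → i ℤ.+ 1ℤ ≡ j ℤ.+ 1ℤ → i ≡ j
  ℤ-cancel {i} {j} eq = trans (sym (i+r-r i 1ℤ)) (trans (cong (ℤ._- 1ℤ) eq) (i+r-r j 1ℤ))

-- This trades the bounded search in `δ` for `edges`, on which induction over the parts is possible.
toℕ-δ : ∀ p k → toℕ (δ p k) ≡ edges (parts p) k
toℕ-δ p k = toℕ-if (edge? p k)
  (λ { (i , refl) → edges-edgeAt (Partition.sorted p) i })
  no-edge
  where
  toℕ-if : ∀ {P : Set} {n} (P? : Dec P) → (P → n ≡ 1) → (¬ P → n ≡ 0) → toℕ (if does P? then 1b else 0b) ≡ n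
  toℕ-if (yes p) f g = sym (f p)
  toℕ-if (no ¬p) f g = sym (g ¬p)

  no-edge : ¬ ∃ (IsEdge p k) → edges (parts p) k ≡ 0
  no-edge ¬edge with edges (parts p) k ≟ 0
  ... | yes ≡0 = ≡0
  ... | no  ≢0 = contradiction (edges⇒edgeAt (parts p) k ≢0) ¬edge

x≤y-1 : ∀ {x y} → x < y → + x ℤ.≤ + y ℤ.- 1ℤ
x≤y-1 {x} {suc y} (s≤s x≤y) = ℤ.+≤+ x≤y

edges-injective : ∀ {xs ys} → Linked _≥_ xs → All (0 <_) xs → Linked _≥_ ys → All (0 <_) ys →
                  edges xs ≗ edges ys → xs ≡ ys
edges-injective {[]}     {[]}     _ _ _ _ _ = refl
edges-injective {[]}     {suc y ∷ ys} _ _ _ (_ ∷ _) eq =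
  contradiction (trans (eq (+ y)) (cong (_+ edges ys (+ y ℤ.+ 1ℤ)) (⟦≡⟧-yes {+ y} refl))) λ ()
edges-injective {suc x ∷ xs} {[]} _ (_ ∷ _) _ _ eq =
  contradiction (trans (sym (eq (+ x))) (cong (_+ edges xs (+ x ℤ.+ 1ℤ)) (⟦≡⟧-yes {+ x} refl))) λ ()
edges-injective {x ∷ xs} {y ∷ ys} L (_ ∷ p) L′ (_ ∷ p′) eq with <-cmp x y
... | tri≈ _ refl _ = cong (x ∷_) (edges-injective (Linked.tail L) p (Linked.tail L′) p′ λ k →
        subst (λ k → edges xs k ≡ edges ys k) (i-r+r k 1ℤ)
          (+-cancelˡ-≡ ⟦ k ℤ.- 1ℤ ≡ + x ℤ.- 1ℤ ⟧ _ _ (eq (k ℤ.- 1ℤ))))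
-- `≤-refl ∷ L` repeats the head, so that `edges-above-head` bounds the edges of `x ∷ xs` itself.
-- The largest edge position thus determines the head.
... | tri< x<y _ _ = contradiction (trans (sym (edges-above-head (≤-refl ∷ L) (+ y ℤ.- 1ℤ) (x≤y-1 x<y)))
        (trans (eq (+ y ℤ.- 1ℤ)) (cong (_+ edges ys (+ y ℤ.- 1ℤ ℤ.+ 1ℤ)) (⟦≡⟧-yes {+ y ℤ.- 1ℤ} refl)))) λ ()
... | tri> _ _ y<x = contradiction (trans (sym (edges-above-head (≤-refl ∷ L′) (+ x ℤ.- 1ℤ) (x≤y-1 y<x)))
        (trans (sym (eq (+ x ℤ.- 1ℤ))) (cong (_+ edges xs (+ x ℤ.- 1ℤ ℤ.+ 1ℤ)) (⟦≡⟧-yes {+ x ℤ.- 1ℤ} refl)))) λ ()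

δ-injective : ∀ {p q} → δ p ≗ δ q → p ≡ q
δ-injective {p} {q} eq = same (edges-injective (Partition.sorted p) (Partition.positive p)
    (Partition.sorted q) (Partition.positive q)
    (λ k → trans (sym (toℕ-δ p k)) (trans (cong toℕ (eq k)) (toℕ-δ q k))))
  where
  same : ∀ {p q} → parts p ≡ parts q → p ≡ q
  same {partition xs s p} {partition .xs s′ p′} refl =
    cong₂ (partition xs) (Linked.irrelevant ≤-irrelevant s s′) (All.irrelevant ≤-irrelevant p p′)

-- Charge and first moment of an edge sequence

∑-point : ∀ n (f : ℕ → ℕ) k → k < n → ∑ n (λ j → f j * ⟦ + j ≡ + k ⟧) ≡ f k
∑-point (suc n) f k k<1+n with n ≟ k
... | yes refl = cong₂ _+_ (∑-zero n λ j j<n → trans (cong (f j *_) (⟦≡⟧-no (<⇒≢ j<n ∘ ℤ.+-injective))) (*-zeroʳ (f j)))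
                           (trans (cong (f n *_) (⟦≡⟧-yes {+ n} refl)) (*-identityʳ (f n)))
... | no n≢k = trans (cong₂ _+_ (∑-point n f k (≤∧≢⇒< (≤-pred k<1+n) (n≢k ∘ sym)))
                           (trans (cong (f n *_) (⟦≡⟧-no (n≢k ∘ ℤ.+-injective))) (*-zeroʳ (f n)))) (+-identityʳ (f k))

-- The weight is attached to the place j in the window, so moments remain natural numbers. The
-- length `L` is separate from the left end -M because removing a part moves that end by one and
-- keeps the length.
moment : (ℕ → ℕ) → ℕ → ℕ → List ℕ → ℕ
moment f M L xs = ∑ L (λ j → f j * edges xs (at M j))

moment-[] : ∀ f M L → M ≤ L → moment f M L [] ≡ ∑ M f
moment-[] f M L M≤L = begin
  moment f M L []                                      ≡⟨ cong (λ l → moment f M l []) (sym (m+[n∸m]≡n M≤L)) ⟩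
  moment f M (M + (L ∸ M)) []                          ≡⟨ ∑-split M (L ∸ M) _ ⟩
  moment f M M [] + ∑ (L ∸ M) (λ j → f (M + j) * edges [] (at M (M + j)))
    ≡⟨ cong₂ _+_ (∑-cong M λ j j<M → trans (cong (f j *_) (edges-small [] (at M j) (neg j j<M))) (*-identityʳ (f j)))
                 (∑-zero (L ∸ M) λ j _ → trans (cong (f (M + j) *_) (edges-large [] (at M (M + j)) (pos j))) (*-zeroʳ (f (M + j)))) ⟩
  ∑ M f + 0                                            ≡⟨ +-identityʳ _ ⟩
  ∑ M f                                                ∎
  where
  open ≡-Reasoning
  neg : ∀ j → j < M → at M j ℤ.< 0ℤ
  neg j j<M = subst (at M j ℤ.<_) (ℤ.+-inverseˡ (+ M)) (ℤ.+-monoʳ-< (ℤ.- + M) (ℤ.+<+ j<M))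
  pos : ∀ j → 0ℤ ℤ.≤ at M (M + j)
  pos j = subst (ℤ._≤ at M (M + j)) (ℤ.+-inverseˡ (+ M)) (ℤ.+-monoʳ-≤ (ℤ.- + M) (ℤ.+≤+ (m≤m+n M j)))

at-suc : ∀ M j → at (suc M) j ℤ.+ 1ℤ ≡ at M j
at-suc M j = trans (cong (λ M → ℤ.- M ℤ.+ + j ℤ.+ 1ℤ) (ℤ.pos-+ 1 M)) (eq (+ M) (+ j))
  where
  eq : ∀ M j → ℤ.- (1ℤ ℤ.+ M) ℤ.+ j ℤ.+ 1ℤ ≡ ℤ.- M ℤ.+ j
  eq = ℤ-Ring.solve-∀

at-suc-point : ∀ M j x → ⟦ at (suc M) j ≡ + x ℤ.- 1ℤ ⟧ ≡ ⟦ + j ≡ + (x + M) ⟧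
at-suc-point M j x = ⟦≡⟧-cong
  (λ p → trans (sym (eq₁ (+ suc M) (+ j))) (trans (cong (ℤ._+_ (+ suc M)) p) to))
  (λ p → trans (cong (ℤ._+_ (ℤ.- + suc M)) (trans p (sym to))) (eq₃ (+ suc M) (+ x ℤ.- 1ℤ)))
  where
  eq₁ : ∀ M j → M ℤ.+ (ℤ.- M ℤ.+ j) ≡ j
  eq₁ = ℤ-Ring.solve-∀
  eq₂ : ∀ M x → 1ℤ ℤ.+ M ℤ.+ (x ℤ.- 1ℤ) ≡ x ℤ.+ M
  eq₂ = ℤ-Ring.solve-∀
  eq₃ : ∀ M x → ℤ.- M ℤ.+ (M ℤ.+ x) ≡ x
  eq₃ = ℤ-Ring.solve-∀
  to : + suc M ℤ.+ (+ x ℤ.- 1ℤ) ≡ + (x + M)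
  to = trans (cong (ℤ._+ (+ x ℤ.- 1ℤ)) (ℤ.pos-+ 1 M)) (trans (eq₂ (+ M) (+ x)) (sym (ℤ.pos-+ x M)))

moment-∷ : ∀ f M L x xs → x + M < L → moment f (suc M) L (x ∷ xs) ≡ f (x + M) + moment f M L xs
moment-∷ f M L x xs lt = begin
  ∑ L (λ j → f j * edges (x ∷ xs) (at (suc M) j))
    ≡⟨ ∑-≗ L (λ j → trans (cong (f j *_) (cong₂ _+_ (at-suc-point M j x) (cong (edges xs) (at-suc M j)))) (*-distribˡ-+ (f j) _ _)) ⟩
  ∑ L (λ j → f j * ⟦ + j ≡ + (x + M) ⟧ + f j * edges xs (at M j))
    ≡⟨ ∑-+ L _ _ ⟩
  ∑ L (λ j → f j * ⟦ + j ≡ + (x + M) ⟧) + moment f M L xs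
    ≡⟨ cong (_+ moment f M L xs) (∑-point L f (x + M) lt) ⟩
  f (x + M) + moment f M L xs ∎
  where open ≡-Reasoning

part-fits : ∀ x xs M L → sum (x ∷ xs) + (length (x ∷ xs) + M) ≤ L → x + (length xs + M) < L
part-fits x xs M L le = ≤-trans (≤-reflexive (sym (+-suc x _))) (≤-trans (+-monoˡ-≤ (suc (length xs + M)) (m≤m+n x (sum xs))) le)

rest-fits : ∀ x xs M L → sum (x ∷ xs) + (length (x ∷ xs) + M) ≤ L → sum xs + (length xs + M) ≤ L
rest-fits x xs M L le = ≤-trans (+-mono-≤ (m≤n+m (sum xs) x) (n≤1+n _)) le

charge : ∀ xs M L → sum xs + (length xs + M) ≤ L → moment (λ _ → 1) (length xs + M) L xs ≡ length xs + M
charge []       M L le = trans (moment-[] (λ _ → 1) M L le) (count M)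
  where
  count : ∀ n → ∑ n (λ _ → 1) ≡ n
  count zero    = refl
  count (suc n) = trans (cong (_+ 1) (count n)) (+-comm n 1)
charge (x ∷ xs) M L le = trans (moment-∷ (λ _ → 1) (length xs + M) L x xs (part-fits x xs M L le))
  (cong suc (charge xs M L (rest-fits x xs M L le)))

-- Each part moves one bit of the empty partition to the right by its own length; the sum of `id` is
-- the moment of the empty partition.
first-moment : ∀ xs M L → sum xs + (length xs + M) ≤ L →
               moment id (length xs + M) L xs ≡ sum xs + ∑ (length xs + M) id
first-moment []       M L le = moment-[] id M L le
first-moment (x ∷ xs) M L le = trans (moment-∷ id (length xs + M) L x xs (part-fits x xs M L le))
  (trans (cong (_+_ (x + (length xs + M))) (first-moment xs M L (rest-fits x xs M L le)))
         (eq x (length xs + M) (sum xs) (∑ (length xs + M) id)))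
  where
  eq : ∀ x m s t → x + m + (s + t) ≡ x + s + (t + m)
  eq = ℕ-Ring.solve-∀

wide : ∀ p N → sum (parts p) + length (parts p) ≤ N →
       ∃ λ M → N ≡ length (parts p) + M × sum (parts p) + (length (parts p) + M) ≤ N + N
wide p N le = N ∸ length (parts p) , sym N≡ ,
  +-mono-≤ (≤-trans (m≤m+n _ (length (parts p))) le) (≤-reflexive N≡)
  where
  N≡ : length (parts p) + (N ∸ length (parts p)) ≡ N
  N≡ = m+[n∸m]≡n (≤-trans (m≤n+m _ (sum (parts p))) le)

δ-charge : ∀ p → Eventually λ N → ∑[ N ] (toℕ ∘ δ p) ≡ N
δ-charge p = sum (parts p) + length (parts p) , λ N le → go N (wide p N le)
  where
  go : ∀ N → _ → ∑[ N ] (toℕ ∘ δ p) ≡ N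
  go N (M , refl , fits) = trans (∑-≗ (N + N) (λ j → trans (toℕ-δ p (at N j)) (sym (+-identityʳ _))))
    (charge (parts p) M (N + N) fits)

δ-first-moment : ∀ p → Eventually λ N → ∑ (N + N) (λ j → j * toℕ (δ p (at N j))) ≡ size p + ∑ N id
δ-first-moment p = sum (parts p) + length (parts p) , λ N le → go N (wide p N le)
  where
  go : ∀ N → _ → ∑ (N + N) (λ j → j * toℕ (δ p (at N j))) ≡ size p + ∑ N id
  go N (M , refl , fits) = trans (∑-≗ (N + N) (λ j → cong (j *_) (toℕ-δ p (at N j))))
    (first-moment (parts p) M (N + N) fits)

Ends : BitSeq → ℕ → Set
Ends s N = (∀ k → k ℤ.< ℤ.- + N → s k ≡ 1b) × (∀ k → + N ℤ.≤ k → s k ≡ 0b)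

δ-ends : ∀ p → Eventually (Ends (δ p))
δ-ends p = sum (parts p) + length (parts p) , λ N le →
    (λ k k<-N → Fin.toℕ-injective (trans (toℕ-δ p k) (edges-small (parts p) k (ℤ.<-≤-trans k<-N
      (ℤ.neg-mono-≤ (ℤ.+≤+ (≤-trans (m≤n+m _ (sum (parts p))) le)))))))
  , (λ k N≤k → Fin.toℕ-injective (trans (toℕ-δ p k) (edges-large (parts p) k
      (ℤ.≤-trans (ℤ.+≤+ (≤-trans (m≤m+n _ (length (parts p))) le)) N≤k))))

-- Partitions from bit sequences

module Build (g : ℕ → Bit) where

  zeros ones : ℕ → ℕ
  zeros L = ∑ L (λ j → 1 ∸ toℕ (g j))
  ones  L = ∑ L (toℕ ∘ g)

  zeros+ones : ∀ L → zeros L + ones L ≡ L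
  zeros+ones zero    = refl
  zeros+ones (suc L) = trans (eq (zeros L) (ones L) (1 ∸ toℕ (g L)) (toℕ (g L)))
    (trans (cong₂ _+_ (zeros+ones L) (m∸n+n≡m (bit≤1 (g L)))) (+-comm L 1))
    where
    eq : ∀ a b c d → a + c + (b + d) ≡ a + b + (c + d)
    eq = ℕ-Ring.solve-∀

  -- Discarding `xs` at a part 0 loses nothing: as long as no bit 0 has been read, the list is empty
  -- by `build-[]`.
  add : Bit → ℕ → List ℕ → List ℕ
  add 𝟘 _       xs = xs
  add 𝟙 zero    xs = []
  add 𝟙 (suc z) xs = suc z ∷ xs

  -- Reading the bits from the left, a bit 1 contributes a part that counts
  -- the preceding bits 0.
  build : ℕ → List ℕ
  build zero    = []
  build (suc L) = add (g L) (zeros L) (build L)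

  build-[] : ∀ L → zeros L ≡ 0 → build L ≡ []
  build-[] zero    _ = refl
  build-[] (suc L) z with g L
  ... | 𝟘 = contradiction (trans (sym (m+n≡0⇒n≡0 (zeros L) z)) refl) λ ()
  ... | 𝟙 rewrite m+n≡0⇒m≡0 (zeros L) z = refl

  add-sorted : ∀ b z xs → Linked _≥_ (z ∷ xs) → Linked _≥_ (z + (1 ∸ toℕ b) ∷ add b z xs)
  add-sorted 𝟘 z       []       _         = [-]
  add-sorted 𝟘 z       (x ∷ xs) (x≤z ∷ L) = ≤-trans x≤z (m≤m+n z 1) ∷ L
  add-sorted 𝟙 zero    xs       _         = [-]
  add-sorted 𝟙 (suc z) xs       L         = ≤-reflexive (sym (+-identityʳ (suc z))) ∷ L

  -- The extra head `zeros L` strengthens the induction: it bounds all parts so far and is the next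
  -- part to be added.
  build-sorted : ∀ L → Linked _≥_ (zeros L ∷ build L)
  build-sorted zero    = [-]
  build-sorted (suc L) = add-sorted (g L) (zeros L) (build L) (build-sorted L)

  build-positive : ∀ L → All (0 <_) (build L)
  build-positive zero    = []
  build-positive (suc L) with g L | zeros L
  ... | 𝟘 | _     = build-positive L
  ... | 𝟙 | zero  = []
  ... | 𝟙 | suc z = z<s ∷ build-positive L

  extended : ℕ → ℤ → ℕ
  extended L -[1+ _ ] = 1
  extended L (+ j)    = if does (j <? L) then toℕ (g j) else 0

  extended-suc : ∀ L k → extended (suc L) k ≡ toℕ (g L) * ⟦ k ≡ + L ⟧ + extended L k
  extended-suc L -[1+ n ] = sym (cong (_+ 1) (trans (cong (toℕ (g L) *_) (⟦≡⟧-no { -[1+ n ]} {+ L} λ ())) (*-zeroʳ (toℕ (g L)))))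
  extended-suc L (+ j) with <-cmp j L
  ... | tri< j<L j≢L _ rewrite dec-true (j <? suc L) (m<n⇒m<1+n j<L) | dec-true (j <? L) j<L
                             | ⟦≡⟧-no {+ j} {+ L} (j≢L ∘ ℤ.+-injective) | *-zeroʳ (toℕ (g L)) = refl
  ... | tri≈ j≮L refl _ rewrite dec-true (j <? suc j) (n<1+n j) | dec-false (j <? j) j≮L
                             | ⟦≡⟧-yes {+ j} refl | *-identityʳ (toℕ (g j)) | +-identityʳ (toℕ (g j)) = refl
  ... | tri> j≮L j≢L L<j rewrite dec-false (j <? suc L) (≤⇒≯ L<j) | dec-false (j <? L) j≮L
                             | ⟦≡⟧-no {+ j} {+ L} (j≢L ∘ ℤ.+-injective) | *-zeroʳ (toℕ (g L)) = refl

  edges-0∷[] : ∀ k → edges (0 ∷ []) k ≡ edges [] k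
  edges-0∷[] (+ n)         = cong₂ _+_ (⟦≡⟧-no {+ n} {0ℤ ℤ.- 1ℤ} λ ()) refl
  edges-0∷[] -[1+ zero ]   = refl
  edges-0∷[] -[1+ suc n ]  = cong₂ _+_ (⟦≡⟧-no { -[1+ suc n ]} {0ℤ ℤ.- 1ℤ} λ ()) refl

  edges-add-𝟙 : ∀ z xs k → (z ≡ 0 → xs ≡ []) → edges (add 𝟙 z xs) k ≡ edges (z ∷ xs) k
  edges-add-𝟙 zero    xs k empty rewrite empty refl = sym (edges-0∷[] k)
  edges-add-𝟙 (suc z) xs k _     = refl

  -- Every part put in front shifts the edges by one, so after L bits the total shift is the number
  -- of bits 1 read.
  edges-build : ∀ L k → edges (build L) (k ℤ.- + ones L) ≡ extended L k
  edges-build zero    (+ j)    = trans (cong (edges []) (ℤ.+-identityʳ (+ j))) refl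
  edges-build zero    -[1+ j ] = refl
  edges-build (suc L) k = trans (by-bit (g L)) (sym (extended-suc L k))
    where
    eq₁ : ∀ k o → k ℤ.- (o ℤ.+ 1ℤ) ℤ.+ 1ℤ ≡ k ℤ.- o
    eq₁ = ℤ-Ring.solve-∀
    eq₂ : ∀ k o → k ℤ.- o ℤ.+ o ≡ k
    eq₂ = ℤ-Ring.solve-∀
    eq₃ : ∀ z o → z ℤ.- 1ℤ ℤ.+ (o ℤ.+ 1ℤ) ≡ z ℤ.+ o
    eq₃ = ℤ-Ring.solve-∀
    top : ∀ {k} → k ℤ.- + (ones L + 1) ≡ + zeros L ℤ.- 1ℤ → k ≡ + L
    top {k} p = trans (sym (eq₂ k (+ (ones L + 1)))) (trans (cong₂ ℤ._+_ p (ℤ.pos-+ (ones L) 1))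
      (trans (eq₃ (+ zeros L) (+ ones L)) (trans (sym (ℤ.pos-+ (zeros L) (ones L))) (cong +_ (zeros+ones L)))))
    top′ : ∀ {k} → k ≡ + L → k ℤ.- + (ones L + 1) ≡ + zeros L ℤ.- 1ℤ
    top′ refl = trans (cong₂ ℤ._-_ (trans (cong +_ (sym (zeros+ones L))) (ℤ.pos-+ (zeros L) (ones L))) (ℤ.pos-+ (ones L) 1))
      (eq₄ (+ zeros L) (+ ones L))
      where
      eq₄ : ∀ z o → z ℤ.+ o ℤ.- (o ℤ.+ 1ℤ) ≡ z ℤ.- 1ℤ
      eq₄ = ℤ-Ring.solve-∀
    by-bit : ∀ b → edges (add b (zeros L) (build L)) (k ℤ.- + (ones L + toℕ b)) ≡ toℕ b * ⟦ k ≡ + L ⟧ + extended L k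
    by-bit 𝟘 = trans (cong (λ o → edges (build L) (k ℤ.- + o)) (+-identityʳ (ones L))) (edges-build L k)
    by-bit 𝟙 = trans (edges-add-𝟙 (zeros L) (build L) _ (build-[] L)) (cong₂ _+_
      (trans (⟦≡⟧-cong {i′ = k} {j′ = + L} top top′) (sym (+-identityʳ _)))
      (trans (cong (edges (build L)) (trans (cong (λ o → k ℤ.- o ℤ.+ 1ℤ) (ℤ.pos-+ (ones L) 1)) (eq₁ k (+ ones L)))) (edges-build L k)))

-- The ends alone determine an edge sequence only up to a shift; the count of bits 1 selects the
-- right one.
Charged : BitSeq → ℕ → Set
Charged s N = Ends s N × ∑[ N ] (toℕ ∘ s) ≡ N

realise : ∀ s N → Charged s N → ∃ λ p → δ p ≗ s
realise s N ((left , right) , charge) = p , λ k → Fin.toℕ-injective (begin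
    toℕ (δ p k)                                            ≡⟨ toℕ-δ p k ⟩
    edges (build (N + N)) k                                ≡⟨ cong (edges (build (N + N)))
                                                                (trans (sym (i+r-r k (+ N))) (cong (λ o → k ℤ.+ + N ℤ.- + o) (sym charge))) ⟩
    edges (build (N + N)) (k ℤ.+ + N ℤ.- + ones (N + N))   ≡⟨ edges-build (N + N) (k ℤ.+ + N) ⟩
    extended (N + N) (k ℤ.+ + N)                           ≡⟨ extended≡ k (k ℤ.+ + N) refl ⟩
    toℕ (s k)                                              ∎)
  where
  open ≡-Reasoning
  open Build (s ∘ at N)

  p : Partition
  p = partition (build (N + N)) (Linked.tail (build-sorted (N + N))) (build-positive (N + N))

  k≡at : ∀ k j → k ℤ.+ + N ≡ + j → k ≡ at N j
  k≡at k j eq = trans (sym (i+r-r k (+ N))) (trans (cong (ℤ._- + N) eq) (ℤ.+-comm (+ j) (ℤ.- + N)))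

  extended≡ : ∀ k x → k ℤ.+ + N ≡ x → extended (N + N) x ≡ toℕ (s k)
  extended≡ k -[1+ n ] eq = sym (cong toℕ (left k (<-linear 0 (ℤ.-<+ {n} {0})
      (trans (ring k (+ N)) (cong (λ x → 0ℤ ℤ.- x ℤ.+ 0ℤ) eq)))))
    where
    ring : ∀ k N → ℤ.- N ℤ.- k ≡ 0ℤ ℤ.- (k ℤ.+ N) ℤ.+ 0ℤ
    ring = ℤ-Ring.solve-∀
  extended≡ k (+ j) eq with j <? N + N
  ... | yes j< = trans (cong (if_then toℕ (s (at N j)) else 0) (dec-true (j <? N + N) j<))
      (cong (toℕ ∘ s) (sym (k≡at k j eq)))
  ... | no j≮ = trans (cong (if_then toℕ (s (at N j)) else 0) (dec-false (j <? N + N) j≮)) (sym (cong toℕ (right k (subst (+ N ℤ.≤_) (sym (k≡at k j eq))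
      (≤-linear 0 (ℤ.+≤+ (≮⇒≥ j≮)) (trans (ring (+ N) (+ j)) (cong (λ x → + j ℤ.- x ℤ.+ 0ℤ) (sym (ℤ.pos-+ N N)))))))))
    where
    ring : ∀ N j → ℤ.- N ℤ.+ j ℤ.- N ≡ j ℤ.- (N ℤ.+ N) ℤ.+ 0ℤ
    ring = ℤ-Ring.solve-∀

-- Strips between partitions

module _ {r s t w c} (S : Strip r s t w c) where

  flow′ : ∀ i → toℕ (t i) + c (i ℤ.+ + r) ≡ toℕ (s i) + c i
  flow′ i = subst (λ j → toℕ (t j) + c (i ℤ.+ + r) ≡ toℕ (s j) + c j) (i+r-r i (+ r)) (flow S (i ℤ.+ + r))

  strip-charge : Eventually λ N → ∑[ N ] (toℕ ∘ t) ≡ ∑[ N ] (toℕ ∘ s)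
  strip-charge = mapᴱ (λ N shift → +-cancelʳ-≡ (∑[ N ] c) _ _ (begin
      ∑[ N ] (toℕ ∘ t) + ∑[ N ] c                             ≡⟨ cong (_+_ (∑[ N ] (toℕ ∘ t))) (sym shift) ⟩
      ∑[ N ] (toℕ ∘ t) + ∑[ N ] (λ i → c (i ℤ.+ + r))         ≡⟨ sym (∑-+ (N + N) _ _) ⟩
      ∑[ N ] (λ i → toℕ (t i) + c (i ℤ.+ + r))                ≡⟨ ∑-≗ (N + N) (λ j → flow′ (at N j)) ⟩
      ∑[ N ] (λ i → toℕ (s i) + c i)                          ≡⟨ ∑-+ (N + N) _ _ ⟩
      ∑[ N ] (toℕ ∘ s) + ∑[ N ] c                             ∎)) (∑[]-shift r (finite S))
    where open ≡-Reasoning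

  -- Each ribbon moves a bit 1 by r places. Formally, `flow′` is summed with weight j and the
  -- departures are reindexed by r.
  strip-first-moment : Eventually λ N →
    ∑ (N + N) (λ j → j * toℕ (t (at N j))) ≡ ∑ (N + N) (λ j → j * toℕ (s (at N j))) + r * ∑[ N ] c
  strip-first-moment = mapᴱ go (window-margins r (finite S))
    where
    open ≡-Reasoning
    go : ∀ N → (∀ j → j < r → c (at N j) ≡ 0) × (∀ j → N + N ≤ j → c (at N j) ≡ 0) → _
    go N (low , high) = linear T (S′ + r * Σc)
        (cong₂ _+_ (cong₂ _+_ moments (sym shifted)) (cong (r *_) shift))
        (eq T U S′ V r Σc Σc⁺)
      where
      T  = ∑ (N + N) (λ j → j * toℕ (t (at N j)))
      S′ = ∑ (N + N) (λ j → j * toℕ (s (at N j)))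
      Σc = ∑[ N ] c
      U  = ∑ (N + N) (λ j → j * c (at N (r + j)))
      V  = ∑ (N + N) (λ j → j * c (at N j))
      Σc⁺ = ∑ (N + N) (λ j → c (at N (r + j)))
      moments : T + U ≡ S′ + V
      moments = trans (sym (∑-+ (N + N) _ _)) (trans (∑-≗ (N + N) λ j → begin
          j * toℕ (t (at N j)) + j * c (at N (r + j))        ≡⟨ sym (*-distribˡ-+ j _ _) ⟩
          j * (toℕ (t (at N j)) + c (at N (r + j)))          ≡⟨ cong (λ x → j * (toℕ (t (at N j)) + c x)) (sym (at-+ N j r)) ⟩
          j * (toℕ (t (at N j)) + c (at N j ℤ.+ + r))        ≡⟨ cong (j *_) (flow′ (at N j)) ⟩
          j * (toℕ (s (at N j)) + c (at N j))                ≡⟨ *-distribˡ-+ j _ _ ⟩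
          j * toℕ (s (at N j)) + j * c (at N j)              ∎) (∑-+ (N + N) _ _))
      shift : Σc⁺ ≡ Σc
      shift = ∑-shift (N + N) r (c ∘ at N) low high
      shifted : r * Σc⁺ + U ≡ V
      shifted = trans (cong (_+ U) (sym (∑-* (N + N) r _))) (trans (sym (∑-+ (N + N) _ _))
        (trans (∑-≗ (N + N) (λ j → sym (*-distribʳ-+ (c (at N (r + j))) r j)))
          (∑-shift (N + N) r (λ j → j * c (at N j))
            (λ j j<r → trans (cong (j *_) (low j j<r)) (*-zeroʳ j))
            (λ j le → trans (cong (j *_) (high j le)) (*-zeroʳ j)))))
      eq : ∀ T U S V r c c⁺ → T + (S + V + (r * c⁺ + U) + r * c) ≡ S + r * c + (T + U + V + r * c⁺)
      eq = ℕ-Ring.solve-∀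

  strip-ends : Eventually λ N → ∀ k → k ℤ.< ℤ.- + N ⊎ + N ℤ.≤ k → s k ≡ t k
  strip-ends = M + r , λ N le k out → Fin.toℕ-injective (begin
      toℕ (s k)                       ≡⟨ sym (+-identityʳ _) ⟩
      toℕ (s k) + 0                   ≡⟨ cong (_+_ (toℕ (s k))) (sym (v k (outside N le k out))) ⟩
      toℕ (s k) + c k                 ≡⟨ sym (flow′ k) ⟩
      toℕ (t k) + c (k ℤ.+ + r)       ≡⟨ cong (_+_ (toℕ (t k))) (v _ (outside⁺ N le k out)) ⟩
      toℕ (t k) + 0                   ≡⟨ +-identityʳ _ ⟩
      toℕ (t k)                       ∎)
    where
    open ≡-Reasoning
    M = proj₁ (finite S)
    v = proj₂ (finite S)
    outside : ∀ N → M + r ≤ N → ∀ k → k ℤ.< ℤ.- + N ⊎ + N ℤ.≤ k → k ℤ.< ℤ.- + M ⊎ + M ℤ.≤ k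
    outside N le k (inj₁ k<) = inj₁ (ℤ.<-≤-trans k< (ℤ.neg-mono-≤ (ℤ.+≤+ (≤-trans (m≤m+n M r) le))))
    outside N le k (inj₂ ≤k) = inj₂ (ℤ.≤-trans (ℤ.+≤+ (≤-trans (m≤m+n M r) le)) ≤k)
    outside⁺ : ∀ N → M + r ≤ N → ∀ k → k ℤ.< ℤ.- + N ⊎ + N ℤ.≤ k → k ℤ.+ + r ℤ.< ℤ.- + M ⊎ + M ℤ.≤ k ℤ.+ + r
    outside⁺ N le k (inj₁ k<) = inj₁ (<-linear 0 (ℤ.<-≤-trans k< (ℤ.neg-mono-≤ (ℤ.+≤+ le)))
        (trans (eq k (+ M) (+ r)) (cong (λ x → ℤ.- x ℤ.- k ℤ.+ 0ℤ) (sym (ℤ.pos-+ M r)))))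
      where
      eq : ∀ k M r → ℤ.- M ℤ.- (k ℤ.+ r) ≡ ℤ.- (M ℤ.+ r) ℤ.- k ℤ.+ 0ℤ
      eq = ℤ-Ring.solve-∀
    outside⁺ N le k (inj₂ ≤k) = inj₂ (ℤ.≤-trans (ℤ.≤-trans (ℤ.+≤+ (≤-trans (m≤m+n M r) le)) ≤k) (ℤ.i≤i+j k (+ r)))

δ-charged : ∀ p → Eventually (Charged (δ p))
δ-charged p = zipᴱ (δ-ends p) (δ-charge p)

module _ {r : ℕ} {p : Partition} {w : BitSeq} {c : ℤ → ℕ} where

  -- Both ends and the charge pass through a strip, so `realise` applies.
  strip-target : ∀ {t} → Strip r (δ p) t w c → ∃ λ q → δ q ≗ t
  strip-target {t} S with zipᴱ (δ-charged p) (zipᴱ (strip-charge S) (strip-ends S))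
  ... | M , f with f M ≤-refl
  ...   | ((left , right) , ch) , eq , ends = realise t M
    (( (λ k k< → trans (sym (ends k (inj₁ k<))) (left k k<))
     , (λ k ≤k → trans (sym (ends k (inj₂ ≤k))) (right k ≤k))) , trans eq ch)

  strip-source : ∀ {s} → Strip r s (δ p) w c → ∃ λ q → δ q ≗ s
  strip-source {s} S with zipᴱ (δ-charged p) (zipᴱ (strip-charge S) (strip-ends S))
  ... | M , f with f M ≤-refl
  ...   | ((left , right) , ch) , eq , ends = realise s M
    (( (λ k k< → trans (ends k (inj₁ k<)) (left k k<))
     , (λ k ≤k → trans (ends k (inj₂ ≤k)) (right k ≤k))) , trans (sym eq) ch)

  strip-size : ∀ {q} → Strip r (δ p) (δ q) w c → Eventually λ N → size q ≡ size p + r * ∑[ N ] c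
  strip-size {q} S = mapᴱ (λ N (m , mp , mq) → linear (size q) (size p + r * ∑[ N ] c)
      (cong₂ _+_ (cong₂ _+_ m mp) (sym mq))
      (eq (size q) (size p) (r * ∑[ N ] c) (∑ N id)
        (∑ (N + N) (λ j → j * toℕ (δ p (at N j)))) (∑ (N + N) (λ j → j * toℕ (δ q (at N j))))))
    (zipᴱ (strip-first-moment S) (zipᴱ (δ-first-moment p) (δ-first-moment q)))
    where
    eq : ∀ q p rc t mp mq → q + (mp + rc + (p + t) + mq) ≡ p + rc + (mq + mp + (q + t))
    eq = ℕ-Ring.solve-∀

-- Linear functionals on vectors

-- |a| and n(a) are the cases of φ constantly 1 and φ = `toℕ`, so one telescoping argument serves
-- both the weight and the spin.
weighted : ∀ {r} → (Fin r → ℕ) → Vec ℕ r → ℕ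
weighted φ u = Vec.sum (tabulate λ x → φ x * lookup u x)

∣∣≡weighted : ∀ {r} (u : Vec ℕ r) → ∣ u ∣ᵥ ≡ weighted (const 1) u
∣∣≡weighted []      = refl
∣∣≡weighted (x ∷ u) = cong₂ _+_ (sym (+-identityʳ x)) (∣∣≡weighted u)

weighted-0 : ∀ {r} φ → weighted {r} φ 0ᵥ ≡ 0
weighted-0 {zero}  φ = refl
weighted-0 {suc r} φ = cong₂ _+_ (*-zeroʳ (φ Fin.zero)) (weighted-0 {r} (φ ∘ Fin.suc))

weighted-e : ∀ {r} φ (h : Fin r) → weighted φ (e h) ≡ φ h
weighted-e {suc r} φ Fin.zero    = trans (cong₂ _+_ (*-identityʳ (φ Fin.zero)) (weighted-0 {r} (φ ∘ Fin.suc))) (+-identityʳ _)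
weighted-e {suc r} φ (Fin.suc h) = cong₂ _+_ (*-zeroʳ (φ Fin.zero)) (weighted-e (φ ∘ Fin.suc) h)

weighted-linear : ∀ {r} φ (u v f : Vec ℕ r) p q →
  (∀ x → lookup u x + p * lookup f x ≡ lookup v x + q * lookup f x) →
  weighted φ u + p * weighted φ f ≡ weighted φ v + q * weighted φ f
weighted-linear φ []      []      []      p q eq = trans (*-zeroʳ p) (sym (*-zeroʳ q))
weighted-linear φ (x ∷ u) (y ∷ v) (z ∷ f) p q eq =
  linear _ _ (cong₂ _+_ (cong (φ₀ *_) (eq Fin.zero)) (weighted-linear (φ ∘ Fin.suc) u v f p q (eq ∘ Fin.suc)))
    (ring φ₀ x y z p q (weighted (φ ∘ Fin.suc) u) (weighted (φ ∘ Fin.suc) v) (weighted (φ ∘ Fin.suc) f))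
  where
  φ₀ = φ Fin.zero
  ring : ∀ φ x y z p q u v f →
    φ * x + u + p * (φ * z + f) + (φ * (y + q * z) + (v + q * f)) ≡
    φ * y + v + q * (φ * z + f) + (φ * (x + p * z) + (u + p * f))
  ring = ℕ-Ring.solve-∀

telescope : ∀ n (F : ℕ → ℕ) p q → (∀ j → F (suc j) + p j ≡ F j + q j) → F n + ∑ n p ≡ F 0 + ∑ n q
telescope zero    F p q eq = refl
telescope (suc n) F p q eq = linear _ _ (cong₂ _+_ (eq n) (telescope n F p q eq))
  (ring (F (suc n)) (F n) (F 0) (∑ n p) (∑ n q) (p n) (q n))
  where
  ring : ∀ f′ f f₀ P Q p q → f′ + (P + p) + (f + q + (f₀ + Q)) ≡ f₀ + (Q + q) + (f′ + p + (f + P))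
  ring = ℕ-Ring.solve-∀

eventually-∀< : ∀ {P : ℕ → ℕ → Set} → (∀ p → Eventually (P p)) → ∀ n → Eventually λ N → ∀ p → p < n → P p N
eventually-∀< f zero    = 0 , λ _ _ _ ()
eventually-∀< {P} f (suc n) = mapᴱ below (zipᴱ (f n) (eventually-∀< f n))
  where
  below : ∀ N → P n N × (∀ p → p < n → P p N) → ∀ p → p < suc n → P p N
  below N (last , rest) p p<1+n with p ≟ n
  ... | yes refl = last
  ... | no p≢n   = rest p (≤∧≢⇒< (≤-pred p<1+n) p≢n)

-- Weight and spin of a square

module _ {r} .{{_ : NonZero r}} {l m n k a≪ a≫} (S : Square r l m n k a≪ a≫) where
  open Square S

  counters : ∀ φ → Eventually λ N →
    weighted φ a≫ + ∑[ N ] (λ i → D i * E i * φ (h i)) ≡ weighted φ a≪ + ∑[ N ] (λ i → A i * B i * φ (h i))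
  counters φ = ∣ proj₁ left ∣ + ∣ proj₁ right ∣ , λ N le →
    subst₂ (λ u v → weighted φ v + ∑[ N ] (λ i → D i * E i * φ (h i)) ≡ weighted φ u + ∑[ N ] (λ i → A i * B i * φ (h i)))
      (proj₂ left (at N 0) (low N (proj₁ left) (≤-trans (m≤m+n _ ∣ proj₁ right ∣) le)))
      (proj₂ right (at N (N + N)) (high N (proj₁ right) (≤-trans (m≤n+m _ ∣ proj₁ left ∣) le)))
      (telescope (N + N) (λ j → weighted φ (a (at N j))) _ _ λ j →
        subst (λ i → weighted φ (a i) + D (at N j) * E (at N j) * φ (h (at N j))
                   ≡ weighted φ (a (at N j)) + A (at N j) * B (at N j) * φ (h (at N j)))
          (at-+ N j 1)
          (subst (λ x → weighted φ (a (at N j ℤ.+ 1ℤ)) + D (at N j) * E (at N j) * x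
                      ≡ weighted φ (a (at N j)) + A (at N j) * B (at N j) * x)
            (weighted-e φ (h (at N j)))
            (weighted-linear φ (a (at N j ℤ.+ 1ℤ)) (a (at N j)) (e (h (at N j)))
              (D (at N j) * E (at N j)) (A (at N j) * B (at N j)) (step (at N j)))))
    where
    -∣i∣≤i : ∀ i → ℤ.- + ∣ i ∣ ℤ.≤ i
    -∣i∣≤i (+ n)    = ℤ.neg-≤-pos
    -∣i∣≤i -[1+ n ] = ℤ.≤-refl
    i≤∣i∣ : ∀ i → i ℤ.≤ + ∣ i ∣
    i≤∣i∣ (+ n)    = ℤ.≤-refl
    i≤∣i∣ -[1+ n ] = ℤ.-≤+
    low : ∀ N i → ∣ i ∣ ≤ N → at N 0 ℤ.≤ i
    low N i le = ℤ.≤-trans (ℤ.≤-reflexive (ℤ.+-identityʳ _)) (ℤ.≤-trans (ℤ.neg-mono-≤ (ℤ.+≤+ le)) (-∣i∣≤i i))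
    high : ∀ N i → ∣ i ∣ ≤ N → i ℤ.≤ at N (N + N)
    high N i le = ℤ.≤-trans (i≤∣i∣ i) (ℤ.≤-trans (ℤ.+≤+ le) (ℤ.≤-reflexive
      (sym (trans (cong (ℤ._+_ (ℤ.- + N)) (ℤ.pos-+ N N)) (ring (+ N))))))
      where
      ring : ∀ N → ℤ.- N ℤ.+ (N ℤ.+ N) ≡ N
      ring = ℤ-Ring.solve-∀

  C≤1 : ∀ i → C i ≤ 1
  C≤1 = Strip.c≤1 k/l

  -- For bits A, B ≤ C one has DE = (C - A)(C - B) = C - A - B + AB, and C - A = D.
  exchange : ∀ i → D i + A i * B i ≡ B i + D i * E i
  exchange i = go (A i) (B i) (C i) (D i) (E i) (C≤1 i) (A+D≡C i) (B+E≡C i)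
    where
    go : ∀ a b c d e → c ≤ 1 → a + d ≡ c → b + e ≡ c → d + a * b ≡ b + d * e
    go zero zero          c zero e _ _ _ = refl
    go zero zero          c (suc zero) e _ refl refl = refl
    go zero (suc zero)    c (suc zero) zero _ refl _ = refl
    go zero (suc b) c zero e _ refl ()
    go zero b c (suc (suc d)) e (s≤s ()) refl q
    go zero (suc (suc b)) c (suc zero) e _ refl ()
    go zero (suc zero) c (suc zero) (suc e) _ refl ()
    go (suc zero) zero c zero e _ refl q = refl
    go (suc zero) (suc zero) c zero e _ refl q = refl
    go (suc zero) (suc (suc b)) c zero e _ refl ()
    go (suc zero) b c (suc d) e (s≤s ()) refl q
    go (suc (suc a)) b c d e (s≤s ()) refl q

  square-weight : a≫ ≡ 0ᵥ → Eventually λ N → ∑[ N ] D ≡ ∑[ N ] B + ∣ a≪ ∣ᵥ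
  square-weight refl = mapᴱ (λ N eq → linear (∑[ N ] D) (∑[ N ] B + ∣ a≪ ∣ᵥ)
      (cong₂ _+_ (exchanged N) (counted N eq))
      (ring (∑[ N ] D) (∑[ N ] B) ∣ a≪ ∣ᵥ (∑[ N ] AB) (∑[ N ] DE))) (counters (const 1))
    where
    AB DE : ℤ → ℕ
    AB i = A i * B i
    DE i = D i * E i
    ring : ∀ D B x AB DE → D + (B + DE + (x + AB)) ≡ B + x + (D + AB + DE)
    ring = ℕ-Ring.solve-∀
    exchanged : ∀ N → ∑[ N ] D + ∑[ N ] AB ≡ ∑[ N ] B + ∑[ N ] DE
    exchanged N = trans (sym (∑-+ (N + N) _ _)) (trans (∑-≗ (N + N) (λ j → exchange (at N j))) (∑-+ (N + N) _ _))
    counted : ∀ N → weighted (const 1) (0ᵥ {r}) + ∑[ N ] (λ i → DE i * 1) ≡ weighted (const 1) a≪ + ∑[ N ] (λ i → AB i * 1) →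
              ∑[ N ] DE ≡ ∣ a≪ ∣ᵥ + ∑[ N ] AB
    counted N eq = begin
      ∑[ N ] DE                                                ≡⟨ ∑-≗ (N + N) (λ j → sym (*-identityʳ (DE (at N j)))) ⟩
      ∑[ N ] (λ i → DE i * 1)                                  ≡⟨ cong (_+ ∑[ N ] (λ i → DE i * 1)) (sym (weighted-0 {r} (const 1))) ⟩
      weighted (const 1) (0ᵥ {r}) + ∑[ N ] (λ i → DE i * 1)    ≡⟨ eq ⟩
      weighted (const 1) a≪ + ∑[ N ] (λ i → AB i * 1)          ≡⟨ cong₂ _+_ (sym (∣∣≡weighted a≪)) (∑-≗ (N + N) (λ j → *-identityʳ (AB (at N j)))) ⟩
      ∣ a≪ ∣ᵥ + ∑[ N ] AB                                      ∎
      where open ≡-Reasoning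

2spin : ℕ → BitSeq → (ℤ → ℕ) → ℕ → ℕ
2spin r w c N = ∑[ N ] (λ i → c i * height r w i)

-- By uniqueness of the witness, the spin of arbitrary evidence can be computed from the strips of a
-- square.
spin-strip : ∀ {r s t w c} .{{_ : NonZero r}} (X : s ↽[ r ] t) → Strip r s t w c →
             Eventually λ N → sum (map (height r (_↽[_]_.w X)) (_↽[_]_.I X)) ≡ 2spin r w c N
spin-strip {r} {w = w} {c} X S = mapᴱ (λ N eq → trans eq (∑-≗ (N + N) λ j →
    cong₂ _*_ (proj₂ (unique (at N j))) (heights (at N j)))) (sum-ribbons X (height r (_↽[_]_.w X)))
  where
  unique = Strip-unique (strip X) S
  heights : ∀ i → height r (_↽[_]_.w X) i ≡ height r w i
  heights i = trans (height-∑ r (_↽[_]_.w X) i) (trans (∑-≗ (pred r) (λ p → cong toℕ (proj₁ (unique (i ℤ.- + suc p)))))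
    (sym (height-∑ r w i)))

-- The heights of m/l and k/m fall short of those of k/l by sums over the
-- ribbons of the other strip, and these correction terms cancel.
spin-composite : ∀ {r l m k w wA wD C A D} .{{_ : NonZero r}} →
  Strip r l k w C → Strip r l m wA A → Strip r m k wD D →
  Eventually λ N → 2spin r wD D N + 2spin r w A N ≡ 2spin r wA A N + 2spin r w D N
spin-composite {suc q} {l} {m} {k} {w} {wA} {wD} {C} {A} {D} SC SA SD =
  mapᴱ balance (eventually-∀< (λ p → ∑[]-shift {f p} (suc p) (f-finite p)) q)
  where
  r = suc q
  A+D = Strip-additive SC SA SD

  f : ℕ → ℤ → ℕ
  f p i = A i * D (i ℤ.- + suc p)
  f-finite : ∀ p → FinSupp (f p)
  f-finite p = proj₁ (finite SA) , λ i out → cong (_* D (i ℤ.- + suc p)) (proj₂ (finite SA) i out)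

  w≡wA+D : ∀ i → toℕ (w i) ≡ toℕ (wA i) + D i
  w≡wA+D i = trans (sym (source SC i)) (trans (cong (_+_ (toℕ (l i))) (sym (A+D i)))
    (trans (sym (+-assoc (toℕ (l i)) _ _)) (cong (_+ D i) (source SA i))))

  -- A bit that m/l moves from i to i + r has left m, the source of k/m, but still counts in w.
  w≡wD+A : ∀ i → toℕ (w i) ≡ toℕ (wD i) + A (i ℤ.+ + r)
  w≡wD+A i = trans (w≡wA+D i) (linear _ _
    (cong₂ _+_ (cong₂ _+_ (sym (source SA i)) (source SD i)) (sym (flow′ SA i)))
    (ring (toℕ (wA i)) (toℕ (wD i)) (A i) (D i) (A (i ℤ.+ + r)) (toℕ (l i)) (toℕ (m i))))
    where
    ring : ∀ wA wD A D A′ l m → wA + D + (l + A + wD + (m + A′)) ≡ wD + A′ + (wA + (m + D) + (l + A))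
    ring = ℕ-Ring.solve-∀

  height-A : ∀ i → height r w i ≡ height r wA i + ∑ q (λ p → D (i ℤ.- + suc p))
  height-A i = trans (height-∑ r w i) (trans (∑-≗ q (λ p → w≡wA+D (i ℤ.- + suc p)))
    (trans (∑-+ q _ _) (cong (_+ ∑ q (λ p → D (i ℤ.- + suc p))) (sym (height-∑ r wA i)))))

  height-D : ∀ i → height r w i ≡ height r wD i + ∑ q (λ p → A (i ℤ.+ + suc p))
  height-D i = trans (height-∑ r w i) (trans (∑-≗ q (λ p → w≡wD+A (i ℤ.- + suc p)))
    (trans (∑-+ q _ _) (cong₂ _+_ (sym (height-∑ r wD i)) (trans (∑-reverse q _) (∑-cong q λ p p<q → cong A (index p p<q))))))
    where
    index : ∀ p → p < q → i ℤ.- + suc (q ∸ suc p) ℤ.+ + r ≡ i ℤ.+ + suc p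
    index p p<q = trans (cong (λ x → i ℤ.- + suc (q ∸ suc p) ℤ.+ x)
        (trans (cong (λ x → + suc x) (sym (m∸n+n≡m p<q))) (ℤ.pos-+ (suc (q ∸ suc p)) (suc p))))
      (ring i (+ suc (q ∸ suc p)) (+ suc p))
      where
      ring : ∀ i x p → i ℤ.- x ℤ.+ (x ℤ.+ p) ≡ i ℤ.+ p
      ring = ℤ-Ring.solve-∀

  balance : ∀ N → (∀ p → p < q → ∑[ N ] (λ i → f p (i ℤ.+ + suc p)) ≡ ∑[ N ] (f p)) →
            2spin r wD D N + 2spin r w A N ≡ 2spin r wA A N + 2spin r w D N
  balance N shifts = begin
    2spin r wD D N + 2spin r w A N
      ≡⟨ cong (_+_ (2spin r wD D N)) (expand A wA (λ i → ∑ q (λ p → D (i ℤ.- + suc p))) height-A) ⟩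
    2spin r wD D N + (2spin r wA A N + ∑[ N ] (λ i → A i * ∑ q (λ p → D (i ℤ.- + suc p))))
      ≡⟨ cong (λ x → 2spin r wD D N + (2spin r wA A N + x)) cross ⟩
    2spin r wD D N + (2spin r wA A N + ∑[ N ] (λ i → D i * ∑ q (λ p → A (i ℤ.+ + suc p))))
      ≡⟨ ring (2spin r wD D N) (2spin r wA A N) _ ⟩
    2spin r wA A N + (2spin r wD D N + ∑[ N ] (λ i → D i * ∑ q (λ p → A (i ℤ.+ + suc p))))
      ≡⟨ cong (_+_ (2spin r wA A N)) (sym (expand D wD (λ i → ∑ q (λ p → A (i ℤ.+ + suc p))) height-D)) ⟩
    2spin r wA A N + 2spin r w D N ∎
    where
    open ≡-Reasoning
    ring : ∀ x y z → x + (y + z) ≡ y + (x + z)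
    ring = ℕ-Ring.solve-∀
    expand : ∀ c w′ (g : ℤ → ℕ) → (∀ i → height r w i ≡ height r w′ i + g i) →
             2spin r w c N ≡ 2spin r w′ c N + ∑[ N ] (λ i → c i * g i)
    expand c w′ g eq = trans (∑-≗ (N + N) λ j → trans (cong (c (at N j) *_) (eq (at N j))) (*-distribˡ-+ (c (at N j)) _ _))
                             (∑-+ (N + N) _ _)
    swap : ∀ (c : ℤ → ℕ) (g : ℕ → ℤ → ℕ) → ∑[ N ] (λ i → c i * ∑ q (λ p → g p i)) ≡ ∑ q (λ p → ∑[ N ] (λ i → c i * g p i))
    swap c g = trans (∑-≗ (N + N) λ j → sym (∑-* q (c (at N j)) (λ p → g p (at N j)))) (∑-swap (N + N) q _)
    -- Both sides count the pairs of a ribbon of m/l and a ribbon of k/m that lies fewer than r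
    -- places before it, once from either member.
    cross : ∑[ N ] (λ i → A i * ∑ q (λ p → D (i ℤ.- + suc p))) ≡ ∑[ N ] (λ i → D i * ∑ q (λ p → A (i ℤ.+ + suc p)))
    cross = trans (swap A (λ p i → D (i ℤ.- + suc p))) (trans
      (∑-cong q λ p p<q → trans (sym (shifts p p<q)) (∑-≗ (N + N) λ j →
        trans (cong (λ i → A (at N j ℤ.+ + suc p) * D i) (i+r-r (at N j) (+ suc p))) (*-comm (A (at N j ℤ.+ + suc p)) _)))
      (sym (swap D (λ p i → A (i ℤ.+ + suc p)))))

module _ {r} .{{_ : NonZero r}} {l m n k a≪} (S : Square r l m n k a≪ 0ᵥ) where
  open Square S

  -- Twice `exchange`, made symmetric by A + D = B + E; the factors 2 compensate for the one half in
  -- the spin.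
  exchange₂ : ∀ i x → D i * x + E i * x + 2 * (A i * B i * x) ≡ A i * x + B i * x + 2 * (D i * E i * x)
  exchange₂ i x = linear _ _ (cong₂ _+_
      (cong (_* x) (cong₂ _+_ (exchange S i) (exchange S i))) (cong (_* x) (trans (B+E≡C i) (sym (A+D≡C i)))))
    (ring (A i) (B i) (D i) (E i) x)
    where
    ring : ∀ a b d e x → d * x + e * x + 2 * (a * b * x) + ((b + d * e + (b + d * e)) * x + (a + d) * x) ≡
                         a * x + b * x + 2 * (d * e * x) + ((d + a * b + (d + a * b)) * x + (b + e) * x)
    ring = ℕ-Ring.solve-∀

  square-spin : Eventually λ N →
    2spin r wD D N + 2spin r wE E N ≡ 2spin r wA A N + 2spin r wB B N + 2 * n⟨ a≪ ⟩
  square-spin = mapᴱ combine (zipᴱ (spin-composite k/l m/l k/m) (zipᴱ (spin-composite k/l n/l k/n) (counters S toℕ)))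
    where
    H : ℤ → ℕ
    H = height r w
    combine : ∀ N → _ → 2spin r wD D N + 2spin r wE E N ≡ 2spin r wA A N + 2spin r wB B N + 2 * n⟨ a≪ ⟩
    combine N (e₁ , e₂ , e₃) = linear _ _
      (cong₂ _+_ (cong₂ _+_ e₁ e₂) (cong₂ _+_ exchanged (cong (2 *_) counted)))
      (ring (2spin r wD D N) (2spin r wE E N) (2spin r wA A N) (2spin r wB B N) n⟨ a≪ ⟩
        (2spin r w A N) (2spin r w B N) (2spin r w D N) (2spin r w E N) ABH DEH)
      where
      ABH = ∑[ N ] (λ i → A i * B i * H i)
      DEH = ∑[ N ] (λ i → D i * E i * H i)
      ring : ∀ sD sE sA sB n a b d e ab de →
        sD + sE + (sA + d + (sB + e) + (a + b + 2 * de + 2 * (n + ab))) ≡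
        sA + sB + 2 * n + (sD + a + (sE + b) + (d + e + 2 * ab + 2 * de))
      ring = ℕ-Ring.solve-∀
      split : ∀ f g h → ∑[ N ] (λ i → f i * H i + g i * H i + 2 * (h i * H i)) ≡
                        2spin r w f N + 2spin r w g N + 2 * ∑[ N ] (λ i → h i * H i)
      split f g h = trans (∑-+ (N + N) _ _) (cong₂ _+_ (∑-+ (N + N) _ _) (∑-* (N + N) 2 _))
      exchanged : 2spin r w D N + 2spin r w E N + 2 * ABH ≡ 2spin r w A N + 2spin r w B N + 2 * DEH
      exchanged = trans (sym (split D E (λ i → A i * B i)))
        (trans (∑-≗ (N + N) (λ j → exchange₂ (at N j) (H (at N j)))) (split A B (λ i → D i * E i)))
      counted : DEH ≡ n⟨ a≪ ⟩ + ABH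
      counted = trans (cong (_+ DEH) (sym (weighted-0 {r} toℕ))) (trans
        (cong (_+_ (weighted toℕ (0ᵥ {r}))) (∑-≗ (N + N) λ j → cong (D (at N j) * E (at N j) *_) (sym (toℕ-heightᶠ r w (at N j)))))
        (trans e₃ (cong (_+_ n⟨ a≪ ⟩) (∑-≗ (N + N) λ j → cong (A (at N j) * B (at N j) *_) (toℕ-heightᶠ r w (at N j))))))

-- The shape datum

reverse-reverse : ∀ s → reverse (reverse s) ≗ s
reverse-reverse s i = cong s (ℤ.neg-involutive i)

reverse-≗ : ∀ {s t} → reverse s ≗ reverse t → s ≗ t
reverse-≗ {s} {t} eq i = trans (sym (reverse-reverse s i)) (trans (eq (ℤ.- i)) (reverse-reverse t i))

δ-limits : ∀ p → ∃ (Ends (δ p))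
δ-limits p = _ , proj₂ (δ-ends p) _ ≤-refl

-- A record, so that the partitions can be inferred (δ is not injective for
-- unification).
record PartitionSquare {r : ℕ} .{{_ : NonZero r}} (l m n k : Partition) (a : Vec ℕ r) : Set where
  constructor ⟨_⟩
  field square : Square r (δ l) (δ m) (δ n) (δ k) a 0ᵥ

open PartitionSquare

module _ {r : ℕ} .{{_ : NonZero r}} where

  above-unique : ∀ {l m n k k′} {a : Vec ℕ r} → PartitionSquare l m n k a → PartitionSquare l m n k′ a → k ≡ k′
  above-unique {k = k} {k′} ⟨ S ⟩ ⟨ S′ ⟩ = δ-injective {k} {k′} (proj₁ (Square-unique S S′))

  below-unique : ∀ {l l′ m n k} {a a′ : Vec ℕ r} → PartitionSquare l m n k a → PartitionSquare l′ m n k a′ →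
                 (a , l) ≡ (a′ , l′)
  below-unique {l} {l′} ⟨ S ⟩ ⟨ S′ ⟩ =
    cong₂ _,_ (proj₂ unique) (δ-injective {l} {l′} (reverse-≗ (proj₁ unique)))
    where unique = Square-unique (Square-reverse S) (Square-reverse S′)

above-exists : ∀ r .{{_ : NonZero r}} {l m n} (a : Vec ℕ r) → l ↽ᵖ[ r ] m → l ↽ᵖ[ r ] n →
               ∃ λ k → PartitionSquare l m n k a
above-exists (suc q) {l} {m} {n} a m/l n/l = realised (squareFrom (δ-limits l))
  where
  squareFrom : ∃ (Ends (δ l)) → ∃ λ k → Square (suc q) (δ l) (δ m) (δ n) k a 0ᵥ
  squareFrom (N , left , right) = proj₂ (completion (strip m/l) (strip n/l) (ℤ.- + N) 1b left
    -- The bits 1 on the left give W = r, which no index reaches, so `a` is arbitrary.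
    (λ x r≤x → contradiction (Fin.toℕ<n x) (≤⇒≯ (subst (_≤ toℕ x) (*-identityʳ (suc q)) r≤x)))) (+ N) right

  realised : (∃ λ k → Square (suc q) (δ l) (δ m) (δ n) k a 0ᵥ) → ∃ λ k → PartitionSquare l m n k a
  realised (k , S) with strip-target {p = l} (Square.k/l S)
  ... | κ , κ≗k = κ , ⟨ Square-resp (λ _ → refl) (λ _ → refl) (λ _ → refl) (λ i → sym (κ≗k i)) S ⟩

below-exists : ∀ r .{{_ : NonZero r}} {m n k} → m ↽ᵖ[ r ] k → n ↽ᵖ[ r ] k →
               ∃ λ ((a , l) : Vec ℕ r × Partition) → PartitionSquare l m n k a
below-exists (suc q) {m} {n} {k} k/m k/n = realised (squareFrom (δ-limits k))
  where
  squareFrom : ∃ (Ends (δ k)) → ∃ λ l → ∃ λ a → Square (suc q) (reverse (δ k)) (reverse (δ m)) (reverse (δ n)) l 0ᵥ a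
  squareFrom (N , left , right) =
    proj₁ (completion (Strip-reverse (strip k/m)) (Strip-reverse (strip k/n)) (ℤ.- + N) 0b
      (λ i i<-N → right (ℤ.- i) (subst (ℤ._≤ ℤ.- i) (ℤ.neg-involutive (+ N)) (ℤ.neg-mono-≤ (ℤ.<⇒≤ i<-N))))
      -- Here W = 0 on the left, and the condition on all counters is met by a_≫ = 0.
      (λ x _ → Vec.lookup-replicate x 0))
    -- The bits 1 of `δ k` are known strictly below -N, hence the 1 after reversal.
    (1ℤ ℤ.+ + N) (λ i N<i → left (ℤ.- i) (ℤ.neg-mono-< (ℤ.suc[i]≤j⇒i<j N<i)))

  realised : (∃ λ l → ∃ λ a → Square (suc q) (reverse (δ k)) (reverse (δ m)) (reverse (δ n)) l 0ᵥ a) →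
             ∃ λ ((a , l) : Vec ℕ (suc q) × Partition) → PartitionSquare l m n k a
  realised (l , a , S) = (a , proj₁ λ′)  , ⟨ Square-resp (λ i → sym (proj₂ λ′ i)) (λ _ → refl) (λ _ → refl) (λ _ → refl) S′ ⟩
    where
    S′ : Square (suc q) (reverse l) (δ m) (δ n) (δ k) a 0ᵥ
    S′ = Square-resp (λ _ → refl) (reverse-reverse (δ m)) (reverse-reverse (δ n)) (reverse-reverse (δ k)) (Square-reverse S)
    λ′ : ∃ λ p → δ p ≗ reverse l
    λ′ = strip-source {p = k} (Square.k/l S′)

-- The sizes differ by r times the number of ribbons, so rounding down affects both quotients alike.
size/-strip : ∀ r .{{_ : NonZero r}} {p q w c} → Strip r (δ p) (δ q) w c →
              Eventually λ N → size/ r q ≡ size/ r p + ∑[ N ] c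
size/-strip r {p} {q} {c = c} S = mapᴱ (λ N eq → begin
    size q / r                          ≡⟨ cong (_/ r) (trans eq (cong (_+_ (size p)) (*-comm r (∑[ N ] c)))) ⟩
    (size p + ∑[ N ] c * r) / r         ≡⟨ +-distrib-/-∣ʳ (size p) (n∣m*n (∑[ N ] c)) ⟩
    size p / r + ∑[ N ] c * r / r       ≡⟨ cong (_+_ (size p / r)) (m*n/n≡m (∑[ N ] c) r) ⟩
    size p / r + ∑[ N ] c               ∎) (strip-size {p = p} {q = q} S)
  where open ≡-Reasoning

-- Grouped as (κ - μ) - (ν - λ), the left side is the number of ribbons of κ/μ minus that of ν/λ,
-- which `square-weight` evaluates.
weight-law : ∀ {r} .{{_ : NonZero r}} {l m n k : Partition} {a : Vec ℕ r} → PartitionSquare l m n k a →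
             + size/ r k ℤ.- + size/ r n ℤ.- + size/ r m ℤ.+ + size/ r l ≡ + ∣ a ∣ᵥ
weight-law {r} {l} {m} {n} {k} {a} ⟨ S ⟩ = constant (mapᴱ (λ N (eD , eB , e) → begin
    + size/ r k ℤ.- + size/ r n ℤ.- + size/ r m ℤ.+ + size/ r l
      ≡⟨ cong₂ (λ x y → x ℤ.- y ℤ.- + size/ r m ℤ.+ + size/ r l)
           (trans (cong +_ (trans eD (cong (_+_ (size/ r m)) e)))
             (trans (ℤ.pos-+ (size/ r m) _) (cong (ℤ._+_ (+ size/ r m)) (ℤ.pos-+ (∑[ N ] B) ∣ a ∣ᵥ))))
           (trans (cong +_ eB) (ℤ.pos-+ (size/ r l) (∑[ N ] B))) ⟩
    (+ size/ r m ℤ.+ (+ ∑[ N ] B ℤ.+ + ∣ a ∣ᵥ)) ℤ.- (+ size/ r l ℤ.+ + ∑[ N ] B) ℤ.- + size/ r m ℤ.+ + size/ r l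
      ≡⟨ ring (+ size/ r m) (+ ∑[ N ] B) (+ ∣ a ∣ᵥ) (+ size/ r l) ⟩
    + ∣ a ∣ᵥ ∎)
  (zipᴱ (size/-strip r {m} {k} k/m) (zipᴱ (size/-strip r {l} {n} n/l) (square-weight S refl))))
  where
  open ≡-Reasoning
  open Square S using (k/m; n/l; B)
  ring : ∀ m b a l → (m ℤ.+ (b ℤ.+ a)) ℤ.- (l ℤ.+ b) ℤ.- m ℤ.+ l ≡ a
  ring = ℤ-Ring.solve-∀

half-sum : ∀ x y u v n → x + y ≡ u + v + 2 * n →
           (+ x) ℚ./ 2 ℚ.+ (+ y) ℚ./ 2 ≡ (+ u) ℚ./ 2 ℚ.+ (+ v) ℚ./ 2 ℚ.+ (+ n) ℚ./ 1
half-sum x y u v n eq = ℚ.toℚᵘ-injective (begin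
    ℚ.toℚᵘ ((+ x) ℚ./ 2 ℚ.+ (+ y) ℚ./ 2)
      ≈⟨ +-homo _ _ (ℚ.toℚᵘ-fromℚᵘ (ℚᵘ.mkℚᵘ (+ x) 1)) (ℚ.toℚᵘ-fromℚᵘ (ℚᵘ.mkℚᵘ (+ y) 1)) ⟩
    ℚᵘ.mkℚᵘ (+ x) 1 ℚᵘ.+ ℚᵘ.mkℚᵘ (+ y) 1
      ≈⟨ ℚᵘ.*≡* cross ⟩
    ℚᵘ.mkℚᵘ (+ u) 1 ℚᵘ.+ ℚᵘ.mkℚᵘ (+ v) 1 ℚᵘ.+ ℚᵘ.mkℚᵘ (+ n) 0
      ≈⟨ ℚᵘ.≃-sym (+-homo _ _ (+-homo _ _ (ℚ.toℚᵘ-fromℚᵘ (ℚᵘ.mkℚᵘ (+ u) 1)) (ℚ.toℚᵘ-fromℚᵘ (ℚᵘ.mkℚᵘ (+ v) 1)))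
                              (ℚ.toℚᵘ-fromℚᵘ (ℚᵘ.mkℚᵘ (+ n) 0))) ⟩
    ℚ.toℚᵘ ((+ u) ℚ./ 2 ℚ.+ (+ v) ℚ./ 2 ℚ.+ (+ n) ℚ./ 1) ∎)
  where
  open import Relation.Binary.Reasoning.Setoid ℚᵘ.≃-setoid
  +-homo : ∀ p q {p′ q′} → ℚ.toℚᵘ p ℚᵘ.≃ p′ → ℚ.toℚᵘ q ℚᵘ.≃ q′ → ℚ.toℚᵘ (p ℚ.+ q) ℚᵘ.≃ p′ ℚᵘ.+ q′
  +-homo p q p≃ q≃ = ℚᵘ.≃-trans (ℚ.toℚᵘ-homo-+ p q) (ℚᵘ.+-cong p≃ q≃)
  cast : + x ℤ.+ + y ≡ + u ℤ.+ + v ℤ.+ + 2 ℤ.* + n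
  cast = trans (sym (ℤ.pos-+ x y)) (trans (cong +_ eq) (trans (ℤ.pos-+ (u + v) (2 * n))
    (cong₂ ℤ._+_ (ℤ.pos-+ u v) (ℤ.pos-* 2 n))))
  -- Each side has the unreduced denominator 4, so cross-multiplication brings out 8 times the
  -- integer identity.
  ring₁ : ∀ x y → (x ℤ.* + 2 ℤ.+ y ℤ.* + 2) ℤ.* + 4 ≡ + 8 ℤ.* (x ℤ.+ y)
  ring₁ = ℤ-Ring.solve-∀
  ring₂ : ∀ u v n → ((u ℤ.* + 2 ℤ.+ v ℤ.* + 2) ℤ.* 1ℤ ℤ.+ n ℤ.* + 4) ℤ.* + 4 ≡ + 8 ℤ.* (u ℤ.+ v ℤ.+ + 2 ℤ.* n)
  ring₂ = ℤ-Ring.solve-∀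
  cross : (+ x ℤ.* + 2 ℤ.+ + y ℤ.* + 2) ℤ.* + 4
        ≡ ((+ u ℤ.* + 2 ℤ.+ + v ℤ.* + 2) ℤ.* 1ℤ ℤ.+ + n ℤ.* + 4) ℤ.* + 4
  cross = trans (ring₁ (+ x) (+ y)) (trans (cong (ℤ._*_ (+ 8)) cast) (sym (ring₂ (+ u) (+ v) (+ n))))

ribbonHeights : ∀ {r s t} → s ↽[ r ] t → ℕ
ribbonHeights {r} t/s = sum (map (height r w) I)
  where open _↽[_]_ t/s

spin-law : ∀ {r} .{{_ : NonZero r}} {l m n k} {a : Vec ℕ r} → Square r l m n k a 0ᵥ →
           (k/m : m ↽[ r ] k) (k/n : n ↽[ r ] k) (m/l : l ↽[ r ] m) (n/l : l ↽[ r ] n) →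
           spin k/m ℚ.+ spin k/n ≡ spin m/l ℚ.+ spin n/l ℚ.+ (+ n⟨ a ⟩) ℚ./ 1
spin-law {r} {a = a} S k/m k/n m/l n/l = half-sum (ribbonHeights k/m) (ribbonHeights k/n) (ribbonHeights m/l) (ribbonHeights n/l) n⟨ a ⟩ (constant (mapᴱ
    (λ N (em , en , fm , fn , eq) → trans (cong₂ _+_ em en) (trans eq (cong (_+ 2 * n⟨ a ⟩) (sym (cong₂ _+_ fm fn)))))
    (zipᴱ (spin-strip k/m S.k/m) (zipᴱ (spin-strip k/n S.k/n)
      (zipᴱ (spin-strip m/l S.m/l) (zipᴱ (spin-strip n/l S.n/l) (square-spin S)))))))
  where module S = Square S

module _ (r : ℕ) .{{_ : NonZero r}} where

  module _ (m n k : Partition) (k/m : m ↽ᵖ[ r ] k) (k/n : n ↽ᵖ[ r ] k) where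

    below : Vec ℕ r × Partition
    below = proj₁ (below-exists r {m} {n} {k} k/m k/n)

    below-square : PartitionSquare (proj₂ below) m n k (proj₁ below)
    below-square = proj₂ (below-exists r {m} {n} {k} k/m k/n)

  shapeDatum : ShapeDatum r
  shapeDatum = record
    { bijection = λ μ ν → record
      { to = λ (κ , κ/μ , κ/ν) → below μ ν κ κ/μ κ/ν
          , ribbonStrip (Square.m/l (square (below-square μ ν κ κ/μ κ/ν)))
          , ribbonStrip (Square.n/l (square (below-square μ ν κ κ/μ κ/ν)))
      -- The construction takes the evidence as input while the setoid ignores it; uniqueness of the
      -- square closes the gap.
      ; cong = λ { {κ , κ/μ , κ/ν} {.κ , κ/μ′ , κ/ν′} refl →
          below-unique (below-square μ ν κ κ/μ κ/ν) (below-square μ ν κ κ/μ′ κ/ν′) }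
      -- Injectivity is uniqueness of the upper corner κ; surjectivity is its existence together
      -- with uniqueness of the pair (a, λ).
      ; bijective =
          (λ { {κ , κ/μ , κ/ν} {κ′ , κ/μ′ , κ/ν′} eq → above-unique (below-square μ ν κ κ/μ κ/ν)
              (subst (λ (a , l) → PartitionSquare l μ ν κ′ a) (sym eq) (below-square μ ν κ′ κ/μ′ κ/ν′)) })
        , (λ ((a , l) , μ/l , ν/l) → let (κ , S) = above-exists r {l} {μ} {ν} a μ/l ν/l in
            (κ , ribbonStrip (Square.k/m (square S)) , ribbonStrip (Square.k/n (square S)))
          , λ { {.κ , κ/μ , κ/ν} refl → below-unique (below-square μ ν κ κ/μ κ/ν) S })
      }
    ; weight = λ { μ ν κ κ/μ κ/ν a l refl → weight-law (below-square μ ν κ κ/μ κ/ν) }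
    }

  given : GivenBySquares shapeDatum
  given μ ν κ κ/μ κ/ν a l = mk⇔
    (λ { refl → square⇒basic (square (below-square μ ν κ κ/μ κ/ν)) })
    (λ S → below-unique ⟨ basic⇒square S ⟩ (below-square μ ν κ κ/μ κ/ν))

  determined : ∀ C → GivenBySquares C → shapeDatum ≋ C
  determined C givenC μ ν κ κ/μ κ/ν = Equivalence.from (givenC μ ν κ κ/μ κ/ν a l)
    (Equivalence.to (given μ ν κ κ/μ κ/ν a l) refl)
    where
    a = proj₁ (below μ ν κ κ/μ κ/ν)
    l = proj₂ (below μ ν κ κ/μ κ/ν)

  spinIdentity : SpinIdentity shapeDatum
  spinIdentity μ ν κ κ/μ κ/ν a l refl = spin-law (square (below-square μ ν κ κ/μ κ/ν)) κ/μ κ/ν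

theorem5p2p7 : (r : ℕ) .{{_ : NonZero r}} →
    ∃ λ (B : ShapeDatum r) →
    GivenBySquares B
    × (∀ (C : ShapeDatum r) → GivenBySquares C → B ≋ C)
    × SpinIdentity B
theorem5p2p7 r = shapeDatum r , given r , determined r , spinIdentity r
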